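{- Let $n$ and $q$ be positive integers with $q\ge 2$. There exists an edge-ordered graph $G$ on $N = 2^{8^{q+1}n^{2q-2}(\log_2 n)^q}$ vertices such that, for every $q$-coloring of the edges of $G$, there exists a monochromatic subgraph of $G$ containing a copy of every $n$-vertex edge-ordered graph $H$.
   Context: An edge-ordered graph is a finite simple graph together with a total ordering of its edges (equivalently, an assignment of distinct integer labels to its edges). Two edge-ordered graphs are equivalent if there is a graph isomorphism between them preserving the ordering of the edges. An edge-ordered graph $G$ contains a copy of an edge-ordered graph $H$ if some subgraph of $G$, with the edge-ordering inherited from $G$, is equivalent to $H$. -}

module Defs where

open import Data.Nat using (ℕ; zero; suc; _+_; _*_; _^_; _≤_; _<_)
open import Data.Fin using (Fin)
open import Data.Bool using (Bool; true; false; _∧_)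
open import Data.Product using (Σ; _×_; _,_; ∃-syntax)
open import Data.Sum using (_⊎_)
open import Relation.Binary.PropositionalEquality using (_≡_; _≢_)
open import Relation.Nullary using (¬_)
open import Function.Definitions using (Injective)

-- An edge-ordered graph on the vertex set Fin v: a finite simple graph
-- (symmetric, irreflexive adjacency) together with an injective labelling
-- of its edges by natural numbers (equivalently, a total order on edges;
-- only the relative order of labels matters).
record EOGraph (v : ℕ) : Set where
  field
    adj    : Fin v → Fin v → Bool
    label  : Fin v → Fin v → ℕ
    adj-sym    : ∀ x y → adj x y ≡ adj y x
    adj-irr    : ∀ x → adj x x ≡ false
    label-sym  : ∀ x y → label x y ≡ label y x
    label-inj  : ∀ a b c d → adj a b ≡ true → adj c d ≡ true →
                 label a b ≡ label c d →
                 (a ≡ c × b ≡ d) ⊎ (a ≡ d × b ≡ c)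

open EOGraph public

Edge : ∀ {v} → EOGraph v → Fin v → Fin v → Set
Edge G x y = adj G x y ≡ true

Contains : ∀ {v n} → EOGraph v → EOGraph n → Set
Contains {v} {n} G H =
  Σ (Fin n → Fin v) λ f →
    Injective _≡_ _≡_ f ×
    (∀ x y → Edge H x y → Edge G (f x) (f y)) ×
    (∀ x y z w → Edge H x y → Edge H z w →
       label H x y < label H z w → label G (f x) (f y) < label G (f z) (f w))

Colouring : ∀ {v} → EOGraph v → ℕ → Set
Colouring {v} G q =
  Σ (Fin v → Fin v → Fin q) λ c → ∀ x y → Edge G x y → c x y ≡ c y x

colourClass : ∀ {v q} (G : EOGraph v) → Colouring G q → Fin q → EOGraph v
colourClass {v} {q} G (c , c-sym) i = record
  { adj = λ x y → adj G x y ∧ isCol x y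
  ; label = label G
  ; adj-sym = symm
  ; adj-irr = irr
  ; label-sym = label-sym G
  ; label-inj = inj
  }
  where
  open import Data.Fin using (_≟_)
  open import Relation.Nullary using (yes; no; does)
  open import Relation.Binary.PropositionalEquality using (refl; sym; trans; cong)
  isCol : Fin v → Fin v → Bool
  isCol x y = does (c x y ≟ i)
  symm : ∀ x y → (adj G x y ∧ isCol x y) ≡ (adj G y x ∧ isCol y x)
  symm x y with adj G x y in exy | adj G y x in eyx
  ... | false | false = refl
  ... | true  | true  rewrite c-sym x y exy = refl
  ... | true  | false = ⊥ (trans (sym exy) (trans (adj-sym G x y) eyx))
    where
    ⊥ : true ≡ false → _
    ⊥ ()
  ... | false | true  = ⊥ (trans (sym eyx) (trans (adj-sym G y x) exy))
    where
    ⊥ : true ≡ false → _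
    ⊥ ()
  irr : ∀ x → (adj G x x ∧ isCol x x) ≡ false
  irr x rewrite adj-irr G x = refl
  fst : ∀ {a b} → (a ∧ b) ≡ true → a ≡ true
  fst {true} _ = refl
  inj : ∀ a b c' d → (adj G a b ∧ isCol a b) ≡ true → (adj G c' d ∧ isCol c' d) ≡ true →
        label G a b ≡ label G c' d → (a ≡ c' × b ≡ d) ⊎ (a ≡ d × b ≡ c')
  inj a b c' d p r e = label-inj G a b c' d (fst p) (fst r) e

-- Real-free encoding of  v ≤ 2 ^ (A · (log₂ n) ^ q)  for naturals v, A, n, q:
-- for every rational s/t (t > 0) with s/t > log₂ n, i.e. n ^ t < 2 ^ s,
-- we have log₂ v ≤ A·(s/t)^q, i.e. v ^ (t ^ q) ≤ 2 ^ (A · s ^ q).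
-- By density of the rationals and continuity this is equivalent to the
-- real inequality.
AtMostTwoPow : (A n q v : ℕ) → Set
AtMostTwoPow A n q v =
  ∀ (s t : ℕ) → 0 < t → n ^ t < 2 ^ s → v ^ (t ^ q) ≤ 2 ^ (A * s ^ q)

{-# OPTIONS --safe #-}
module Submission where

-- The host is a complete graph on 2^L vertices whose edges carry pseudo-random
-- labels, strings of Δ digits ordered lexicographically. A colour i that is not
-- universal misses some pattern of digits g i. A greedy embedding of g i in
-- colour i must get stuck, at two large sets B and C between which colour i is
-- rare among the edges with one more label digit prescribed. Finding such pairs
-- inside each other along a binary tree, where the second subtree of a node is
-- searched with the digits already prescribed by the first, yields n sets which
-- are pairwise sparse in colour i for one common label prefix. Doing this colour
-- by colour, each time inside the families of the previous colours, leaves n sets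
-- in which all colours but the last are rare. Sparseness in one colour has to
-- survive the shrinking caused by the next one, so the density thresholds are
-- nested powers. For the last colour this is avoided: by pseudo-randomness,
-- vertices can be chosen whose label neighbourhoods do not concentrate the edges
-- of the other colours.

open import Defs
open import Data.Nat
open import Data.Nat.Properties
open import Data.Nat.Divisibility using (n∣m*n)
open import Data.Nat.DivMod
  using (m≡m%n+[m/n]*n; m%n<n; +-distrib-/-∣ˡ; m*n/n≡m; m<n⇒m/n≡0; /-monoˡ-≤)
open import Data.Nat.Tactic.RingSolver using (solve-∀)
open import Data.Fin
  using (Fin; zero; suc; toℕ; fromℕ<; combine; remQuot; finToFun; funToFin)
import Data.Fin as Fin
import Data.Fin.Properties as Fin
open import Data.Bool using (Bool; true; false; _∧_; not; if_then_else_)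
import Data.Bool as Bool
open import Data.Bool.Properties using (∧-zeroʳ)
open import Data.List using (List; []; _∷_; _++_; length; lookup)
open import Data.List.Properties using (length-++)
open import Data.List.Relation.Unary.All as All using (All; []; _∷_)
import Data.List.Relation.Unary.All.Properties as All
open import Data.List.Relation.Unary.AllPairs as AllPairs using (AllPairs; []; _∷_)
import Data.List.Relation.Unary.AllPairs.Properties as AllPairs
open import Data.Product using (Σ; _×_; _,_; ∃; proj₁; proj₂; map₂)
open import Data.Sum using (_⊎_; inj₁; inj₂)
open import Data.Empty using (⊥; ⊥-elim)
open import Function using (_∘_)
open import Function.Definitions using (Injective)
open import Relation.Nullary using (¬_; Dec; yes; no; does)
open import Relation.Nullary.Decidable using (_×-dec_; _→-dec_; ¬?; dec-true; dec-false)
open import Relation.Binary.PropositionalEquality hiding (J)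
open import Relation.Binary.Definitions using (tri<; tri≈; tri>)
open import Algebra.Properties.Semiring.Sum +-*-semiring
  using (sum; sum-cong-≗; ∑-distrib-+; ∑-comm; *-distribˡ-sum; *-distribʳ-sum)
open import Algebra.Properties.CommutativeMonoid.Sum *-1-commutativeMonoid
  using () renaming (sum to prod; sum-cong-≗ to prod-cong; ∑-distrib-+ to prod-distrib)

-- Counting subsets of Fin N

-- Origin of the exponent `n^(2q-2) (log n)^q`. A pattern digit takes about `2 log n` bits, and a
-- tree with `n` leaves spends the digits of a whole search at each of its `n - 1` inner nodes. So
-- about `n^(q-1)` digits serve all `q` colours, and the number of labels is `2^κ` with `κ` of order
-- `n^(q-1) log n`. One prescribed label keeps only about a `2^(-κ)` share of the pairs, so before
-- the last embedding the other colours must be rarer than that. A greedy embedding cuts its target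
-- sets by up to the `n`-th power of its threshold; making the earlier colours survive this
-- multiplies the exponent of their density by `n` for each colour, which is the second factor
-- `n^(q-1)`. Sizes, in contrast to digits, are lost only along one branch of a tree, of depth about
-- `log n`; this gives the remaining `(log n)^(q-1)`. If sparseness in the last embedding were
-- merely passed on to smaller sets, it would have to start near `2^(-n κ)`, one factor `n` worse;
-- choosing vertices that do not concentrate the exceptional edges lets it start near `2^(-κ - 6n)`.

Sub : ℕ → Set
Sub ν = Fin ν → Bool

⟦_⟧ : Bool → ℕ
⟦ true ⟧ = 1
⟦ false ⟧ = 0

⟦∧⟧ : ∀ a b → ⟦ a ∧ b ⟧ ≡ ⟦ a ⟧ * ⟦ b ⟧
⟦∧⟧ true b = sym (*-identityˡ ⟦ b ⟧)
⟦∧⟧ false b = refl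

private variable
  ν : ℕ

infixr 6 _∩_
infix 4 _⊆_

_∩_ : Sub ν → Sub ν → Sub ν
(A ∩ B) x = A x ∧ B x

_⊆_ : Sub ν → Sub ν → Set
A ⊆ B = ∀ x → A x ≡ true → B x ≡ true

# : Sub ν → ℕ
# A = sum (λ x → ⟦ A x ⟧)

wsum : Sub ν → (Fin ν → ℕ) → ℕ
wsum A f = sum (λ x → ⟦ A x ⟧ * f x)

∧-intro : ∀ {a b} → a ≡ true → b ≡ true → a ∧ b ≡ true
∧-intro refl refl = refl

∧-elimˡ : ∀ {a b} → a ∧ b ≡ true → a ≡ true
∧-elimˡ {true} _ = refl

∧-elimʳ : ∀ {a b} → a ∧ b ≡ true → b ≡ true
∧-elimʳ {true} p = p

does-true : ∀ {P : Set} (d : Dec P) → does d ≡ true → P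
does-true (yes p) _ = p

true-does : ∀ {P : Set} (d : Dec P) → P → does d ≡ true
true-does (yes _) _ = refl
true-does (no ¬p) p = ⊥-elim (¬p p)

not-does : ∀ {P : Set} (d : Dec P) → not (does d) ≡ true → ¬ P
not-does (no ¬p) _ = ¬p

does-not : ∀ {P : Set} (d : Dec P) → ¬ P → not (does d) ≡ true
does-not (no _) _ = refl
does-not (yes p) ¬p = ⊥-elim (¬p p)

sum-mono : ∀ {n} {f g : Fin n → ℕ} → (∀ i → f i ≤ g i) → sum f ≤ sum g
sum-mono {zero} le = z≤n
sum-mono {suc n} le = +-mono-≤ (le zero) (sum-mono (le ∘ suc))

sum-const : ∀ n c → sum {n} (λ _ → c) ≡ n * c
sum-const zero c = refl
sum-const (suc n) c = cong (c +_) (sum-const n c)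

term≤sum : ∀ {n} (f : Fin n → ℕ) i → f i ≤ sum f
term≤sum f zero = m≤m+n _ _
term≤sum f (suc i) = ≤-trans (term≤sum (f ∘ suc) i) (m≤n+m _ _)

sum-mono-< : ∀ {n} {f g : Fin n → ℕ} → (∀ i → f i ≤ g i) → ∀ i → f i < g i → sum f < sum g
sum-mono-< le zero lt = +-mono-<-≤ lt (sum-mono (le ∘ suc))
sum-mono-< le (suc i) lt = +-mono-≤-< (le zero) (sum-mono-< (le ∘ suc) i lt)

⟦⟧-mono : ∀ {a b} → (a ≡ true → b ≡ true) → ⟦ a ⟧ ≤ ⟦ b ⟧
⟦⟧-mono {false} _ = z≤n
⟦⟧-mono {true} p rewrite p refl = ≤-refl

⟦⟧≤1 : ∀ a → ⟦ a ⟧ ≤ 1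
⟦⟧≤1 true = ≤-refl
⟦⟧≤1 false = z≤n

#-mono : {A B : Sub ν} → A ⊆ B → # A ≤ # B
#-mono p = sum-mono (λ x → ⟦⟧-mono (p x))

#-full : # {ν} (λ _ → true) ≡ ν
#-full {ν} = trans (sum-const ν 1) (*-identityʳ ν)

#-empty : # {ν} (λ _ → false) ≡ 0
#-empty {ν} = trans (sum-const ν 0) (*-zeroʳ ν)

#-pos : (A : Sub ν) → 0 < # A → ∃ λ x → A x ≡ true
#-pos {suc ν} A p with A zero in eq
... | true = zero , eq
... | false with #-pos (A ∘ suc) p
...   | x , q = suc x , q

wsum-≤ : {A : Sub ν} {f : Fin ν → ℕ} {a : ℕ} →
  (∀ x → A x ≡ true → f x ≤ a) → wsum A f ≤ # A * a
wsum-≤ {A = A} {f} {a} p =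
  ≤-trans (sum-mono pt) (≤-reflexive (sym (*-distribʳ-sum a (λ x → ⟦ A x ⟧))))
  where
  pt : ∀ x → ⟦ A x ⟧ * f x ≤ ⟦ A x ⟧ * a
  pt x with A x in eq
  ... | true = +-monoˡ-≤ 0 (p x eq)
  ... | false = z≤n

wsum-≥ : {A : Sub ν} {f : Fin ν → ℕ} {a : ℕ} →
  (∀ x → A x ≡ true → a ≤ f x) → # A * a ≤ wsum A f
wsum-≥ {A = A} {f} {a} p =
  ≤-trans (≤-reflexive (*-distribʳ-sum a (λ x → ⟦ A x ⟧))) (sum-mono pt)
  where
  pt : ∀ x → ⟦ A x ⟧ * a ≤ ⟦ A x ⟧ * f x
  pt x with A x in eq
  ... | true = +-monoˡ-≤ 0 (p x eq)
  ... | false = z≤n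

wsum-mono-⊆ : {A B : Sub ν} (f : Fin ν → ℕ) → A ⊆ B → wsum A f ≤ wsum B f
wsum-mono-⊆ f p = sum-mono (λ x → *-monoˡ-≤ (f x) (⟦⟧-mono (p x)))

wsum-*ˡ : (A : Sub ν) (f : Fin ν → ℕ) (a : ℕ) → a * wsum A f ≡ wsum A (λ x → a * f x)
wsum-*ˡ A f a = trans (*-distribˡ-sum a (λ x → ⟦ A x ⟧ * f x))
    (sum-cong-≗ (λ x → lem a ⟦ A x ⟧ (f x)))
  where
  lem : ∀ a b c → a * (b * c) ≡ b * (a * c)
  lem = solve-∀

wsum-swap : (Z W : Sub ν) (R : Fin ν → Sub ν) →
  wsum Z (λ x → # (W ∩ R x)) ≡ wsum W (λ y → # (Z ∩ λ x → R x y))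
wsum-swap Z W R = begin
  sum (λ x → ⟦ Z x ⟧ * sum (λ y → ⟦ W y ∧ R x y ⟧))
    ≡⟨ sum-cong-≗ (λ x → *-distribˡ-sum ⟦ Z x ⟧ (λ y → ⟦ W y ∧ R x y ⟧)) ⟩
  sum (λ x → sum (λ y → ⟦ Z x ⟧ * ⟦ W y ∧ R x y ⟧))
    ≡⟨ ∑-comm (λ x y → ⟦ Z x ⟧ * ⟦ W y ∧ R x y ⟧) ⟩
  sum (λ y → sum (λ x → ⟦ Z x ⟧ * ⟦ W y ∧ R x y ⟧))
    ≡⟨ sum-cong-≗ (λ y → sum-cong-≗ (λ x → pt x y)) ⟩
  sum (λ y → sum (λ x → ⟦ W y ⟧ * ⟦ Z x ∧ R x y ⟧))
    ≡⟨ sum-cong-≗ (λ y → sym (*-distribˡ-sum ⟦ W y ⟧ (λ x → ⟦ Z x ∧ R x y ⟧))) ⟩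
  sum (λ y → ⟦ W y ⟧ * sum (λ x → ⟦ Z x ∧ R x y ⟧)) ∎
  where
  open ≡-Reasoning
  lem : ∀ a b c → a * (b * c) ≡ b * (a * c)
  lem = solve-∀
  pt : ∀ x y → ⟦ Z x ⟧ * ⟦ W y ∧ R x y ⟧ ≡ ⟦ W y ⟧ * ⟦ Z x ∧ R x y ⟧
  pt x y rewrite ⟦∧⟧ (W y) (R x y) | ⟦∧⟧ (Z x) (R x y) = lem ⟦ Z x ⟧ ⟦ W y ⟧ ⟦ R x y ⟧

#≤∑# : ∀ {k} {A : Sub ν} {B : Fin k → Sub ν} →
  (∀ x → A x ≡ true → ∃ λ b → B b x ≡ true) → # A ≤ sum (λ b → # (B b))
#≤∑# {A = A} {B} p = ≤-trans (sum-mono pt) (≤-reflexive (∑-comm (λ x b → ⟦ B b x ⟧)))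
  where
  pt : ∀ x → ⟦ A x ⟧ ≤ sum (λ b → ⟦ B b x ⟧)
  pt x with A x in eq
  ... | false = z≤n
  ... | true with p x eq
  ...   | b , q = ≤-trans (≤-reflexive (cong ⟦_⟧ (sym q))) (term≤sum (λ b → ⟦ B b x ⟧) b)

max-avg : ∀ {k} (f : Fin (suc k) → ℕ) → ∃ λ b → sum f ≤ suc k * f b
max-avg {zero} f = zero , ≤-refl
max-avg {suc k} f with max-avg (f ∘ suc)
... | b , le with ≤-total (f zero) (f (suc b))
...   | inj₁ p = suc b , +-mono-≤ p le
...   | inj₂ p = zero , +-monoʳ-≤ (f zero) (≤-trans le (*-monoʳ-≤ (suc k) p))

min-avg : ∀ {k} (f : Fin (suc k) → ℕ) → ∃ λ b → suc k * f b ≤ sum f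
min-avg {zero} f = zero , ≤-refl
min-avg {suc k} f with min-avg (f ∘ suc)
... | b , le with ≤-total (f zero) (f (suc b))
...   | inj₂ p = suc b , +-mono-≤ p le
...   | inj₁ p = zero , +-monoʳ-≤ (f zero) (≤-trans (*-monoʳ-≤ (suc k) p) le)

split-size : (A B C : Sub ν) → (∀ x → A x ≡ true → B x ≡ true ⊎ C x ≡ true) → # A ≤ # B + # C
split-size A B C p = ≤-trans (sum-mono point) (≤-reflexive
    (∑-distrib-+ (λ x → ⟦ B x ⟧) (λ x → ⟦ C x ⟧)))
  where
  point : ∀ x → ⟦ A x ⟧ ≤ ⟦ B x ⟧ + ⟦ C x ⟧
  point x with A x in eq
  ... | false = z≤n
  ... | true with p x eq
  ...   | inj₁ b rewrite b = s≤s z≤n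
  ...   | inj₂ c rewrite c = m≤n+m 1 ⟦ B x ⟧

-- Averaging over independent choices

-- `κ` is the number of choices and `μ j` the total of `ψ j` over them: some choice does no worse
-- than the mean. All weights `u` are allowed, because it is the weights that change when choices
-- are combined.
Averages : ∀ {J : ℕ} (V : Set) (κ : ℕ) (μ : Fin J → ℕ) (ψ : Fin J → V → ℕ) → Set
Averages {J} V κ μ ψ = ∀ (u : Fin J → ℕ) →
  Σ V λ v → sum (λ j → u j * ψ j v) * κ ≤ sum (λ j → u j * μ j)

averages-Fin : ∀ {J k} (φ : Fin J → Fin (suc k) → ℕ) →
  Averages (Fin (suc k)) (suc k) (λ j → sum (φ j)) φ
averages-Fin {J} {k} φ u with min-avg (λ v → sum (λ j → u j * φ j v))
... | v , le = v , (begin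
    sum (λ j → u j * φ j v) * suc k      ≡⟨ *-comm (sum (λ j → u j * φ j v)) (suc k) ⟩
    suc k * sum (λ j → u j * φ j v)      ≤⟨ le ⟩
    sum (λ v → sum (λ j → u j * φ j v))  ≡⟨ ∑-comm (λ v j → u j * φ j v) ⟩
    sum (λ j → sum (λ v → u j * φ j v))  ≡⟨ sum-cong-≗ (λ j → sym (*-distribˡ-sum (u j) (φ j))) ⟩
    sum (λ j → u j * sum (φ j))          ∎)
  where open ≤-Reasoning

-- Conditional expectations. The tail is chosen while coordinate `zero` is still averaged, so
-- `μ zero j` joins the weights; then coordinate `zero` is chosen with the actual value of the tail
-- as weight.
averages-Π : ∀ {J} {V : Set} {κ} m {μ : Fin m → Fin J → ℕ} {ψ : Fin m → Fin J → V → ℕ} →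
  (∀ i → Averages V κ (μ i) (ψ i)) →
  Averages (Fin m → V) (κ ^ m) (λ j → prod (λ i → μ i j)) (λ j v → prod (λ i → ψ i j (v i)))
averages-Π zero avg u = (λ ()) , ≤-reflexive (*-identityʳ _)
averages-Π {κ = κ} (suc m) {μ} {ψ} avg u
  with averages-Π m {μ ∘ suc} {ψ ∘ suc} (avg ∘ suc) (λ j → u j * μ zero j)
... | v , le with avg zero (λ j → u j * prod (λ i → ψ (suc i) j (v i)))
...   | v₀ , le₀ = (λ { zero → v₀ ; (suc i) → v i }) , (begin
    sum (λ j → u j * (ψ zero j v₀ * rest j)) * (κ * κ ^ m)
      ≡⟨ sym (*-assoc (sum (λ j → u j * (ψ zero j v₀ * rest j))) κ (κ ^ m)) ⟩
    sum (λ j → u j * (ψ zero j v₀ * rest j)) * κ * κ ^ m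
      ≡⟨ cong (λ z → z * κ * κ ^ m) (sum-cong-≗ (λ j → lem₁ (u j) (ψ zero j v₀) (rest j))) ⟩
    sum (λ j → u j * rest j * ψ zero j v₀) * κ * κ ^ m
      ≤⟨ *-monoˡ-≤ (κ ^ m) le₀ ⟩
    sum (λ j → u j * rest j * μ zero j) * κ ^ m
      ≡⟨ cong (_* κ ^ m) (sum-cong-≗ (λ j → lem₂ (u j) (rest j) (μ zero j))) ⟩
    sum (λ j → u j * μ zero j * rest j) * κ ^ m
      ≤⟨ le ⟩
    sum (λ j → u j * μ zero j * prod (λ i → μ (suc i) j))
      ≡⟨ sum-cong-≗ (λ j → *-assoc (u j) (μ zero j) _) ⟩
    sum (λ j → u j * (μ zero j * prod (λ i → μ (suc i) j))) ∎)
  where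
  open ≤-Reasoning
  rest : Fin _ → ℕ
  rest j = prod (λ i → ψ (suc i) j (v i))
  lem₁ : ∀ a b c → a * (b * c) ≡ a * c * b
  lem₁ = solve-∀
  lem₂ : ∀ a b c → a * b * c ≡ a * c * b
  lem₂ = solve-∀

-- Products of powers and growth of powers of `1 + 1/a`

prod-pow : ∀ {m} c (a : Fin m → ℕ) → prod (λ i → c ^ a i) ≡ c ^ sum a
prod-pow {zero} c a = refl
prod-pow {suc m} c a = trans (cong (c ^ a zero *_) (prod-pow c (a ∘ suc)))
  (sym (^-distribˡ-+-* c (a zero) (sum (a ∘ suc))))

prod-const : ∀ m c → prod {m} (λ _ → c) ≡ c ^ m
prod-const zero c = refl
prod-const (suc m) c = cong (c *_) (prod-const m c)

sum-delta : ∀ {k} (w : Fin (suc k)) a b → sum (λ c → if does (c Fin.≟ w) then a else b) ≡ a + k * b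
sum-delta {k} zero a b = cong (a +_) (sum-const k b)
sum-delta {suc k} (suc w) a b = trans (cong (b +_) (sum-delta w a b)) (lem a b (k * b))
  where
  lem : ∀ a b c → b + (a + c) ≡ a + (b + c)
  lem = solve-∀

-- With `a = j + i` this is `(1 + 1/a)^j ≤ (a + 1)/(a + 1 - j)`. The induction keeps `j + i` fixed,
-- which avoids subtraction.
bernoulli-up : ∀ j i → suc (j + i) ^ j * suc i ≤ (j + i) ^ j * suc (j + i)
bernoulli-up zero i = ≤-refl
bernoulli-up (suc j) i = begin
  (suc a * suc a ^ j) * suc i   ≡⟨ lem₁ (suc a) (suc a ^ j) (suc i) ⟩
  suc a ^ j * (suc a * suc i)   ≤⟨ *-monoʳ-≤ (suc a ^ j) step ⟩
  suc a ^ j * (a * suc (suc i)) ≡⟨ lem₂ (suc a ^ j) a (suc (suc i)) ⟩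
  a * (suc a ^ j * suc (suc i)) ≤⟨ *-monoʳ-≤ a ih ⟩
  a * (a ^ j * suc a)           ≡⟨ sym (*-assoc a (a ^ j) (suc a)) ⟩
  a * a ^ j * suc a             ∎
  where
  open ≤-Reasoning
  a = suc (j + i)
  ih : suc a ^ j * suc (suc i) ≤ a ^ j * suc a
  ih = subst (λ z → suc z ^ j * suc (suc i) ≤ z ^ j * suc z) (+-suc j i) (bernoulli-up j (suc i))
  lem₁ : ∀ a b c → (a * b) * c ≡ b * (a * c)
  lem₁ = solve-∀
  lem₂ : ∀ a b c → a * (b * c) ≡ b * (a * c)
  lem₂ = solve-∀
  lem₃ : ∀ a i → suc a * suc i ≡ a + a * i + suc i
  lem₃ = solve-∀
  lem₄ : ∀ a i → a * suc (suc i) ≡ a + a * i + a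
  lem₄ = solve-∀
  step : suc a * suc i ≤ a * suc (suc i)
  step = ≤-trans (≤-reflexive (lem₃ a i)) (≤-trans (+-monoʳ-≤ (a + a * i) (s≤s (m≤n+m i j)))
      (≤-reflexive (sym (lem₄ a i))))

-- Replaces a logarithm: with `K = 2j` labels the mean weight `(K + 1)/K` needs at least `K/2`
-- factors to reach 2. The halving is the reason for asking that the number of labels be even.
growth-up : ∀ j → suc (j + j) ^ j ≤ 2 * (j + j) ^ j
growth-up j = *-cancelʳ-≤ _ _ (suc j) (begin
  suc (j + j) ^ j * suc j          ≤⟨ bernoulli-up j j ⟩
  (j + j) ^ j * suc (j + j)        ≤⟨ *-monoʳ-≤ ((j + j) ^ j)
      (s≤s (≤-trans (n≤1+n (j + j)) (≤-reflexive (lem₁ j)))) ⟩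
  (j + j) ^ j * (suc j + suc j)    ≡⟨ lem₂ ((j + j) ^ j) (suc j) ⟩
  2 * (j + j) ^ j * suc j          ∎)
  where
  open ≤-Reasoning
  lem₁ : ∀ j → suc (j + j) ≡ j + suc j
  lem₁ j = sym (+-suc j j)
  lem₂ : ∀ a b → a * (b + b) ≡ 2 * a * b
  lem₂ = solve-∀

bernoulli-down : ∀ a t → a ^ t * (a + t) ≤ a * suc a ^ t
bernoulli-down a zero = ≤-reflexive (lem a)
  where
  lem : ∀ a → 1 * (a + 0) ≡ a * 1
  lem = solve-∀
bernoulli-down a (suc t) = begin
  a * a ^ t * (a + suc t)       ≡⟨ lem₁ a (a ^ t) t ⟩
  a ^ t * (a * a + a * t + a)   ≤⟨ *-monoʳ-≤ (a ^ t) (m≤m+n _ t) ⟩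
  a ^ t * (a * a + a * t + a + t) ≡⟨ lem₂ a (a ^ t) t ⟩
  a ^ t * (a + t) * suc a       ≤⟨ *-monoˡ-≤ (suc a) (bernoulli-down a t) ⟩
  a * suc a ^ t * suc a         ≡⟨ lem₃ a (suc a ^ t) (suc a) ⟩
  a * (suc a * suc a ^ t)       ∎
  where
  open ≤-Reasoning
  lem₁ : ∀ a b t → a * b * (a + suc t) ≡ b * (a * a + a * t + a)
  lem₁ = solve-∀
  lem₂ : ∀ a b t → b * (a * a + a * t + a + t) ≡ b * (a + t) * suc a
  lem₂ = solve-∀
  lem₃ : ∀ a b c → a * b * c ≡ a * (c * b)
  lem₃ = solve-∀

growth-down : ∀ a .{{_ : NonZero a}} → 2 * a ^ a ≤ suc a ^ a
growth-down a = *-cancelˡ-≤ a (begin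
  a * (2 * a ^ a)   ≡⟨ lem a (a ^ a) ⟩
  a ^ a * (a + a)   ≤⟨ bernoulli-down a a ⟩
  a * suc a ^ a     ∎)
  where
  open ≤-Reasoning
  lem : ∀ a b → a * (2 * b) ≡ b * (a + a)
  lem = solve-∀

^-distribʳ-* : ∀ a b n → (a * b) ^ n ≡ a ^ n * b ^ n
^-distribʳ-* a b zero = refl
^-distribʳ-* a b (suc n) rewrite ^-distribʳ-* a b n = lem a b (a ^ n) (b ^ n)
  where
  lem : ∀ a b c d → a * b * (c * d) ≡ a * c * (b * d)
  lem = solve-∀

2^-cancel-≤ : ∀ {a b} → 2 ^ a ≤ 2 ^ b → a ≤ b
2^-cancel-≤ {a} {b} p with a ≤? b
... | yes q = q
... | no q = ⊥-elim (<⇒≱ (^-monoʳ-< 2 (s≤s (s≤s z≤n)) (≰⇒> q)) p)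

-- Tail bounds from products of exponential weights

prod-dist₂ : ∀ {N} (g h : Fin N → Fin N → ℕ) →
  prod (λ x → prod (λ y → g x y * h x y)) ≡ prod (λ x → prod (g x)) * prod (λ x → prod (h x))
prod-dist₂ g h = trans (prod-cong (λ x → prod-distrib (g x) (h x)))
  (prod-distrib (λ x → prod (g x)) (λ x → prod (h x)))

prod-pow₂ : ∀ {N} c (s : Fin N → Fin N → ℕ) →
  prod (λ x → prod (λ y → c ^ s x y)) ≡ c ^ sum (λ x → sum (s x))
prod-pow₂ c s = trans (prod-cong (λ x → prod-pow c (s x))) (prod-pow c (λ x → sum (s x)))

module _ {N : ℕ} (K a J : ℕ) .{{_ : NonZero (prod {N} λ _ → prod {N} λ _ → a)}}
         (B H : Fin N → Fin N → Bool) (φ : Fin N → Fin N → ℕ) where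

  private
    P : (Fin N → Fin N → ℕ) → ℕ
    P g = prod (λ x → prod (g x))
    b h : ℕ
    b = sum (λ x → sum (λ y → ⟦ B x y ⟧))
    h = sum (λ x → sum (λ y → ⟦ H x y ⟧))
    A : ℕ
    A = P (λ _ _ → a)
    lem₁ : ∀ x y z → x * y * z ≡ x * z * y
    lem₁ = solve-∀
    lem₂ : ∀ p x y z → p * (x * y * z) ≡ p * (x * z) * y
    lem₂ = solve-∀

  -- In use, `φ` is the constant `a` outside `B` and `2 ^ ⟦ H x y ⟧ * K` inside. An extra factor `a`
  -- on `B` makes the pointwise formula uniform, so the product over all pairs can be split and the
  -- common power of `a` cancelled.
  upper-tail : (∀ x y → φ x y * a ^ ⟦ B x y ⟧ ≡ 2 ^ ⟦ H x y ⟧ * K ^ ⟦ B x y ⟧ * a) →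
    P φ ≤ J * A → 2 ^ h * K ^ b ≤ J * a ^ b
  upper-tail point le = *-cancelʳ-≤ (2 ^ h * K ^ b) (J * a ^ b) A (begin
    2 ^ h * K ^ b * A
      ≡⟨ cong (_* A) (cong₂ _*_ (sym (prod-pow₂ 2 (λ x y → ⟦ H x y ⟧)))
          (sym (prod-pow₂ K (λ x y → ⟦ B x y ⟧)))) ⟩
    P (λ x y → 2 ^ ⟦ H x y ⟧) * P (λ x y → K ^ ⟦ B x y ⟧) * A
      ≡⟨ cong (_* A) (sym (prod-dist₂ (λ x y → 2 ^ ⟦ H x y ⟧) (λ x y → K ^ ⟦ B x y ⟧))) ⟩
    P (λ x y → 2 ^ ⟦ H x y ⟧ * K ^ ⟦ B x y ⟧) * A
      ≡⟨ sym (prod-dist₂ (λ x y → 2 ^ ⟦ H x y ⟧ * K ^ ⟦ B x y ⟧) (λ _ _ → a)) ⟩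
    P (λ x y → 2 ^ ⟦ H x y ⟧ * K ^ ⟦ B x y ⟧ * a)
      ≡⟨ prod-cong (λ x → prod-cong (λ y → sym (point x y))) ⟩
    P (λ x y → φ x y * a ^ ⟦ B x y ⟧)
      ≡⟨ prod-dist₂ φ (λ x y → a ^ ⟦ B x y ⟧) ⟩
    P φ * P (λ x y → a ^ ⟦ B x y ⟧)
      ≤⟨ *-mono-≤ le (≤-reflexive (prod-pow₂ a (λ x y → ⟦ B x y ⟧))) ⟩
    J * A * a ^ b
      ≡⟨ lem₁ J A (a ^ b) ⟩
    J * a ^ b * A ∎)
    where open ≤-Reasoning

  lower-tail : (∀ x y → 2 ^ ⟦ H x y ⟧ * (φ x y * a ^ ⟦ B x y ⟧) ≡ K ^ ⟦ B x y ⟧ * a) →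
    P φ ≤ J * A → K ^ b ≤ 2 ^ h * (J * a ^ b)
  lower-tail point le = *-cancelʳ-≤ (K ^ b) (2 ^ h * (J * a ^ b)) A (begin
    K ^ b * A
      ≡⟨ cong (_* A) (sym (prod-pow₂ K (λ x y → ⟦ B x y ⟧))) ⟩
    P (λ x y → K ^ ⟦ B x y ⟧) * A
      ≡⟨ sym (prod-dist₂ (λ x y → K ^ ⟦ B x y ⟧) (λ _ _ → a)) ⟩
    P (λ x y → K ^ ⟦ B x y ⟧ * a)
      ≡⟨ prod-cong (λ x → prod-cong (λ y → sym (point x y))) ⟩
    P (λ x y → 2 ^ ⟦ H x y ⟧ * (φ x y * a ^ ⟦ B x y ⟧))
      ≡⟨ prod-dist₂ (λ x y → 2 ^ ⟦ H x y ⟧) (λ x y → φ x y * a ^ ⟦ B x y ⟧) ⟩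
    P (λ x y → 2 ^ ⟦ H x y ⟧) * P (λ x y → φ x y * a ^ ⟦ B x y ⟧)
      ≡⟨ cong₂ _*_ (prod-pow₂ 2 (λ x y → ⟦ H x y ⟧)) (prod-dist₂ φ (λ x y → a ^ ⟦ B x y ⟧)) ⟩
    2 ^ h * (P φ * P (λ x y → a ^ ⟦ B x y ⟧))
      ≤⟨ *-monoʳ-≤ (2 ^ h) (*-mono-≤ le (≤-reflexive (prod-pow₂ a (λ x y → ⟦ B x y ⟧)))) ⟩
    2 ^ h * (J * A * a ^ b)
      ≡⟨ lem₂ (2 ^ h) J A (a ^ b) ⟩
    2 ^ h * (J * a ^ b) * A ∎)
    where open ≤-Reasoning

-- Choosing all labels against all pairs of vertex sets at once

pack : ∀ {a b c d} → Fin a × Fin b × Fin c × Fin d → Fin (a * (b * (c * d)))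
pack (i , j , k , l) = combine i (combine j (combine k l))

unpack : ∀ {a b c d} → Fin (a * (b * (c * d))) → Fin a × Fin b × Fin c × Fin d
unpack {b = b} {c} {d} = map₂ (map₂ (remQuot d) ∘ remQuot (c * d)) ∘ remQuot (b * (c * d))

unpack-pack : ∀ {a b c d} (t : Fin a × Fin b × Fin c × Fin d) → unpack (pack t) ≡ t
unpack-pack {b = b} {c} {d} (i , j , k , l) =
  trans (cong (map₂ (map₂ (remQuot d) ∘ remQuot (c * d)))
      (Fin.remQuot-combine i (combine j (combine k l))))
    (cong (i ,_) (trans (cong (map₂ (remQuot d)) (Fin.remQuot-combine j (combine k l)))
      (cong (j ,_) (Fin.remQuot-combine k l))))

module Weights (N k : ℕ) where

  K aᵁ aᴸ J : ℕ
  K = suc k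
  aᵁ = suc K
  aᴸ = k + K
  J = 2 * (2 ^ N * (2 ^ N * K))

  -- The labels of pairs `x < y` are chosen independently. Both orientations between `Z` and `W` are
  -- recovered by adding `below Z W` and `below W Z`.
  below : Sub N → Sub N → Fin N → Fin N → Bool
  below Z W x y = does (x Fin.<? y) ∧ Z x ∧ W y

  size : Sub N → Sub N → ℕ
  size Z W = sum (λ x → sum (λ y → ⟦ below Z W x y ⟧))

  hits : (Fin N → Fin N → Fin K) → Fin K → Sub N → Sub N → ℕ
  hits f w Z W = sum (λ x → sum (λ y → ⟦ below Z W x y ∧ does (f x y Fin.≟ w) ⟧))

  -- Up to scaling, the product of these weights is 2^hits (t = true) or 2^(-hits)
  -- (t = false). The scaling makes the mean over the labels independent of whether
  -- a pair lies in the constrained set, so that constraints with equal t have equal means.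
  φ : Bool → Bool → Fin K → Fin K → ℕ
  φ true  s w c = if s then (if does (c Fin.≟ w) then 2 * K else K) else aᵁ
  φ false s w c = if s then (if does (c Fin.≟ w) then K else 2 * K) else aᴸ

  a : Bool → ℕ
  a true = aᵁ
  a false = aᴸ

  sum-φ : ∀ t s w → sum (φ t s w) ≡ K * a t
  sum-φ true true w = trans (sum-delta w (2 * K) K) (lem k)
    where
    lem : ∀ k → 2 * suc k + k * suc k ≡ suc k * suc (suc k)
    lem = solve-∀
  sum-φ false true w = trans (sum-delta w K (2 * K)) (lem k)
    where
    lem : ∀ k → suc k + k * (2 * suc k) ≡ suc k * (k + suc k)
    lem = solve-∀
  sum-φ true false w = sum-const K aᵁ
  sum-φ false false w = sum-const K aᴸ

  Index : Set
  Index = Bool × Sub N × Sub N × Fin K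

  bit : Fin 2 → Bool
  bit zero = false
  bit (suc _) = true

  unbit : Bool → Fin 2
  unbit true = suc zero
  unbit false = zero

  bit-unbit : ∀ b → bit (unbit b) ≡ b
  bit-unbit true = refl
  bit-unbit false = refl

  record SameIndex (i j : Index) : Set where
    constructor same
    field
      flag : proj₁ i ≡ proj₁ j
      left : ∀ x → proj₁ (proj₂ i) x ≡ proj₁ (proj₂ j) x
      right : ∀ x → proj₁ (proj₂ (proj₂ i)) x ≡ proj₁ (proj₂ (proj₂ j)) x
      lbl : proj₂ (proj₂ (proj₂ i)) ≡ proj₂ (proj₂ (proj₂ j))

  interpret : Fin 2 × Fin (2 ^ N) × Fin (2 ^ N) × Fin K → Index
  interpret (t , z , y , w) = bit t , (λ i → bit (finToFun z i)) , (λ i → bit (finToFun y i)) , w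

  abstract
    decode : Fin J → Index
    decode j = interpret (unpack j)

    encode : Index → Fin J
    encode (t , Z , W , w) = pack (unbit t , funToFin (λ i → unbit (Z i)) , funToFin
        (λ i → unbit (W i)) , w)

    decode-encode : ∀ i → SameIndex (decode (encode i)) i
    decode-encode (t , Z , W , w) =
      subst (λ z → SameIndex (interpret z) (t , Z , W , w)) (sym (unpack-pack _))
          (same (bit-unbit t)
        (λ x → trans (cong bit (Fin.finToFun-funToFin (unbit ∘ Z) x)) (bit-unbit (Z x)))
        (λ x → trans (cong bit (Fin.finToFun-funToFin (unbit ∘ W) x)) (bit-unbit (W x))) refl)

  Φ : Fin J → Fin N → Fin N → Fin K → ℕ
  Φ j x y c with decode j
  ... | t , Z , W , w = φ t (below Z W x y) w c

  -- The factor `a (not t)` gives upper and lower constraints the same weighted mean `M`.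
  u : Fin J → ℕ
  u j with decode j
  ... | t , _ = prod {N} λ _ → prod {N} λ _ → a (not t)

  M : ℕ
  M = prod {N} λ _ → prod {N} λ _ → K * (aᵁ * aᴸ)

  pp : ℕ → ℕ
  pp c = prod {N} λ _ → prod {N} λ _ → c

  pp-* : ∀ b c → pp b * pp c ≡ pp (b * c)
  pp-* b c = trans (sym (prod-distrib {N} (λ _ → prod {N} λ _ → b) (λ _ → prod {N} λ _ → c)))
    (prod-cong {N} (λ _ → sym (prod-distrib {N} (λ _ → b) (λ _ → c))))

  u-μ : ∀ j → u j * prod (λ x → prod (λ y → sum (Φ j x y))) ≡ M
  u-μ j with decode j
  ... | t , Z , W , w = trans (cong (pp (a (not t)) *_)
            (prod-cong (λ x → prod-cong (λ y → sum-φ t (below Z W x y) w))))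
          (trans (pp-* (a (not t)) (K * a t)) (cong pp (lem t)))
    where
    lem₁ : ∀ x y z → y * (z * x) ≡ z * (x * y)
    lem₁ = solve-∀
    lem₂ : ∀ x y z → x * (z * y) ≡ z * (x * y)
    lem₂ = solve-∀
    lem : ∀ t → a (not t) * (K * a t) ≡ K * (aᵁ * aᴸ)
    lem true = lem₁ aᵁ aᴸ K
    lem false = lem₂ aᵁ aᴸ K

  -- A union bound in first-moment form: the terms are nonnegative, so each one is bounded by their
  -- sum, which costs only the number `J` of constraints as a factor.
  averaged : Σ (Fin N → Fin N → Fin K) λ f →
    ∀ j → u j * prod (λ x → prod (λ y → Φ j x y (f x y))) * pp K ≤ J * M
  averaged with averages-Π N (λ x → averages-Π N (λ y → averages-Fin (λ j → Φ j x y))) u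
  ... | f , le = f , λ j → begin
      u j * Ψ j * pp K
        ≤⟨ *-monoˡ-≤ (pp K) (term≤sum (λ j → u j * Ψ j) j) ⟩
      sum (λ j → u j * Ψ j) * pp K
        ≡⟨ cong (sum (λ j → u j * Ψ j) *_) (trans (prod-cong {N} (λ _ → prod-const N K))
            (prod-const N (K ^ N))) ⟩
      sum (λ j → u j * Ψ j) * (K ^ N) ^ N
        ≤⟨ le ⟩
      sum (λ j → u j * prod (λ x → prod (λ y → sum (Φ j x y))))
        ≡⟨ sum-cong-≗ u-μ ⟩
      sum {J} (λ _ → M)
        ≡⟨ sum-const J M ⟩
      J * M ∎
    where
    open ≤-Reasoning
    Ψ : Fin J → ℕ
    Ψ j = prod (λ x → prod (λ y → Φ j x y (f x y)))

  f : Fin N → Fin N → Fin K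
  f = proj₁ averaged

  -- Chernoff-type bounds. Over a uniform label the mean of `2^[c = w]` is `(K + 1)/K` and that of
  -- `2^(-[c = w])` is `(2K - 1)/(2K)`; no product exceeds its mean by more than the factor `J`.
  PU PL : Fin K → Sub N → Sub N → Set
  PU w Z W = 2 ^ hits f w Z W * K ^ size Z W ≤ J * aᵁ ^ size Z W
  PL w Z W = (2 * K) ^ size Z W ≤ 2 ^ hits f w Z W * (J * aᴸ ^ size Z W)

  instance
    pp-nonZero : ∀ {c} .{{_ : NonZero c}} → NonZero (pp c)
    pp-nonZero {c} = subst NonZero (sym (trans (prod-cong {N} (λ _ → prod-const N c))
        (prod-const N (c ^ N))))
      (m^n≢0 (c ^ N) N {{m^n≢0 c N}})
    a-nonZero : ∀ {t} → NonZero (a t)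
    a-nonZero {true} = _
    a-nonZero {false} = subst NonZero (sym (+-suc k k)) _

  reduced : ∀ t w Z W → prod (λ x → prod (λ y → φ t (below Z W x y) w (f x y))) * pp (a (not t)) *
      pp K ≤ J * M →
    prod (λ x → prod (λ y → φ t (below Z W x y) w (f x y))) ≤ J * pp (a t)
  reduced t w Z W le = *-cancelʳ-≤ _ _ (pp (a (not t))) {{pp-nonZero {{a-nonZero {not t}}}}}
      (*-cancelʳ-≤ _ _ (pp K)
    (≤-trans le (≤-reflexive (trans (cong (J *_) (trans (cong pp (lem t))
      (trans (sym (pp-* (a t * a (not t)) K)) (cong (_* pp K) (sym (pp-* (a t) (a (not t))))))))
      (lem₃ J (pp (a t)) (pp (a (not t))) (pp K))))))
    where
    lem₃ : ∀ j x y z → j * (x * y * z) ≡ j * x * y * z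
    lem₃ = solve-∀
    lem₁ : ∀ x y z → z * (x * y) ≡ x * y * z
    lem₁ = solve-∀
    lem₂ : ∀ x y z → z * (x * y) ≡ y * x * z
    lem₂ = solve-∀
    lem : ∀ t → K * (aᵁ * aᴸ) ≡ a t * a (not t) * K
    lem true = lem₁ aᵁ aᴸ K
    lem false = lem₂ aᵁ aᴸ K

  pointU : ∀ s (w c : Fin K) → φ true s w c * aᵁ ^ ⟦ s ⟧ ≡ 2 ^ ⟦ s ∧ does (c Fin.≟ w) ⟧ * K ^ ⟦ s
      ⟧ * aᵁ
  pointU false w c = lem aᵁ
    where
    lem : ∀ x → x * 1 ≡ 1 * 1 * x
    lem = solve-∀
  pointU true w c with does (c Fin.≟ w)
  ... | true = lem K aᵁ
    where
    lem : ∀ K x → 2 * K * (x * 1) ≡ 2 * (K * 1) * x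
    lem = solve-∀
  ... | false = lem K aᵁ
    where
    lem : ∀ K x → K * (x * 1) ≡ 1 * (K * 1) * x
    lem = solve-∀

  pointL : ∀ s (w c : Fin K) → 2 ^ ⟦ s ∧ does (c Fin.≟ w) ⟧ * (φ false s w c * aᴸ ^ ⟦ s ⟧) ≡
      (2 * K) ^ ⟦ s ⟧ * aᴸ
  pointL false w c = lem aᴸ
    where
    lem : ∀ x → 1 * (x * 1) ≡ 1 * x
    lem = solve-∀
  pointL true w c with does (c Fin.≟ w)
  ... | true = lem K aᴸ
    where
    lem : ∀ K x → 2 * (K * (x * 1)) ≡ 2 * K * 1 * x
    lem = solve-∀
  ... | false = lem K aᴸ
    where
    lem : ∀ K x → 1 * (2 * K * (x * 1)) ≡ 2 * K * 1 * x
    lem = solve-∀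

  finU : ∀ w Z W → prod (λ x → prod (λ y → φ true (below Z W x y) w (f x y))) ≤ J * pp aᵁ → PU w Z W
  finU w Z W = upper-tail K aᵁ J (below Z W) (λ x y → below Z W x y ∧ does (f x y Fin.≟ w))
    (λ x y → φ true (below Z W x y) w (f x y)) (λ x y → pointU (below Z W x y) w (f x y))

  finL : ∀ w Z W → prod (λ x → prod (λ y → φ false (below Z W x y) w (f x y))) ≤ J * pp aᴸ →
      PL w Z W
  finL w Z W = lower-tail (2 * K) aᴸ J {{pp-nonZero {{a-nonZero {false}}}}} (below Z W)
      (λ x y → below Z W x y ∧ does (f x y Fin.≟ w))
    (λ x y → φ false (below Z W x y) w (f x y)) (λ x y → pointL (below Z W x y) w (f x y))

  avg-at : ∀ t w Z W → Σ (Sub N × Sub N) λ { (Z′ , W′) →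
    (∀ x → Z′ x ≡ Z x) × (∀ x → W′ x ≡ W x) ×
    prod (λ x → prod (λ y → φ t (below Z′ W′ x y) w (f x y))) ≤ J * pp (a t) }
  avg-at t w Z W with encode (t , Z , W , w) | decode-encode (t , Z , W , w)
  ... | j | sm with proj₂ averaged j
  ... | le with decode j
  avg-at t w Z W | j | same refl l r refl | le | _ , Z′ , W′ , _ =
    (Z′ , W′) , l , r , reduced t w Z′ W′ (≤-trans (≤-reflexive (cong (_* pp K)
      (*-comm (prod (λ x → prod (λ y → φ t (below Z′ W′ x y) w (f x y)))) (pp (a (not t)))))) le)

  below-cong : ∀ {Z Z′ W W′} → (∀ x → Z′ x ≡ Z x) → (∀ x → W′ x ≡ W x) → ∀ x y →
      below Z′ W′ x y ≡ below Z W x y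
  below-cong l r x y rewrite l x | r y = refl

  size-cong : ∀ {Z Z′ W W′} → (∀ x → Z′ x ≡ Z x) → (∀ x → W′ x ≡ W x) → size Z′ W′ ≡ size Z W
  size-cong l r = sum-cong-≗ λ x → sum-cong-≗ λ y → cong ⟦_⟧ (below-cong l r x y)

  hits-cong : ∀ {Z Z′ W W′} w → (∀ x → Z′ x ≡ Z x) → (∀ x → W′ x ≡ W x) →
      hits f w Z′ W′ ≡ hits f w Z W
  hits-cong w l r = sum-cong-≗ λ x → sum-cong-≗ λ y →
    cong (λ b → ⟦ b ∧ does (f x y Fin.≟ w) ⟧) (below-cong l r x y)

  allU : ∀ w Z W → PU w Z W
  allU w Z W =
    let (Z′ , W′) , l , r , le = avg-at true w Z W
    in subst₂ (λ s h → 2 ^ h * K ^ s ≤ J * aᵁ ^ s) (size-cong l r) (hits-cong w l r)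
            (finU w Z′ W′ le)

  allL : ∀ w Z W → PL w Z W
  allL w Z W =
    let (Z′ , W′) , l , r , le = avg-at false w Z W
    in subst₂ (λ s h → (2 * K) ^ s ≤ 2 ^ h * (J * aᴸ ^ s)) (size-cong l r) (hits-cong w l r)
            (finL w Z′ W′ le)

-- A pseudo-random labelling

pow-≤ : ∀ {a b j} s t .{{_ : NonZero b}} → b ≤ a → a ^ j ≤ 2 * b ^ j → s ≤ t * j →
    a ^ s ≤ 2 ^ t * b ^ s
pow-≤ {a} {b} {j} s t b≤a growth s≤tj with m≤n⇒∃[o]m+o≡n s≤tj
... | r , eq = *-cancelʳ-≤ (a ^ s) (2 ^ t * b ^ s) (b ^ r) {{m^n≢0 b r}} (begin
    a ^ s * b ^ r          ≤⟨ *-monoʳ-≤ (a ^ s) (^-monoˡ-≤ r b≤a) ⟩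
    a ^ s * a ^ r          ≡⟨ sym (^-distribˡ-+-* a s r) ⟩
    a ^ (s + r)            ≡⟨ cong (a ^_) (trans eq (*-comm t j)) ⟩
    a ^ (j * t)            ≡⟨ sym (^-*-assoc a j t) ⟩
    (a ^ j) ^ t            ≤⟨ ^-monoˡ-≤ t growth ⟩
    (2 * b ^ j) ^ t        ≡⟨ ^-distribʳ-* 2 (b ^ j) t ⟩
    2 ^ t * (b ^ j) ^ t    ≡⟨ cong (2 ^ t *_) (trans (^-*-assoc b j t)
        (cong (b ^_) (trans (*-comm j t) (sym eq)))) ⟩
    2 ^ t * b ^ (s + r)    ≡⟨ cong (2 ^ t *_) (^-distribˡ-+-* b s r) ⟩
    2 ^ t * (b ^ s * b ^ r) ≡⟨ sym (*-assoc (2 ^ t) (b ^ s) (b ^ r)) ⟩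
    2 ^ t * b ^ s * b ^ r  ∎)
  where open ≤-Reasoning

pow-≥ : ∀ {a b j} s t → b ≤ a → 2 * b ^ j ≤ a ^ j → t * j ≤ s → 2 ^ t * b ^ s ≤ a ^ s
pow-≥ {a} {b} {j} s t b≤a growth tj≤s with m≤n⇒∃[o]m+o≡n tj≤s
... | r , refl = begin
    2 ^ t * b ^ (t * j + r)          ≡⟨ cong (2 ^ t *_) (^-distribˡ-+-* b (t * j) r) ⟩
    2 ^ t * (b ^ (t * j) * b ^ r)    ≡⟨ cong (λ z → 2 ^ t * (b ^ z * b ^ r)) (*-comm t j) ⟩
    2 ^ t * (b ^ (j * t) * b ^ r)    ≡⟨ cong (λ z → 2 ^ t * (z * b ^ r)) (sym (^-*-assoc b j t)) ⟩
    2 ^ t * ((b ^ j) ^ t * b ^ r)    ≡⟨ sym (*-assoc (2 ^ t) _ _) ⟩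
    2 ^ t * (b ^ j) ^ t * b ^ r      ≡⟨ cong (_* b ^ r) (sym (^-distribʳ-* 2 (b ^ j) t)) ⟩
    (2 * b ^ j) ^ t * b ^ r          ≤⟨ *-mono-≤ (^-monoˡ-≤ t growth) (^-monoˡ-≤ r b≤a) ⟩
    (a ^ j) ^ t * a ^ r              ≡⟨ cong (_* a ^ r)
        (trans (^-*-assoc a j t) (cong (a ^_) (*-comm j t))) ⟩
    a ^ (t * j) * a ^ r              ≡⟨ sym (^-distribˡ-+-* a (t * j) r) ⟩
    a ^ (t * j + r)                  ∎
  where open ≤-Reasoning

-- In logarithms `h ≤ ℓ + 1 + s/j`. With `K = 2j` this is at most twice the expected number `s/K` of
-- hits, up to the additive error `M`.
upper-exponent : ∀ j .{{_ : NonZero j}} ℓ M h s → suc ℓ ≤ M →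
  2 ^ h * (j + j) ^ s ≤ 2 ^ ℓ * suc (j + j) ^ s → (j + j) * h ≤ (j + j) * M + 2 * s
upper-exponent j ℓ M h s ℓ<M le = begin
    (j + j) * h                      ≤⟨ *-monoʳ-≤ (j + j) h≤ ⟩
    (j + j) * (ℓ + suc q)            ≡⟨ lem₁ j ℓ q ⟩
    (j + j) * suc ℓ + 2 * (q * j)    ≤⟨ +-mono-≤ (*-monoʳ-≤ (j + j) ℓ<M) (*-monoʳ-≤ 2 qj≤s) ⟩
    (j + j) * M + 2 * s              ∎
  where
  open ≤-Reasoning
  q = s / j
  instance
    nz : NonZero (j + j)
    nz = >-nonZero (≤-trans (>-nonZero⁻¹ j) (m≤m+n j j))
  qj≤s : q * j ≤ s
  qj≤s = ≤-trans (m≤n+m (q * j) (s % j)) (≤-reflexive (sym (m≡m%n+[m/n]*n s j)))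
  s≤ : s ≤ suc q * j
  s≤ = ≤-trans (≤-reflexive (m≡m%n+[m/n]*n s j)) (+-monoˡ-≤ (q * j) (<⇒≤ (m%n<n s j)))
  lem₁ : ∀ j ℓ q → (j + j) * (ℓ + suc q) ≡ (j + j) * suc ℓ + 2 * (q * j)
  lem₁ = solve-∀
  h≤ : h ≤ ℓ + suc q
  h≤ = 2^-cancel-≤ (*-cancelʳ-≤ _ _ ((j + j) ^ s) {{m^n≢0 (j + j) s}} (begin
    2 ^ h * (j + j) ^ s                  ≤⟨ le ⟩
    2 ^ ℓ * suc (j + j) ^ s              ≤⟨ *-monoʳ-≤ (2 ^ ℓ)
        (pow-≤ s (suc q) (n≤1+n (j + j)) (growth-up j) s≤) ⟩
    2 ^ ℓ * (2 ^ suc q * (j + j) ^ s)    ≡⟨ sym (*-assoc (2 ^ ℓ) (2 ^ suc q) ((j + j) ^ s)) ⟩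
    2 ^ ℓ * 2 ^ suc q * (j + j) ^ s      ≡⟨ cong (_* (j + j) ^ s)
        (sym (^-distribˡ-+-* 2 ℓ (suc q))) ⟩
    2 ^ (ℓ + suc q) * (j + j) ^ s        ∎))

-- Used with `a + 1 = 2K`: at least half of the expected `s/K` hits, up to the error `M`.
lower-exponent : ∀ a .{{_ : NonZero a}} ℓ M h s → suc ℓ ≤ M →
  suc a ^ s ≤ 2 ^ h * (2 ^ ℓ * a ^ s) → s ≤ suc a * (h + M)
lower-exponent a ℓ M h s ℓ<M le = begin
    s                        ≤⟨ s≤ ⟩
    suc q * a                ≤⟨ *-mono-≤ (s≤s q≤) (n≤1+n a) ⟩
    suc (h + ℓ) * suc a      ≡⟨ cong (_* suc a) (sym (+-suc h ℓ)) ⟩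
    (h + suc ℓ) * suc a      ≤⟨ *-monoˡ-≤ (suc a) (+-monoʳ-≤ h ℓ<M) ⟩
    (h + M) * suc a          ≡⟨ *-comm (h + M) (suc a) ⟩
    suc a * (h + M)          ∎
  where
  open ≤-Reasoning
  q = s / a
  qa≤s : q * a ≤ s
  qa≤s = ≤-trans (m≤n+m (q * a) (s % a)) (≤-reflexive (sym (m≡m%n+[m/n]*n s a)))
  s≤ : s ≤ suc q * a
  s≤ = ≤-trans (≤-reflexive (m≡m%n+[m/n]*n s a)) (+-monoˡ-≤ (q * a) (<⇒≤ (m%n<n s a)))
  q≤ : q ≤ h + ℓ
  q≤ = 2^-cancel-≤ (*-cancelʳ-≤ _ _ (a ^ s) {{m^n≢0 a s}} (begin
    2 ^ q * a ^ s             ≤⟨ pow-≥ s q (n≤1+n a) (growth-down a) qa≤s ⟩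
    suc a ^ s                 ≤⟨ le ⟩
    2 ^ h * (2 ^ ℓ * a ^ s)   ≡⟨ sym (*-assoc (2 ^ h) (2 ^ ℓ) (a ^ s)) ⟩
    2 ^ h * 2 ^ ℓ * a ^ s     ≡⟨ cong (_* a ^ s) (sym (^-distribˡ-+-* 2 h ℓ)) ⟩
    2 ^ (h + ℓ) * a ^ s       ∎))

-- Edge counts of one label between two vertex sets

nbhd : ∀ {N K} → (Fin N → Fin N → Fin K) → Fin K → Fin N → Sub N
nbhd lab w x y = not (does (x Fin.≟ y)) ∧ does (lab x y Fin.≟ w)

edges : ∀ {N K} → (Fin N → Fin N → Fin K) → Fin K → Sub N → Sub N → ℕ
edges lab w Z W = wsum Z (λ x → # (W ∩ nbhd lab w x))

module _ (N k κ : ℕ) (K≡ : suc k ≡ 2 ^ κ) (κ≥1 : 1 ≤ κ) (κ+3≤N : κ + 3 ≤ N) where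

  open Weights N k

  private
    half : ∃ λ j → NonZero j × K ≡ j + j
    half = go κ κ≥1 K≡
      where
      go : ∀ κ → 1 ≤ κ → K ≡ 2 ^ κ → ∃ λ j → NonZero j × K ≡ j + j
      go (suc κ′) _ eq = 2 ^ κ′ , m^n≢0 2 κ′ , trans eq (cong (2 ^ κ′ +_) (+-identityʳ (2 ^ κ′)))

    -- `2 ^ ℓ` is the number `J` of constraints, dominated by the `2 ^ N` choices for each of the
    -- two sets. Hence the error is linear in `N`, and small once `# Z * # W` is far above `K * N`.
    ℓ : ℕ
    ℓ = 1 + (N + (N + κ))

    J≡ : J ≡ 2 ^ ℓ
    J≡ rewrite K≡ = cong (2 *_) (trans (cong (2 ^ N *_) (sym (^-distribˡ-+-* 2 N κ)))
        (sym (^-distribˡ-+-* 2 N (N + κ))))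

    ℓ<3N : suc ℓ ≤ 3 * N
    ℓ<3N = ≤-trans (≤-trans (≤-reflexive (lem₁ N κ)) (+-monoʳ-≤ (N + N)
        (≤-trans (+-monoʳ-≤ κ (n≤1+n 2)) κ+3≤N))) (≤-reflexive (lem₂ N))
      where
      lem₁ : ∀ N κ → suc (1 + (N + (N + κ))) ≡ N + N + (κ + 2)
      lem₁ = solve-∀
      lem₂ : ∀ N → N + N + N ≡ 3 * N
      lem₂ = solve-∀

    hits-upper : ∀ w Z W → K * hits f w Z W ≤ K * (3 * N) + 2 * size Z W
    hits-upper w Z W = go half (hits f w Z W) (size Z W)
        (subst (λ z → 2 ^ hits f w Z W * K ^ size Z W ≤ z * aᵁ ^ size Z W) J≡ (allU w Z W))
      where
      go : ∀ {X} → (∃ λ j → NonZero j × X ≡ j + j) → ∀ h s →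
        2 ^ h * X ^ s ≤ 2 ^ ℓ * suc X ^ s → X * h ≤ X * (3 * N) + 2 * s
      go (j , nz , refl) h s = upper-exponent j {{nz}} ℓ (3 * N) h s ℓ<3N

    hits-lower : ∀ w Z W → size Z W ≤ 2 * K * (hits f w Z W + 3 * N)
    hits-lower w Z W = subst (λ z → size Z W ≤ z * (hits f w Z W + 3 * N)) suc-aᴸ
      (lower-exponent aᴸ {{a-nonZero {false}}} ℓ (3 * N) (hits f w Z W) (size Z W) ℓ<3N
        (subst₂ (λ b z → b ^ size Z W ≤ 2 ^ hits f w Z W * (z * aᴸ ^ size Z W)) (sym suc-aᴸ) J≡
            (allL w Z W)))
      where
      lem : ∀ k → suc (k + suc k) ≡ 2 * suc k
      lem = solve-∀
      suc-aᴸ : suc aᴸ ≡ 2 * K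
      suc-aᴸ = lem k

  randomLabel : Fin N → Fin N → Fin (suc k)
  randomLabel x y = if does (x Fin.<? y) then f x y else f y x

  randomLabel-sym : ∀ x y → randomLabel x y ≡ randomLabel y x
  randomLabel-sym x y with Fin.<-cmp x y
  ... | tri< lt _ gt rewrite dec-true (x Fin.<? y) lt | dec-false (y Fin.<? x) gt = refl
  ... | tri≈ _ refl _ = refl
  ... | tri> lt _ gt rewrite dec-true (y Fin.<? x) gt | dec-false (x Fin.<? y) lt = refl

  private
    edges≡ : ∀ w Z W → edges randomLabel w Z W ≡ hits f w Z W + hits f w W Z
    edges≡ w Z W = begin
      sum (λ x → ⟦ Z x ⟧ * sum (λ y → ⟦ W y ∧ nbhd randomLabel w x y ⟧))
        ≡⟨ sum-cong-≗ (λ x → trans (*-distribˡ-sum ⟦ Z x ⟧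
            (λ y → ⟦ W y ∧ nbhd randomLabel w x y ⟧)) (sum-cong-≗ (point x))) ⟩
      sum (λ x → sum (λ y → A x y + B x y))
        ≡⟨ trans (sum-cong-≗ (λ x → ∑-distrib-+ (A x) (B x)))
            (∑-distrib-+ (λ x → sum (A x)) (λ x → sum (B x))) ⟩
      sum (λ x → sum (A x)) + sum (λ x → sum (B x))
        ≡⟨ cong (sum (λ x → sum (A x)) +_) (∑-comm B) ⟩
      hits f w Z W + hits f w W Z ∎
      where
      open ≡-Reasoning
      A B : Fin N → Fin N → ℕ
      A x y = ⟦ below Z W x y ∧ does (f x y Fin.≟ w) ⟧
      B x y = ⟦ below W Z y x ∧ does (f y x Fin.≟ w) ⟧
      point : ∀ x y → ⟦ Z x ⟧ * ⟦ W y ∧ nbhd randomLabel w x y ⟧ ≡ A x y + B x y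
      point x y with Fin.<-cmp x y
      ... | tri< lt ne gt rewrite dec-true (x Fin.<? y) lt | dec-false (y Fin.<? x) gt | dec-false
          (x Fin.≟ y) ne =
        cases (Z x) (W y) (does (f x y Fin.≟ w))
        where
        cases : ∀ a b c → ⟦ a ⟧ * ⟦ b ∧ c ⟧ ≡ ⟦ (a ∧ b) ∧ c ⟧ + 0
        cases false b c = refl
        cases true b c = refl
      ... | tri≈ lt eq gt rewrite dec-false (x Fin.<? y) lt | dec-false (y Fin.<? x) gt | dec-true
          (x Fin.≟ y) eq
                                | ∧-zeroʳ (W y) = *-zeroʳ ⟦ Z x ⟧
      ... | tri> lt ne gt rewrite dec-false (x Fin.<? y) lt | dec-true (y Fin.<? x) gt | dec-false
          (x Fin.≟ y) ne =
        cases (Z x) (W y) (does (f y x Fin.≟ w))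
        where
        cases : ∀ a b c → ⟦ a ⟧ * ⟦ b ∧ c ⟧ ≡ ⟦ (b ∧ a) ∧ c ⟧
        cases false false c = refl
        cases false true c = refl
        cases true false c = refl
        cases true true c = +-identityʳ ⟦ c ⟧

    product≡ : ∀ (Z W : Sub N) → # Z * # W ≡ sum (λ x → sum (λ y → ⟦ Z x ⟧ * ⟦ W y ⟧))
    product≡ Z W = trans (*-distribʳ-sum (# W) (λ x → ⟦ Z x ⟧))
      (sum-cong-≗ (λ x → *-distribˡ-sum ⟦ Z x ⟧ (λ y → ⟦ W y ⟧)))

    sizes : ∀ Z W → size Z W + size W Z ≡ sum (λ x → sum
        (λ y → ⟦ below Z W x y ⟧ + ⟦ below W Z y x ⟧))
    sizes Z W = trans (cong (size Z W +_) (∑-comm (λ y x → ⟦ below W Z y x ⟧)))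
      (sym (trans (sum-cong-≗ (λ x → ∑-distrib-+ (A x) (B x)))
          (∑-distrib-+ (λ x → sum (A x)) (λ x → sum (B x)))))
      where
      A B : Fin N → Fin N → ℕ
      A x y = ⟦ below Z W x y ⟧
      B x y = ⟦ below W Z y x ⟧

    diagonal : ∀ n → sum {n} (λ x → sum {n} (λ y → ⟦ does (x Fin.≟ y) ⟧)) ≡ n
    diagonal n = trans (sum-cong-≗ (row n)) (trans (sum-const n 1) (*-identityʳ n))
      where
      row : ∀ n (x : Fin n) → sum (λ y → ⟦ does (x Fin.≟ y) ⟧) ≡ 1
      row (suc n) zero = cong suc (trans (sum-const n 0) (*-zeroʳ n))
      row (suc n) (suc x) = row n x

    pair-cases : ∀ (Z W : Sub N) x y →
      ⟦ below Z W x y ⟧ + ⟦ below W Z y x ⟧ ≤ ⟦ Z x ⟧ * ⟦ W y ⟧ ×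
      ⟦ Z x ⟧ * ⟦ W y ⟧ ≤ ⟦ below Z W x y ⟧ + ⟦ below W Z y x ⟧ + ⟦ does (x Fin.≟ y) ⟧
    pair-cases Z W x y with Fin.<-cmp x y
    ... | tri< lt ne gt rewrite dec-true (x Fin.<? y) lt | dec-false (y Fin.<? x) gt | dec-false
        (x Fin.≟ y) ne
                              | ⟦∧⟧ (Z x) (W y) | +-identityʳ (⟦ Z x ⟧ * ⟦ W y ⟧) | +-identityʳ
                                  (⟦ Z x ⟧ * ⟦ W y ⟧) = ≤-refl , ≤-refl
    ... | tri≈ lt eq gt rewrite dec-false (x Fin.<? y) lt | dec-false (y Fin.<? x) gt | dec-true
        (x Fin.≟ y) eq =
      z≤n , *-mono-≤ (⟦⟧≤1 (Z x)) (⟦⟧≤1 (W y))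
    ... | tri> lt ne gt rewrite dec-false (x Fin.<? y) lt | dec-true (y Fin.<? x) gt | dec-false
        (x Fin.≟ y) ne
                              | ⟦∧⟧ (W y) (Z x) | *-comm ⟦ W y ⟧ ⟦ Z x ⟧ | +-identityʳ
                                  (⟦ Z x ⟧ * ⟦ W y ⟧) = ≤-refl , ≤-refl

    sizes-≤ : ∀ Z W → size Z W + size W Z ≤ # Z * # W
    sizes-≤ Z W = ≤-trans (≤-reflexive (sizes Z W)) (≤-trans
      (sum-mono (λ x → sum-mono (λ y → proj₁ (pair-cases Z W x y))))
          (≤-reflexive (sym (product≡ Z W))))

    sizes-≥ : ∀ Z W → # Z * # W ≤ size Z W + size W Z + N
    sizes-≥ Z W = begin
      # Z * # W ≡⟨ product≡ Z W ⟩
      sum (λ x → sum (λ y → ⟦ Z x ⟧ * ⟦ W y ⟧)) ≤⟨ sum-mono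
          (λ x → sum-mono (λ y → proj₂ (pair-cases Z W x y))) ⟩
      sum (λ x → sum (λ y → A x y + D x y))
        ≡⟨ trans (sum-cong-≗ (λ x → ∑-distrib-+ (A x) (D x)))
            (∑-distrib-+ (λ x → sum (A x)) (λ x → sum (D x))) ⟩
      sum (λ x → sum (A x)) + sum (λ x → sum (D x))
        ≡⟨ cong₂ _+_ (sym (sizes Z W)) (diagonal N) ⟩
      size Z W + size W Z + N ∎
      where
      open ≤-Reasoning
      A D : Fin N → Fin N → ℕ
      A x y = ⟦ below Z W x y ⟧ + ⟦ below W Z y x ⟧
      D x y = ⟦ does (x Fin.≟ y) ⟧

  edges-upper : ∀ w Z W → K * edges randomLabel w Z W ≤ 2 * (# Z * # W) + 6 * (K * N)
  edges-upper w Z W = begin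
    K * edges randomLabel w Z W                     ≡⟨ cong (K *_) (edges≡ w Z W) ⟩
    K * (hits f w Z W + hits f w W Z)         ≡⟨ *-distribˡ-+ K (hits f w Z W) (hits f w W Z) ⟩
    K * hits f w Z W + K * hits f w W Z       ≤⟨ +-mono-≤ (hits-upper w Z W) (hits-upper w W Z) ⟩
    K * (3 * N) + 2 * size Z W + (K * (3 * N) + 2 * size W Z) ≡⟨ lem K N (size Z W) (size W Z) ⟩
    2 * (size Z W + size W Z) + 6 * (K * N)   ≤⟨ +-monoˡ-≤ _ (*-monoʳ-≤ 2 (sizes-≤ Z W)) ⟩
    2 * (# Z * # W) + 6 * (K * N)             ∎
    where
    open ≤-Reasoning
    lem : ∀ K N a b → K * (3 * N) + 2 * a + (K * (3 * N) + 2 * b) ≡ 2 * (a + b) + 6 * (K * N)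
    lem = solve-∀

  -- The error collects `3 * N` hits from each orientation, scaled by `2 * K`, and the diagonal
  -- pairs, which count in `# Z * # W` but are not edges.
  edges-lower : ∀ w Z W → # Z * # W ≤ 2 * (K * edges randomLabel w Z W) + 14 * (K * N)
  edges-lower w Z W = begin
    # Z * # W                                 ≤⟨ sizes-≥ Z W ⟩
    size Z W + size W Z + N                   ≤⟨ +-mono-≤
        (+-mono-≤ (hits-lower w Z W) (hits-lower w W Z)) (m≤n*m N K) ⟩
    2 * K * (hits f w Z W + 3 * N) + 2 * K * (hits f w W Z + 3 * N) + K * N
        ≡⟨ lem K N (hits f w Z W) (hits f w W Z) ⟩
    2 * (K * (hits f w Z W + hits f w W Z)) + 13 * (K * N)
        ≡⟨ cong (λ z → 2 * (K * z) + 13 * (K * N)) (sym (edges≡ w Z W)) ⟩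
    2 * (K * edges randomLabel w Z W) + 13 * (K * N) ≤⟨ +-monoʳ-≤
        (2 * (K * edges randomLabel w Z W)) (*-monoˡ-≤ (K * N) (n≤1+n 13)) ⟩
    2 * (K * edges randomLabel w Z W) + 14 * (K * N) ∎
    where
    open ≤-Reasoning
    lem : ∀ K N a b → 2 * K * (a + 3 * N) + 2 * K * (b + 3 * N) + K * N ≡ 2 * (K * (a + b)) + 13 *
        (K * N)
    lem = solve-∀

-- Greedy embedding

module _ {N : ℕ} where

  Transversal : ∀ {m} → (Fin m → Fin m → Fin N → Sub N) → (Fin m → Sub N) → Set
  Transversal {m} ρ U = Σ (Fin m → Fin N) λ f →
    (∀ b → U b (f b) ≡ true) × (∀ a b → a Fin.< b → ρ a b (f a) (f b) ≡ true)

  -- At most `m` vertices are embedded before the search gets stuck, and each of them cuts the later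
  -- sets by at most the factor `E`; the factor `suc m` in `sizeB` pays for the pigeonhole in
  -- `pick`.
  record SparsePair (E m : ℕ) {n : ℕ} (ρ : Fin n → Fin n → Fin N → Sub N) (U : Fin n → Sub N) :
      Set where
    field
      a b : Fin n
      a<b : a Fin.< b
      B C : Sub N
      B⊆ : B ⊆ U a
      C⊆ : C ⊆ U b
      sizeB : # (U a) ≤ suc m * E ^ m * # B
      sizeC : # (U b) ≤ E ^ m * # C
      sparse : ∀ x → B x ≡ true → E * # (C ∩ ρ a b x) ≤ # C

  -- If every vertex of `A` is poor towards some `U b`, the pigeonhole principle yields one `b` that
  -- serves a `1/(m + 1)` share of `A`.
  pick : ∀ {m} (A : Sub N) (ρ : Fin (suc m) → Fin N → Sub N) (U : Fin (suc m) → Sub N) (E : ℕ) →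
    (∃ λ x → A x ≡ true × ∀ b → # (U b) ≤ E * # (U b ∩ ρ b x)) ⊎
    (∃ λ b → Σ (Sub N) λ B → B ⊆ A × # A ≤ suc m * # B ×
      (∀ x → B x ≡ true → E * # (U b ∩ ρ b x) ≤ # (U b)))
  pick {m} A ρ U E with Fin.any? (λ x → (A x Bool.≟ true) ×-dec Fin.all?
      (λ b → # (U b) ≤? E * # (U b ∩ ρ b x)))
  ... | yes found = inj₁ found
  ... | no none with max-avg (λ b → # (poor b))
    where
    poor : Fin (suc m) → Sub N
    poor b x = A x ∧ not (does (# (U b) ≤? E * # (U b ∩ ρ b x)))
  ...   | b , le = inj₂ (b , poor , (λ x → ∧-elimˡ) , ≤-trans (#≤∑# covered) le ,
            λ x p → <⇒≤ (≰⇒> (not-does (# (U b) ≤? E * # (U b ∩ ρ b x)) (∧-elimʳ {A x} p))))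
    where
    poor : Sub N
    poor x = A x ∧ not (does (# (U b) ≤? E * # (U b ∩ ρ b x)))
    covered : ∀ x → A x ≡ true → ∃ λ b → A x ∧ not (does (# (U b) ≤? E * # (U b ∩ ρ b x))) ≡ true
    covered x p with Fin.all? (λ b → # (U b) ≤? E * # (U b ∩ ρ b x))
    ... | yes rich = ⊥-elim (none (x , p , rich))
    ... | no ¬rich with Fin.¬∀⟶∃¬ (suc m) _ (λ b → # (U b) ≤? E * # (U b ∩ ρ b x)) ¬rich
    ...   | b′ , ¬le = b′ , ∧-intro p (does-not (# (U b′) ≤? E * # (U b′ ∩ ρ b′ x)) ¬le)

  -- A vertex rich towards all later sets is embedded and these sets are cut to its neighbourhoods.
  -- Otherwise `pick` supplies the pair at once, with a whole later set as `C`.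
  transversal-or-sparse : ∀ m (ρ : Fin (suc m) → Fin (suc m) → Fin N → Sub N)
      (U : Fin (suc m) → Sub N)
    (E : ℕ) → 1 ≤ E → (∀ b → 0 < # (U b)) → Transversal ρ U ⊎ SparsePair E m ρ U
  transversal-or-sparse zero ρ U E E≥1 pos with #-pos (U zero) (pos zero)
  ... | x , p = inj₁ ((λ _ → x) , (λ { zero → p }) , λ { zero zero () })
  transversal-or-sparse (suc m) ρ U E E≥1 pos
    with pick (U zero) (λ b → ρ zero (suc b)) (U ∘ suc) E
  ... | inj₂ (b , B , B⊆ , size , sparse) = inj₂ record
    { a = zero ; b = suc b ; a<b = s≤s z≤n ; B = B ; C = U (suc b) ; B⊆ = B⊆ ; C⊆ = λ _ p → p
    ; sizeB = ≤-trans size (*-monoˡ-≤ (# B) (≤-trans (n≤1+n (suc m))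
        (m≤m*n (suc (suc m)) (E ^ suc m) {{E^≢0}})))
    ; sizeC = m≤n*m (# (U (suc b))) (E ^ suc m) {{E^≢0}}
    ; sparse = sparse }
    where
    E^≢0 : NonZero (E ^ suc m)
    E^≢0 = m^n≢0 E (suc m) {{>-nonZero E≥1}}
  ... | inj₁ (x , x∈ , rich) with transversal-or-sparse m (λ a b → ρ (suc a) (suc b))
                                    (λ b → U (suc b) ∩ ρ zero (suc b) x) E E≥1 pos′
    where
    pos′ : ∀ b → 0 < # (U (suc b) ∩ ρ zero (suc b) x)
    pos′ b with # (U (suc b) ∩ ρ zero (suc b) x) in eq
    ... | suc _ = s≤s z≤n
    ... | zero = ⊥-elim (<⇒≱ (pos (suc b)) (≤-trans (rich b)
        (≤-reflexive (trans (cong (E *_) eq) (*-zeroʳ E)))))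
  ...   | inj₁ (f , f∈ , ok) = inj₁ ((λ { zero → x ; (suc b) → f b }) ,
            (λ { zero → x∈ ; (suc b) → ∧-elimˡ (f∈ b) }) ,
            λ { zero (suc b) _ → ∧-elimʳ {U (suc b) (f b)} (f∈ b) ; (suc a) (suc b) (s≤s lt) →
                ok a b lt })
  ...   | inj₂ sp = inj₂ record
    { a = suc a ; b = suc b ; a<b = s≤s a<b ; B = B ; C = C
    ; B⊆ = λ y p → ∧-elimˡ (B⊆ y p) ; C⊆ = λ y p → ∧-elimˡ (C⊆ y p)
    ; sizeB = begin
        # (U (suc a))                              ≤⟨ rich a ⟩
        E * # (U (suc a) ∩ ρ zero (suc a) x)       ≤⟨ *-monoʳ-≤ E sizeB ⟩
        E * (suc m * E ^ m * # B)                  ≡⟨ lem₁ E (suc m) (E ^ m) (# B) ⟩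
        suc m * (E * E ^ m) * # B                  ≤⟨ *-monoˡ-≤ (# B)
            (*-monoˡ-≤ (E * E ^ m) (n≤1+n (suc m))) ⟩
        suc (suc m) * (E * E ^ m) * # B            ∎
    ; sizeC = ≤-trans (rich b) (≤-trans (*-monoʳ-≤ E sizeC)
        (≤-reflexive (sym (*-assoc E (E ^ m) (# C)))))
    ; sparse = sparse }
    where
    open SparsePair sp
    open ≤-Reasoning
    lem₁ : ∀ e m p b → e * (m * p * b) ≡ m * (e * p) * b
    lem₁ = solve-∀

-- Families of pairwise sparse sets

lookup-All : ∀ {A : Set} {P : A → Set} {xs : List A} → All P xs → ∀ i → P (lookup xs i)
lookup-All (p ∷ ps) zero = p
lookup-All (p ∷ ps) (suc i) = lookup-All ps i

lookup-AllPairs : ∀ {A : Set} {R : A → A → Set} {xs : List A} → AllPairs R xs →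
  ∀ i j → i Fin.< j → R (lookup xs i) (lookup xs j)
lookup-AllPairs (p ∷ ps) zero (suc j) _ = lookup-All p j
lookup-AllPairs (p ∷ ps) (suc i) (suc j) (s≤s lt) = lookup-AllPairs ps i j lt

family : ∀ {A : Set} {P : A → Set} {R : A → A → Set} {xs : List A} {m} → length xs ≡ m →
  All P xs → AllPairs R xs → Σ (Fin m → A) λ U → (∀ i → P (U i)) ×
      (∀ i j → i Fin.< j → R (U i) (U j))
family {xs = xs} refl ps rs = lookup xs , lookup-All ps , lookup-AllPairs rs

half≤ : ∀ m d → suc (suc m) ≤ 2 ^ suc d → suc ⌈ m /2⌉ ≤ 2 ^ d
half≤ m d le = ≤-trans (⌈n/2⌉-mono (≤-trans le (≤-reflexive
    (cong (2 ^ d +_) (+-identityʳ (2 ^ d))))))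
  (≤-reflexive (sym (n≡⌈n+n/2⌉ (2 ^ d))))

module Regions {N : ℕ} (β : ℕ) .{{_ : NonZero β}}
  (lab : Fin N → Fin N → ℕ) (lab-sym : ∀ x y → lab x y ≡ lab y x)
  (col : Fin N → Fin N → ℕ) (col-sym : ∀ x y → x ≢ y → col x y ≡ col y x) where

  -- Q r ℓ drops the r least significant base-β digits of ℓ; the pair (r , v)
  -- stands for the labels whose remaining leading digits are v.
  Q : ℕ → ℕ → ℕ
  Q zero ℓ = ℓ
  Q (suc r) ℓ = Q r ℓ / β

  Q-<-cancel : ∀ r {ℓ ℓ′} → Q r ℓ < Q r ℓ′ → ℓ < ℓ′
  Q-<-cancel zero lt = lt
  Q-<-cancel (suc r) {ℓ} {ℓ′} lt = Q-<-cancel r (≰⇒> λ le → <⇒≱ lt (/-monoˡ-≤ β le))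

  low exact : ℕ → ℕ → ℕ → Fin N → Sub N
  low r v k x y = not (does (x Fin.≟ y)) ∧ does (Q r (lab x y) ≟ v) ∧ does (col x y <? k)
  exact r v k x y = not (does (x Fin.≟ y)) ∧ does (Q r (lab x y) ≟ v) ∧ does (col x y ≟ k)

  low-sym : ∀ r v k x y → low r v k x y ≡ low r v k y x
  low-sym r v k x y with x Fin.≟ y | y Fin.≟ x
  ... | yes _ | yes _ = refl
  ... | yes refl | no ne = ⊥-elim (ne refl)
  ... | no ne | yes refl = ⊥-elim (ne refl)
  ... | no ne | no _ rewrite lab-sym x y | col-sym x y ne = refl

  -- `(r , v)` is the interval of labels from `v * β ^ r` up to but excluding `suc v * β ^ r`.
  -- `bounded` compares the right ends; it will show that the labels prescribed in the last
  -- embedding are below `β ^ Δ`, so that they occur in the host.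
  record Refines (r′ v′ r v : ℕ) : Set where
    constructor refines
    field
      extends : ∀ ℓ → Q r′ ℓ ≡ v′ → Q r ℓ ≡ v
      bounded : suc v′ * β ^ r′ ≤ suc v * β ^ r
  open Refines

  refines-refl : ∀ {r v} → Refines r v r v
  refines-refl = refines (λ _ p → p) ≤-refl

  refines-trans : ∀ {r₁ v₁ r₂ v₂ r₃ v₃} → Refines r₁ v₁ r₂ v₂ → Refines r₂ v₂ r₃ v₃ →
      Refines r₁ v₁ r₃ v₃
  refines-trans p q = refines (λ ℓ e → extends q ℓ (extends p ℓ e))
      (≤-trans (bounded p) (bounded q))

  refines-digit : ∀ r v d → d < β → Refines r (v * β + d) (suc r) v
  refines-digit r v d d<β = refines (λ ℓ e → trans (cong (_/ β) e) quotient) (begin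
      suc (v * β + d) * β ^ r   ≡⟨ cong (_* β ^ r) (sym (+-suc (v * β) d)) ⟩
      (v * β + suc d) * β ^ r   ≤⟨ *-monoˡ-≤ (β ^ r) (+-monoʳ-≤ (v * β) d<β) ⟩
      (v * β + β) * β ^ r       ≡⟨ lem v β (β ^ r) ⟩
      suc v * (β * β ^ r)       ∎)
    where
    open ≤-Reasoning
    lem : ∀ v β x → (v * β + β) * x ≡ suc v * (β * x)
    lem = solve-∀
    quotient : (v * β + d) / β ≡ v
    quotient = trans (+-distrib-/-∣ˡ d (n∣m*n v)) (trans (cong₂ _+_ (m*n/n≡m v β) (m<n⇒m/n≡0 d<β))
        (+-identityʳ v))

  ∧-map : ∀ p {q q′ s} → (q ≡ true → q′ ≡ true) → p ∧ q ∧ s ≡ true → p ∧ q′ ∧ s ≡ true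
  ∧-map true {true} f h rewrite f refl = h

  low-refine : ∀ {r′ v′ r v k} → Refines r′ v′ r v → ∀ x → low r′ v′ k x ⊆ low r v k x
  low-refine {r′} {v′} {r} {v} {k} ref x y =
    ∧-map (not (does (x Fin.≟ y)))
      (λ q → true-does (Q r (lab x y) ≟ v) (extends ref (lab x y)
          (does-true (Q r′ (lab x y) ≟ v′) q)))

  -- One-sided: degrees from `C` back into `A` are not controlled. `reverse-sparse` restores the
  -- other direction, for a subset of `C` and a weaker density.
  SparseTo : (D r v k : ℕ) → Sub N → Sub N → Set
  SparseTo D r v k A C = ∀ x → A x ≡ true → D * # (C ∩ low r v k x) ≤ # C

  ∩-monoʳ : ∀ (C : Sub N) {A B : Sub N} → A ⊆ B → C ∩ A ⊆ C ∩ B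
  ∩-monoʳ C p y h = ∧-intro (∧-elimˡ h) (p y (∧-elimʳ {C y} h))

  -- Colours below k are rare from B to C, at the price of a factor S in size and
  -- of z further label digits.
  HasPairs : (k D S z : ℕ) → Set
  HasPairs k D S z = ∀ r V (A : Sub N) → 0 < # A → ∃ λ v → Refines r v (z + r) V ×
    Σ (Sub N) λ B → Σ (Sub N) λ C → B ⊆ A × C ⊆ A × # A ≤ S * # B × # A ≤ S * # C × SparseTo D r v
        k B C

  -- `m * z` digits, because a binary tree with `suc m` leaves has `m` inner nodes and each of them
  -- calls for one pair.
  HasFamilies : (k D S z m : ℕ) → Set
  HasFamilies k D S z m = ∀ r V (A : Sub N) → 0 < # A → ∃ λ v → Refines r v (m * z + r) V ×
    Σ (List (Sub N)) λ Us → length Us ≡ suc m ×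
      All (λ U → U ⊆ A × # A ≤ S * # U) Us × AllPairs (SparseTo D r v k) Us

  pairs-0 : ∀ D → HasPairs 0 D 1 0
  pairs-0 D r V A pos = V , refines-refl , A , A , (λ _ p → p) , (λ _ p → p) ,
    ≤-reflexive (sym (*-identityˡ (# A))) , ≤-reflexive (sym (*-identityˡ (# A))) , sparse
    where
    empty : ∀ x → # (A ∩ low r V 0 x) ≤ 0
    none : ∀ x → A ∩ low r V 0 x ⊆ (λ _ → false)
    none x y h with A y | does (x Fin.≟ y) | does (Q r (lab x y) ≟ V)
    none x y () | true | false | true
    none x y () | true | false | false
    none x y () | true | true | _
    none x y () | false | _ | _
    empty x = ≤-trans (#-mono {A = A ∩ low r V 0 x} {B = λ _ → false} (none x))
        (≤-reflexive (#-empty {N}))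
    sparse : SparseTo D r V 0 A A
    sparse x _ = ≤-trans (*-monoʳ-≤ D (empty x)) (≤-trans (≤-reflexive (*-zeroʳ D)) z≤n)

  survivors : (good : Sub N → Sub N) → Sub N → List (Sub N) → Sub N
  survivors good C [] = C
  survivors good C (U ∷ Us) = survivors good C Us ∩ good U

  survivors-⊆ : ∀ good C Us → survivors good C Us ⊆ C
  survivors-⊆ good C [] x p = p
  survivors-⊆ good C (U ∷ Us) x p = survivors-⊆ good C Us x (∧-elimˡ p)

  survivors-good : ∀ good C Us → ∀ x → survivors good C Us x ≡ true → All (λ U → good U x ≡ true) Us
  survivors-good good C [] x p = []
  survivors-good good C (U ∷ Us) x p =
    ∧-elimʳ {survivors good C Us x} p ∷ survivors-good good C Us x (∧-elimˡ p)

  survivors-size : ∀ c good C Us → All (λ U → c * # (C ∩ (not ∘ good U)) ≤ # C) Us →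
    c * # C ≤ c * # (survivors good C Us) + length Us * # C
  survivors-size c good C [] [] = m≤m+n (c * # C) 0
  survivors-size c good C (U ∷ Us) (p ∷ ps) = begin
    c * # C
      ≤⟨ survivors-size c good C Us ps ⟩
    c * # (survivors good C Us) + length Us * # C
      ≤⟨ +-monoˡ-≤ (length Us * # C) (*-monoʳ-≤ c (split-size (survivors good C Us)
          (survivors good C Us ∩ good U) (C ∩ (not ∘ good U)) cases)) ⟩
    c * (# (survivors good C Us ∩ good U) + # (C ∩ (not ∘ good U))) + length Us * # C
      ≡⟨ cong (_+ length Us * # C) (*-distribˡ-+ c (# (survivors good C Us ∩ good U))
          (# (C ∩ (not ∘ good U)))) ⟩
    c * # (survivors good C Us ∩ good U) + c * # (C ∩ (not ∘ good U)) + length Us * # C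
      ≤⟨ +-monoˡ-≤ (length Us * # C) (+-monoʳ-≤ (c * # (survivors good C Us ∩ good U)) p) ⟩
    c * # (survivors good C Us ∩ good U) + # C + length Us * # C
      ≡⟨ +-assoc (c * # (survivors good C Us ∩ good U)) (# C) (length Us * # C) ⟩
    c * # (survivors good C Us ∩ good U) + (# C + length Us * # C) ∎
    where
    open ≤-Reasoning
    cases : ∀ x → survivors good C Us x ≡ true →
      (survivors good C Us ∩ good U) x ≡ true ⊎ (C ∩ (not ∘ good U)) x ≡ true
    cases x q with good U x in eq
    ... | true = inj₁ (∧-intro q refl)
    ... | false = inj₂ (∧-intro (survivors-⊆ good C Us x q) refl)

  -- Markov's inequality, after counting the edges between U and C from both sides.
  reverse-sparse : ∀ n D {r₁ v₁ r₂ v₂ k} → Refines r₂ v₂ r₁ v₁ → (U B C : Sub N) → U ⊆ B → 0 < # U →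
    SparseTo (2 * (n * D)) r₁ v₁ k B C →
    2 * n * # (C ∩ λ y → not (does (D * # (U ∩ low r₂ v₂ k y) ≤? # U))) ≤ # C
  reverse-sparse n D {r₁} {v₁} {r₂} {v₂} {k} ref U B C U⊆B pos sparse =
    *-cancelʳ-≤ _ _ (# U) {{>-nonZero pos}} (begin
      2 * n * # bad * # U
        ≡⟨ *-assoc (2 * n) (# bad) (# U) ⟩
      2 * n * (# bad * # U)
        ≤⟨ *-monoʳ-≤ (2 * n) (wsum-≥ {A = bad} λ y p → <⇒≤
            (≰⇒> (not-does (D * deg y ≤? # U) (∧-elimʳ {C y} p)))) ⟩
      2 * n * wsum bad (λ y → D * deg y)
        ≤⟨ *-monoʳ-≤ (2 * n) (wsum-mono-⊆ {A = bad} {B = C} (λ y → D * deg y) (λ y → ∧-elimˡ)) ⟩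
      2 * n * wsum C (λ y → D * deg y)
        ≡⟨ cong (2 * n *_) (sym (wsum-*ˡ C deg D)) ⟩
      2 * n * (D * wsum C deg)
        ≡⟨ lem n D (wsum C deg) ⟩
      2 * (n * D) * wsum C deg
        ≡⟨ cong (2 * (n * D) *_) (wsum-swap C U (low r₂ v₂ k)) ⟩
      2 * (n * D) * wsum U (λ x → # (C ∩ λ y → low r₂ v₂ k y x))
        ≡⟨ wsum-*ˡ U (λ x → # (C ∩ λ y → low r₂ v₂ k y x)) (2 * (n * D)) ⟩
      wsum U (λ x → 2 * (n * D) * # (C ∩ λ y → low r₂ v₂ k y x))
        ≤⟨ wsum-≤ {A = U} bound ⟩
      # U * # C
        ≡⟨ *-comm (# U) (# C) ⟩
      # C * # U ∎)
    where
    open ≤-Reasoning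
    deg : Fin N → ℕ
    deg y = # (U ∩ low r₂ v₂ k y)
    bad : Sub N
    bad = C ∩ λ y → not (does (D * deg y ≤? # U))
    lem : ∀ n d w → 2 * n * (d * w) ≡ 2 * (n * d) * w
    lem = solve-∀
    bound : ∀ x → U x ≡ true → 2 * (n * D) * # (C ∩ λ y → low r₂ v₂ k y x) ≤ # C
    bound x p = ≤-trans (*-monoʳ-≤ (2 * (n * D)) (#-mono {A = C ∩ λ y → low r₂ v₂ k y x}
        {B = C ∩ low r₁ v₁ k x}
      (∩-monoʳ C {λ y → low r₂ v₂ k y x} {low r₁ v₁ k x}
          (λ y q → low-refine {k = k} ref x y (trans (low-sym r₂ v₂ k x y) q)))))
      (sparse x (U⊆B x p))

  good : (D r v k : ℕ) → Sub N → Sub N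
  good D r v k U y = does (D * # (U ∩ low r v k y) ≤? # U)

  positive : ∀ s {a b} → 0 < a → a ≤ s * b → 0 < b
  positive s {a} {zero} pos le = ⊥-elim (<⇒≱ pos (≤-trans le (≤-reflexive (*-zeroʳ s))))
  positive s {a} {suc b} pos le = s≤s z≤n

  -- By `reverse-sparse` each of the at most `n` members of `Bs` rules out at most a `1/(2n)` share
  -- of `C`.
  survivors-half : ∀ {k n D r₁ v₁ r₂ v₂} .{{_ : NonZero n}} (P : ℕ) {B C : Sub N}
      {Bs : List (Sub N)} →
    Refines r₂ v₂ r₁ v₁ → 0 < # B → SparseTo (2 * (n * D)) r₁ v₁ k B C → length Bs ≤ n →
    All (λ U → U ⊆ B × # B ≤ P * # U) Bs → # C ≤ 2 * # (survivors (good D r₂ v₂ k) C Bs)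
  survivors-half {k} {n} {D} {r₁} {v₁} {r₂} {v₂} P {B} {C} {Bs} ref posB sparse len all =
    halve n (# C) (# (survivors (good D r₂ v₂ k) C Bs)) (length Bs) len
      (survivors-size (2 * n) (good D r₂ v₂ k) C Bs
        (All.map (λ {U} (U⊆ , sU) → reverse-sparse n D {k = k} ref U B C U⊆ (positive P posB sU)
            sparse) all))
    where
    open ≤-Reasoning
    halve : ∀ n .{{_ : NonZero n}} c c′ l → l ≤ n → 2 * n * c ≤ 2 * n * c′ + l * c → c ≤ 2 * c′
    halve n c c′ l l≤n le = *-cancelˡ-≤ n (+-cancelʳ-≤ (n * c) (n * c) (n * (2 * c′)) (begin
      n * c + n * c             ≡⟨ lem₄ n c ⟩
      2 * n * c                 ≤⟨ le ⟩
      2 * n * c′ + l * c        ≤⟨ +-mono-≤ (≤-reflexive (lem₅ n c′)) (*-monoˡ-≤ c l≤n) ⟩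
      n * (2 * c′) + n * c      ∎))
      where
      lem₄ : ∀ n c → n * c + n * c ≡ 2 * n * c
      lem₄ = solve-∀
      lem₅ : ∀ n c → 2 * n * c ≡ n * (2 * c)
      lem₅ = solve-∀

  -- The order `Cs ++ Bs` matters: survivors are selected by their degrees into the members of `Bs`,
  -- so sparseness runs from `Cs` to `Bs`. Inside `Bs` it persists, since a longer prefix only
  -- removes edges.
  join-sparse : ∀ {k D r₂ v₂ r v C} {Bs Cs : List (Sub N)} → Refines r v r₂ v₂ →
    AllPairs (SparseTo D r₂ v₂ k) Bs → AllPairs (SparseTo D r v k) Cs →
    All (λ U → U ⊆ survivors (good D r₂ v₂ k) C Bs) Cs → AllPairs (SparseTo D r v k) (Cs ++ Bs)
  join-sparse {k} {D} {r₂} {v₂} {r} {v} {C} {Bs} ref apB apC sub =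
    AllPairs.++⁺ apC (AllPairs.map (λ {U} {W} sp x p → ≤-trans (shrink W x) (sp x p)) apB)
      (All.map cross sub)
    where
    shrink : ∀ W x → D * # (W ∩ low r v k x) ≤ D * # (W ∩ low r₂ v₂ k x)
    shrink W x = *-monoʳ-≤ D (#-mono {A = W ∩ low r v k x} {B = W ∩ low r₂ v₂ k x}
        (∩-monoʳ W {low r v k x} {low r₂ v₂ k x} (low-refine {k = k} ref x)))
    cross : ∀ {U} → U ⊆ survivors (good D r₂ v₂ k) C Bs → All (SparseTo D r v k U) Bs
    cross {U} U⊆ = All.tabulate λ {W} W∈ x p → ≤-trans (shrink W x)
      (does-true (D * # (W ∩ low r₂ v₂ k x) ≤? # W)
        (All.lookup (survivors-good (good D r₂ v₂ k) C Bs x (U⊆ x p)) W∈))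

  join-sizes : ∀ {S P} {good : Sub N → Sub N} {A B C : Sub N} {Bs Cs : List (Sub N)} → B ⊆ A →
      C ⊆ A →
    # A ≤ S * # B → # A ≤ S * # C → # C ≤ 2 * # (survivors good C Bs) →
    All (λ U → U ⊆ B × # B ≤ P * # U) Bs →
    All (λ U → U ⊆ survivors good C Bs × # (survivors good C Bs) ≤ P * # U) Cs →
    All (λ U → U ⊆ A × # A ≤ 2 * S * P * # U) (Cs ++ Bs)
  join-sizes {S} {P} {good} {A} {B} {C} {Bs} B⊆ C⊆ sB sC sC′ allB allC = All.++⁺
    (All.map (λ {U} (U⊆ , sU) → (λ x p → C⊆ x (survivors-⊆ good C Bs x (U⊆ x p))) ,
      ≤-trans sC (≤-trans (*-monoʳ-≤ S (≤-trans sC′ (*-monoʳ-≤ 2 sU)))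
          (≤-reflexive (lem₂ S P (# U))))) allC)
    (All.map (λ {U} (U⊆ , sU) → (λ x p → B⊆ x (U⊆ x p)) ,
      ≤-trans sB (≤-trans (m≤n*m (S * # B) 2) (≤-trans (*-monoʳ-≤ 2 (*-monoʳ-≤ S sU))
          (≤-reflexive (lem₃ S P (# U)))))) allB)
    where
    lem₂ : ∀ S p u → S * (2 * (p * u)) ≡ 2 * S * p * u
    lem₂ = solve-∀
    lem₃ : ∀ S p u → 2 * (S * (p * u)) ≡ 2 * S * p * u
    lem₃ = solve-∀

  -- The depth `d` governs the sizes: each level loses `S` for the pair and 2 for the survivors. The
  -- factor `2 * n` in the required density is consumed by Markov's inequality and is not compounded
  -- along the tree, because sparseness between `Bs` and `Cs` is fixed at their lowest common node.
  families : ∀ k n D S z .{{_ : NonZero n}} .{{_ : NonZero S}} → HasPairs k (2 * (n * D)) S z →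
    ∀ d m → suc m ≤ 2 ^ d → suc m ≤ n → HasFamilies k D ((2 * S) ^ d) z m
  families k n D S z pairs d zero _ _ r V A pos =
    V , refines-refl , A ∷ [] , refl ,
    (((λ _ p → p) , m≤n*m (# A) ((2 * S) ^ d) {{m^n≢0 (2 * S) d {{m*n≢0 2 S}}}}) ∷ []) , ([] ∷ [])
  families k n D S z pairs zero (suc m) (s≤s ()) _
  families k n D S z pairs (suc d) (suc m) le₁ le₂ r V A pos
    with pairs (⌊ m /2⌋ * z + (⌈ m /2⌉ * z + r)) V A pos
  ... | v₁ , ref₁ , B , C , B⊆ , C⊆ , sB , sC , sparse
    -- `⌈ m /2⌉ * z` digits are held back here. The second subtree spends them below the prefix
    -- `v₂`, so that one prefix ends up serving both subtrees.
    with families k n D S z pairs d ⌊ m /2⌋ a≤ a≤n (⌈ m /2⌉ * z + r) v₁ B (positive S pos sB)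
    where
    a≤ : suc ⌊ m /2⌋ ≤ 2 ^ d
    a≤ = ≤-trans (s≤s (⌊n/2⌋≤⌈n/2⌉ m)) (half≤ m d le₁)
    a≤n : suc ⌊ m /2⌋ ≤ n
    a≤n = ≤-trans (s≤s (⌊n/2⌋≤n m)) (≤-trans (n≤1+n (suc m)) le₂)
  ... | v₂ , ref₂ , Bs , lenB , allB , apB
    with families k n D S z pairs d ⌈ m /2⌉ b≤ b≤n r v₂
        (survivors (good D (⌈ m /2⌉ * z + r) v₂ k) C Bs)
           (positive 2 (positive S pos sC) half)
    where
    b≤ : suc ⌈ m /2⌉ ≤ 2 ^ d
    b≤ = half≤ m d le₁
    b≤n : suc ⌈ m /2⌉ ≤ n
    b≤n = ≤-trans (s≤s (⌈n/2⌉≤n m)) (≤-trans (n≤1+n (suc m)) le₂)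
    half : # C ≤ 2 * # (survivors (good D (⌈ m /2⌉ * z + r) v₂ k) C Bs)
    half = survivors-half {k} {n} {D} ((2 * S) ^ d) ref₂ (positive S pos sB) sparse
      (≤-trans (≤-reflexive lenB) (≤-trans (s≤s (⌊n/2⌋≤n m)) (≤-trans (n≤1+n (suc m)) le₂))) allB
  ... | v₃ , ref₃ , Cs , lenC , allC , apC =
    v₃ , subst (λ R → Refines r v₃ R V) r≡ (refines-trans ref₃ (refines-trans ref₂ ref₁)) , Cs ++
        Bs ,
    trans (length-++ Cs) (trans (cong₂ _+_ lenC lenB)
      (cong suc (trans (+-suc ⌈ m /2⌉ ⌊ m /2⌋) (cong suc
          (trans (+-comm ⌈ m /2⌉ ⌊ m /2⌋) (⌊n/2⌋+⌈n/2⌉≡n m)))))) ,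
    join-sizes {S} {(2 * S) ^ d} {good D (⌈ m /2⌉ * z + r) v₂ k} B⊆ C⊆ sB sC half allB allC ,
        join-sparse {k} {D} ref₃ apB apC (All.map proj₁ allC)
    where
    half : # C ≤ 2 * # (survivors (good D (⌈ m /2⌉ * z + r) v₂ k) C Bs)
    half = survivors-half {k} {n} {D} ((2 * S) ^ d) ref₂ (positive S pos sB) sparse
      (≤-trans (≤-reflexive lenB) (≤-trans (s≤s (⌊n/2⌋≤n m)) (≤-trans (n≤1+n (suc m)) le₂))) allB
    lem : ∀ z a b r → z + (a * z + (b * z + r)) ≡ suc (a + b) * z + r
    lem = solve-∀
    r≡ : z + (⌊ m /2⌋ * z + (⌈ m /2⌉ * z + r)) ≡ suc m * z + r
    r≡ = trans (lem z ⌊ m /2⌋ ⌈ m /2⌉ r) (cong (λ j → suc j * z + r) (⌊n/2⌋+⌈n/2⌉≡n m))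

  -- Making one more colour sparse

  Monochromatic : ∀ {n} → ℕ → (Fin n → Fin n → Fin β) → Set
  Monochromatic {n} k g = Σ ℕ λ r → Σ ℕ λ v → Σ (Fin n → Fin N) λ f →
    ∀ a b → a Fin.< b → exact r (v * β + toℕ (g a b)) k (f a) (f b) ≡ true

  low-suc : ∀ r v k x y → low r v (suc k) x y ≡ true → low r v k x y ≡ true ⊎ exact r v k x y ≡ true
  low-suc r v k x y h with does (x Fin.≟ y) | does (Q r (lab x y) ≟ v)
  ... | false | true with m≤n⇒m<n∨m≡n (≤-pred (does-true (col x y <? suc k) h))
  ...   | inj₁ lt = inj₁ (true-does (col x y <? k) lt)
  ...   | inj₂ eq = inj₂ (true-does (col x y ≟ k) eq)

  -- The search for `g` cuts the target by at most `(2 * D) ^ m`, so density `(2 * D) ^ suc m` for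
  -- the colours below `k` leaves them `2 * D` afterwards. Being stuck gives `2 * D` for colour `k`,
  -- and the two bounds add up to `D`.
  pairs-suc : ∀ k m D S z (g : Fin (suc m) → Fin (suc m) → Fin β) .{{_ : NonZero D}} →
      ¬ Monochromatic k g →
    HasFamilies k ((2 * D) ^ suc m) S z m → HasPairs (suc k) D (S * (suc m * (2 * D) ^ m))
        (m * z + 1)
  pairs-suc k m D S z g none families r V A pos
    -- The families stop one digit early. This digit carries the pattern during the search, and is
    -- then set to the value of `g` at the pair where the search got stuck.
    with families (suc r) V A pos
  ... | v , ref , Us , len , allU , apU
    with family len allU apU
  ... | U , inU , sparseU
    with transversal-or-sparse m (λ a b → exact r (v * β + toℕ (g a b)) k) U (2 * D)
        (>-nonZero⁻¹ (2 * D) {{m*n≢0 2 D}})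
           (λ b → positive S pos (proj₂ (inU b)))
  ... | inj₁ (f , _ , ok) = ⊥-elim (none (r , v , f , ok))
  ... | inj₂ sp = v * β + toℕ (g a b) ,
      subst (λ R → Refines r (v * β + toℕ (g a b)) R V) (lem (m * z) r) (refines-trans digit ref) ,
      B , C , (λ x p → proj₁ (inU a) x (B⊆ x p)) , (λ x p → proj₁ (inU b) x (C⊆ x p)) ,
      ≤-trans (proj₂ (inU a)) (≤-trans (*-monoʳ-≤ S sizeB)
          (≤-reflexive (sym (*-assoc S _ (# B))))) ,
      ≤-trans (proj₂ (inU b)) (≤-trans (*-monoʳ-≤ S (≤-trans sizeC
          (*-monoˡ-≤ (# C) (m≤n*m ((2 * D) ^ m) (suc m)))))
        (≤-reflexive (sym (*-assoc S _ (# C))))) ,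
      sparseBC
    where
    open SparsePair sp
    open ≤-Reasoning
    instance
      2D≢0 : NonZero (2 * D)
      2D≢0 = m*n≢0 2 D
    w = v * β + toℕ (g a b)
    digit : Refines r w (suc r) v
    digit = refines-digit r v (toℕ (g a b)) (Fin.toℕ<n (g a b))
    lem : ∀ y r → y + suc r ≡ y + 1 + r
    lem = solve-∀
    lower : ∀ x → B x ≡ true → 2 * D * # (C ∩ low r w k x) ≤ # C
    lower x p = *-cancelˡ-≤ ((2 * D) ^ m) {{m^n≢0 (2 * D) m}} (begin
      (2 * D) ^ m * (2 * D * # (C ∩ low r w k x))
        ≤⟨ *-monoʳ-≤ ((2 * D) ^ m) (*-monoʳ-≤ (2 * D) (#-mono {A = C ∩ low r w k x}
            {B = U b ∩ low (suc r) v k x}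
             λ y h → ∧-intro (C⊆ y (∧-elimˡ h)) (low-refine {k = k} digit x y (∧-elimʳ {C y} h)))) ⟩
      (2 * D) ^ m * (2 * D * # (U b ∩ low (suc r) v k x))
        ≡⟨ lem₁ ((2 * D) ^ m) (2 * D) (# (U b ∩ low (suc r) v k x)) ⟩
      (2 * D) ^ suc m * # (U b ∩ low (suc r) v k x)
        ≤⟨ sparseU a b a<b x (B⊆ x p) ⟩
      # (U b)
        ≤⟨ sizeC ⟩
      (2 * D) ^ m * # C ∎)
      where
      lem₁ : ∀ p e y → p * (e * y) ≡ e * p * y
      lem₁ = solve-∀
    sparseBC : SparseTo D r w (suc k) B C
    sparseBC x p = *-cancelˡ-≤ 2 (begin
      2 * (D * # (C ∩ low r w (suc k) x))
        ≤⟨ *-monoʳ-≤ 2 (*-monoʳ-≤ D (split-size (C ∩ low r w (suc k) x) (C ∩ low r w k x)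
            (C ∩ exact r w k x) cases)) ⟩
      2 * (D * (# (C ∩ low r w k x) + # (C ∩ exact r w k x)))
        ≡⟨ lem₂ D (# (C ∩ low r w k x)) (# (C ∩ exact r w k x)) ⟩
      2 * D * # (C ∩ low r w k x) + 2 * D * # (C ∩ exact r w k x)
        ≤⟨ +-mono-≤ (lower x p) (sparse x p) ⟩
      # C + # C
        ≡⟨ cong (# C +_) (sym (+-identityʳ (# C))) ⟩
      2 * # C ∎)
      where
      lem₂ : ∀ d y z → 2 * (d * (y + z)) ≡ 2 * d * y + 2 * d * z
      lem₂ = solve-∀
      cases : ∀ y → (C ∩ low r w (suc k) x) y ≡ true → (C ∩ low r w k x) y ≡ true ⊎
          (C ∩ exact r w k x) y ≡ true
      cases y h with low-suc r w k x y (∧-elimʳ {C y} h)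
      ... | inj₁ l = inj₁ (∧-intro {C y} (∧-elimˡ {C y} h) l)
      ... | inj₂ e = inj₂ (∧-intro {C y} (∧-elimˡ {C y} h) e)

-- Embedding in the last colour

⋃ : ∀ {N k} → (Fin k → Sub N) → Sub N
⋃ B x = does (Fin.any? (λ b → B b x Bool.≟ true))

⋃-∉ : ∀ {N k} (B : Fin k → Sub N) x → not (⋃ B x) ≡ true → ∀ b → B b x ≢ true
⋃-∉ B x h b q = not-does (Fin.any? (λ b → B b x Bool.≟ true)) h (b , q)

⋃-size : ∀ {N k} (B : Fin k → Sub N) {u θ} → (∀ b → # (B b) * u ≤ θ) → # (⋃ B) * u ≤ k * θ
⋃-size {k = k} B {u} {θ} le = begin
  # (⋃ B) * u                  ≤⟨ *-monoˡ-≤ u (#≤∑# {A = ⋃ B} {B = B} λ x h →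
      does-true (Fin.any? (λ b → B b x Bool.≟ true)) h) ⟩
  sum (λ b → # (B b)) * u      ≡⟨ *-distribʳ-sum u (λ b → # (B b)) ⟩
  sum (λ b → # (B b) * u)      ≤⟨ sum-mono le ⟩
  sum {k} (λ _ → θ)            ≡⟨ sum-const k θ ⟩
  k * θ                        ∎
  where
  open ≤-Reasoning

module _ {N K : ℕ} .{{_ : NonZero K}} {L : Set} (nb : L → Fin N → Sub N)
  (upper : ∀ w (Z W : Sub N) → K * wsum Z (λ x → # (W ∩ nb w x)) ≤ 2 * (# Z * # W) + 6 * (K * N))
  (lower : ∀ w (Z W : Sub N) → # Z * # W ≤ 2 * (K * wsum Z (λ x → # (W ∩ nb w x))) + 14 * (K * N))
  (R : Fin N → Sub N) where

  -- In twice the inequality `lower`, thinness bounds the main term by `# Z * # W`, which cancels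
  -- and leaves the error.
  thin-size : ∀ w (Z W : Sub N) → (∀ x → Z x ≡ true → 4 * K * # (W ∩ nb w x) ≤ # W) →
      # Z * # W ≤ 28 * (K * N)
  thin-size w Z W p = +-cancelˡ-≤ (# Z * # W) _ _ (begin
    # Z * # W + # Z * # W
      ≡⟨ cong (# Z * # W +_) (sym (+-identityʳ (# Z * # W))) ⟩
    2 * (# Z * # W)
      ≤⟨ *-monoʳ-≤ 2 (lower w Z W) ⟩
    2 * (2 * (K * e) + 14 * (K * N))
      ≡⟨ lem K e N ⟩
    4 * K * e + 28 * (K * N)
      ≤⟨ +-monoˡ-≤ (28 * (K * N)) (≤-trans (≤-reflexive
          (wsum-*ˡ Z (λ x → # (W ∩ nb w x)) (4 * K))) (wsum-≤ {A = Z} p)) ⟩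
    # Z * # W + 28 * (K * N) ∎)
    where
    open ≤-Reasoning
    e : ℕ
    e = wsum Z (λ x → # (W ∩ nb w x))
    lem : ∀ K e N → 2 * (2 * (K * e) + 14 * (K * N)) ≡ 4 * K * e + 28 * (K * N)
    lem = solve-∀

  -- The constant 64 is `16 * 2 * 2`: the size loss `16 * K` of a step, the factor 2 in `upper`, and
  -- a doubling that lets the main term cancel.
  crowded-size : ∀ w D (X V W : Sub N) → 64 * D * # W ≤ # V →
    (∀ x → X x ≡ true → # V ≤ D * (16 * K) * # (W ∩ nb w x)) → # X * # V ≤ 192 * (D * (K * N))
  crowded-size w D X V W sparse p = +-cancelˡ-≤ (# X * # V) _ _ (begin
    # X * # V + # X * # V
      ≡⟨ cong (# X * # V +_) (sym (+-identityʳ (# X * # V))) ⟩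
    2 * (# X * # V)
      ≤⟨ *-monoʳ-≤ 2 (≤-trans (wsum-≥ {A = X} p) (≤-reflexive
          (sym (wsum-*ˡ X (λ x → # (W ∩ nb w x)) (D * (16 * K)))))) ⟩
    2 * (D * (16 * K) * e)
      ≡⟨ lem₁ D K e ⟩
    32 * D * (K * e)
      ≤⟨ *-monoʳ-≤ (32 * D) (upper w X W) ⟩
    32 * D * (2 * (# X * # W) + 6 * (K * N))
      ≡⟨ lem₂ D (# X) (# W) (K * N) ⟩
    # X * (64 * D * # W) + 192 * (D * (K * N))
      ≤⟨ +-monoˡ-≤ (192 * (D * (K * N))) (*-monoʳ-≤ (# X) sparse) ⟩
    # X * # V + 192 * (D * (K * N)) ∎)
    where
    open ≤-Reasoning
    e : ℕ
    e = wsum X (λ x → # (W ∩ nb w x))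
    lem₁ : ∀ d K e → 2 * (d * (16 * K) * e) ≡ 32 * d * (K * e)
    lem₁ = solve-∀
    lem₂ : ∀ d x w y → 32 * d * (2 * (x * w) + 6 * y) ≡ x * (64 * d * w) + 192 * (d * y)
    lem₂ = solve-∀

  -- Double counting of the pairs related by `cr`: they are many from each `x` in `Z`, but few from
  -- each `y` in `A`.
  heavy-size : ∀ c θ (Z A B : Sub N) (cr : Fin N → Sub N) → 0 < # A →
    (∀ x → Z x ≡ true → # A ≤ c * # (A ∩ cr x)) →
    (∀ y → A y ≡ true → # (Z ∩ λ x → cr x y) * # B ≤ θ) → # Z * # B ≤ c * θ
  heavy-size c θ Z A B cr pos p q = *-cancelʳ-≤ _ _ (# A) {{>-nonZero pos}} (begin
    # Z * # B * # A
      ≡⟨ lem₁ (# Z) (# B) (# A) ⟩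
    # Z * # A * # B
      ≤⟨ *-monoˡ-≤ (# B) (≤-trans (wsum-≥ {A = Z} p) (≤-reflexive
          (sym (wsum-*ˡ Z (λ x → # (A ∩ cr x)) c)))) ⟩
    c * wsum Z (λ x → # (A ∩ cr x)) * # B
      ≡⟨ cong (λ s → c * s * # B) (wsum-swap Z A cr) ⟩
    c * wsum A (λ y → # (Z ∩ λ x → cr x y)) * # B
      ≡⟨ lem₂ c (wsum A (λ y → # (Z ∩ λ x → cr x y))) (# B) ⟩
    c * (# B * wsum A (λ y → # (Z ∩ λ x → cr x y)))
      ≡⟨ cong (c *_) (wsum-*ˡ A (λ y → # (Z ∩ λ x → cr x y)) (# B)) ⟩
    c * wsum A (λ y → # B * # (Z ∩ λ x → cr x y))
      ≤⟨ *-monoʳ-≤ c (wsum-≤ {A = A} λ y h → ≤-trans (≤-reflexive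
          (*-comm (# B) (# (Z ∩ λ x → cr x y)))) (q y h)) ⟩
    c * (# A * θ)
      ≡⟨ lem₃ c (# A) θ ⟩
    c * θ * # A ∎)
    where
    open ≤-Reasoning
    lem₁ : ∀ z b a → z * b * a ≡ z * a * b
    lem₁ = solve-∀
    lem₂ : ∀ c w b → c * w * b ≡ c * (b * w)
    lem₂ = solve-∀
    lem₃ : ∀ c a t → c * (a * t) ≡ c * t * a
    lem₃ = solve-∀

  -- One step of the greedy embedding: a vertex x of A is chosen for which every
  -- V b keeps many neighbours of label w b and few vertices y whose exceptional
  -- degree into a later V b′ exceeds its expected share inside the label class of x.
  module Step (m D θ : ℕ) (w : Fin m → L) (A : Sub N) (V : Fin m → Sub N) (u : ℕ)
    (u≥1 : 1 ≤ u) (uA : u ≤ # A) (uV : ∀ b → u ≤ # (V b)) where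

    module _
      (sparseA : ∀ b x → A x ≡ true → 64 * D * # (V b ∩ R x) ≤ # (V b))
      (sparseV : ∀ a b → a Fin.< b → ∀ y → V a y ≡ true → 64 * D * # (V b ∩ R y) ≤ # (V b))
      (D-large : 16 * K ≤ 64 * D) (θ-large₁ : 28 * (K * N) ≤ θ)
      (θ-large₂ : 16 * K * m * (192 * (D * (K * N))) ≤ θ) (big : (m + m * m) * θ < u * u) where

      thin : Fin m → Sub N
      thin b x = A x ∧ does (4 * K * # (V b ∩ nb (w b) x) ≤? # (V b))

      -- The threshold is the `1/D` share of `# (V b) / (16 * K)`, the size guaranteed for the next
      -- set. Dropping crowded vertices therefore keeps the next sets sparse with parameter `D`.
      crowded : Fin m → Fin m → Fin N → Sub N
      crowded a b x y = does (a Fin.<? b) ∧ does (# (V b) ≤? D * (16 * K) * #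
          ((V b ∩ R y) ∩ nb (w b) x))

      heavy : Fin m → Fin m → Sub N
      heavy a b x = A x ∧ does (# (V a) ≤? 16 * K * m * # (V a ∩ crowded a b x))

      thin-≤ : ∀ b → # (thin b) * # (V b) ≤ 28 * (K * N)
      thin-≤ b = thin-size (w b) (thin b) (V b) λ x h →
        does-true (4 * K * # (V b ∩ nb (w b) x) ≤? # (V b)) (∧-elimʳ {A x} h)

      heavy-≤ : ∀ a b → # (heavy a b) * # (V b) ≤ θ
      heavy-≤ a b = ≤-trans (heavy-size (16 * K * m) (192 * (D * (K * N))) (heavy a b) (V a) (V b)
          (crowded a b)
        (≤-trans u≥1 (uV a))
        (λ x h → does-true (# (V a) ≤? 16 * K * m * # (V a ∩ crowded a b x)) (∧-elimʳ {A x} h))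
        light) θ-large₂
        where
        light : ∀ y → V a y ≡ true → # (heavy a b ∩ λ x → crowded a b x y) * # (V b) ≤ 192 *
            (D * (K * N))
        light y h with a Fin.<? b
        ... | yes lt = crowded-size (w b) D _ (V b) (V b ∩ R y) (sparseV a b lt y h) λ x q →
                does-true (# (V b) ≤? D * (16 * K) * # ((V b ∩ R y) ∩ nb (w b) x))
                    (∧-elimʳ {does (a Fin.<? b)} (∧-elimʳ {heavy a b x} q))
        ... | no ¬lt = ≤-trans (≤-reflexive (cong (_* # (V b))
            (n≤0⇒n≡0 (≤-trans (#-mono {A = heavy a b ∩ λ x → crowded a b x y} {B = λ _ → false} λ
            x q → ⊥-elim (¬lt (does-true (a Fin.<? b) (∧-elimˡ (∧-elimʳ {heavy a b x} q)))))
            (≤-reflexive (#-empty {N}))))))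
                z≤n

      thins heavies good : Sub N
      thins = ⋃ thin
      heavies = ⋃ (λ a → ⋃ (heavy a))
      good x = A x ∧ not (thins x) ∧ not (heavies x)

      -- `m` thin and `m * m` heavy sets of at most `θ / u` elements each cannot cover `A`, which
      -- has at least `u` elements.
      good-pos : 0 < # good
      good-pos with # good in eq
      ... | suc _ = s≤s z≤n
      ... | zero = ⊥-elim (<⇒≱ big (begin
          u * u                                       ≤⟨ *-monoˡ-≤ u uA ⟩
          # A * u                                     ≤⟨ *-monoˡ-≤ u covered ⟩
          (# thins + # heavies) * u                   ≡⟨ *-distribʳ-+ u (# thins) (# heavies) ⟩
          # thins * u + # heavies * u                 ≤⟨ +-mono-≤ thins-≤ heavies-≤ ⟩
          m * θ + m * (m * θ)                     ≡⟨ lem m (θ) ⟩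
          (m + m * m) * θ                           ∎))
        where
        open ≤-Reasoning
        lem : ∀ m t → m * t + m * (m * t) ≡ (m + m * m) * t
        lem = solve-∀
        cases : ∀ x → A x ≡ true → thins x ≡ true ⊎ (good x ≡ true ⊎ heavies x ≡ true)
        cases x h with thins x | heavies x
        ... | true | _ = inj₁ refl
        ... | false | true = inj₂ (inj₂ refl)
        ... | false | false = inj₂ (inj₁ (∧-intro h refl))
        covered : # A ≤ # thins + # heavies
        covered = ≤-trans (split-size A thins (λ x → good x Bool.∨ heavies x) λ x h →
            case x (cases x h))
          (+-monoʳ-≤ (# thins) (≤-trans (split-size _ good heavies λ x h → or (good x) h)
              (≤-reflexive (cong (_+ # heavies) eq))))
          where
          or : ∀ a {b} → a Bool.∨ b ≡ true → a ≡ true ⊎ b ≡ true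
          or true _ = inj₁ refl
          or false h = inj₂ h
          case : ∀ x → thins x ≡ true ⊎ (good x ≡ true ⊎ heavies x ≡ true) →
              thins x ≡ true ⊎ good x Bool.∨ heavies x ≡ true
          case x (inj₁ p) = inj₁ p
          case x (inj₂ (inj₁ p)) rewrite p = inj₂ refl
          case x (inj₂ (inj₂ p)) with good x
          ... | true = inj₂ refl
          ... | false = inj₂ p
        thins-≤ : # thins * u ≤ m * θ
        thins-≤ = ⋃-size thin λ b → ≤-trans (*-monoʳ-≤ (# (thin b)) (uV b))
            (≤-trans (thin-≤ b) θ-large₁)
        heavies-≤ : # heavies * u ≤ m * (m * θ)
        heavies-≤ = ⋃-size (λ a → ⋃ (heavy a)) λ a → ⋃-size (heavy a) λ b →
          ≤-trans (*-monoʳ-≤ (# (heavy a b)) (uV b)) (heavy-≤ a b)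

      x : Fin N
      x = proj₁ (#-pos good good-pos)

      x-good : good x ≡ true
      x-good = proj₂ (#-pos good good-pos)

      x∈A : A x ≡ true
      x∈A = ∧-elimˡ {A x} x-good

      rich : ∀ b → # (V b) ≤ 4 * K * # (V b ∩ nb (w b) x)
      rich b = <⇒≤ (≰⇒> λ le → ⋃-∉ thin x (∧-elimˡ {not (thins x)} (∧-elimʳ {A x} x-good)) b
        (∧-intro x∈A (true-does (4 * K * # (V b ∩ nb (w b) x) ≤? # (V b)) le)))

      uncrowded : ∀ a b → 16 * K * m * # (V a ∩ crowded a b x) ≤ # (V a)
      uncrowded a b = <⇒≤ (≰⇒> λ le → ⋃-∉ (λ a → ⋃ (heavy a)) x
          (∧-elimʳ {not (thins x)} (∧-elimʳ {A x} x-good)) a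
        (true-does (Fin.any? (λ b → heavy a b x Bool.≟ true))
          (b , ∧-intro x∈A (true-does (# (V a) ≤? 16 * K * m * # (V a ∩ crowded a b x)) le))))

      V′ : Fin m → Sub N
      V′ a = V a ∩ nb (w a) x ∩ (not ∘ R x) ∩ (not ∘ ⋃ (λ b → crowded a b x))

      -- In units of `# (V a) / (16 * K)`: the label neighbourhood of `x` has at least 4, its
      -- exceptional neighbours take at most 1, and all crowded vertices together at most 1.
      V′-size : ∀ a → # (V a) ≤ 16 * K * # (V′ a)
      V′-size a = ≤-trans (m≤n*m (# (V a)) 2) (+-cancelʳ-≤ (2 * # (V a)) _ _ (begin
        2 * # (V a) + 2 * # (V a)
          ≡⟨ lem₁ (# (V a)) ⟩
        4 * # (V a)
          ≤⟨ *-monoʳ-≤ 4 (rich a) ⟩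
        4 * (4 * K * # (V a ∩ nb (w a) x))
          ≡⟨ lem₂ K (# (V a ∩ nb (w a) x)) ⟩
        16 * K * # (V a ∩ nb (w a) x)
          ≤⟨ *-monoʳ-≤ (16 * K) parts ⟩
        16 * K * (# (V′ a) + (# (V a ∩ R x) + # (V a ∩ ⋃ (λ b → crowded a b x))))
          ≡⟨ lem₃ (16 * K) (# (V′ a)) (# (V a ∩ R x)) (# (V a ∩ ⋃ (λ b → crowded a b x))) ⟩
        16 * K * # (V′ a) + (16 * K * # (V a ∩ R x) + 16 * K * # (V a ∩ ⋃ (λ b → crowded a b x)))
          ≤⟨ +-monoʳ-≤ (16 * K * # (V′ a)) (+-mono-≤ part₁
              (part₂ m a (V a) (λ b → crowded a b x) (uncrowded a))) ⟩
        16 * K * # (V′ a) + (# (V a) + # (V a))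
          ≡⟨ cong (λ z → 16 * K * # (V′ a) + (# (V a) + z)) (sym (+-identityʳ (# (V a)))) ⟩
        16 * K * # (V′ a) + 2 * # (V a) ∎))
        where
        open ≤-Reasoning
        lem₁ : ∀ v → 2 * v + 2 * v ≡ 4 * v
        lem₁ = solve-∀
        lem₂ : ∀ K y → 4 * (4 * K * y) ≡ 16 * K * y
        lem₂ = solve-∀
        lem₃ : ∀ c p q r → c * (p + (q + r)) ≡ c * p + (c * q + c * r)
        lem₃ = solve-∀
        cr : Sub N
        cr = ⋃ (λ b → crowded a b x)
        parts : # (V a ∩ nb (w a) x) ≤ # (V′ a) + (# (V a ∩ R x) + # (V a ∩ cr))
        parts = ≤-trans (split-size (V a ∩ nb (w a) x) (V′ a) (λ y → V a y ∧ (R x y Bool.∨ cr y))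
            λ y h → go (V a y) (nb (w a) x y) (R x y) (cr y) h)
          (+-monoʳ-≤ (# (V′ a)) (split-size (λ y → V a y ∧ (R x y Bool.∨ cr y)) (V a ∩ R x)
              (V a ∩ cr) λ y h → go₂ (V a y) (R x y) (cr y) h))
          where
          go : ∀ p q r s → p ∧ q ≡ true → p ∧ q ∧ not r ∧ not s ≡ true ⊎ p ∧ (r Bool.∨ s) ≡ true
          go true true true s _ = inj₂ refl
          go true true false true _ = inj₂ refl
          go true true false false _ = inj₁ refl
          go₂ : ∀ p r s → p ∧ (r Bool.∨ s) ≡ true → p ∧ r ≡ true ⊎ p ∧ s ≡ true
          go₂ true true s _ = inj₁ refl
          go₂ true false true _ = inj₂ refl
        part₁ : 16 * K * # (V a ∩ R x) ≤ # (V a)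
        part₁ = ≤-trans (*-monoˡ-≤ (# (V a ∩ R x)) D-large) (sparseA a x x∈A)
        part₂ : ∀ m → Fin m → (V : Sub N) (B : Fin m → Sub N) →
            (∀ b → 16 * K * m * # (V ∩ B b) ≤ # V) →
          16 * K * # (V ∩ ⋃ B) ≤ # V
        part₂ (suc m) _ V B le = *-cancelˡ-≤ (suc m) (begin
          suc m * (16 * K * # (V ∩ ⋃ B))
            ≡⟨ lem₅ (suc m) (16 * K) (# (V ∩ ⋃ B)) ⟩
          # (V ∩ ⋃ B) * (16 * K * suc m)
            ≤⟨ *-monoˡ-≤ (16 * K * suc m) (#-mono {A = V ∩ ⋃ B} {B = ⋃ (λ b → V ∩ B b)} sub) ⟩
          # (⋃ (λ b → V ∩ B b)) * (16 * K * suc m)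
            ≤⟨ ⋃-size (λ b → V ∩ B b) (λ b → ≤-trans (≤-reflexive
                (*-comm (# (V ∩ B b)) (16 * K * suc m))) (le b)) ⟩
          suc m * # V ∎)
          where
          lem₅ : ∀ m c y → m * (c * y) ≡ y * (c * m)
          lem₅ = solve-∀
          sub : ∀ y → V y ∧ ⋃ B y ≡ true → ⋃ (λ b → V ∩ B b) y ≡ true
          sub y h with does-true (Fin.any? (λ b → B b y Bool.≟ true)) (∧-elimʳ {V y} h)
          ... | b , q = true-does (Fin.any? (λ b → V y ∧ B b y Bool.≟ true))
              (b , ∧-intro (∧-elimˡ h) q)

      V′-sparse : ∀ a b → a Fin.< b → ∀ y → V′ a y ≡ true → D * # (V′ b ∩ R y) ≤ # (V′ b)
      V′-sparse a b lt y h = *-cancelˡ-≤ (16 * K) {{m*n≢0 16 K}} (begin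
        16 * K * (D * # (V′ b ∩ R y))
          ≡⟨ lem (16 * K) D (# (V′ b ∩ R y)) ⟩
        D * (16 * K) * # (V′ b ∩ R y)
          ≤⟨ *-monoʳ-≤ (D * (16 * K)) (#-mono {A = V′ b ∩ R y} {B = (V b ∩ R y) ∩ nb (w b) x} sub) ⟩
        D * (16 * K) * # ((V b ∩ R y) ∩ nb (w b) x)
          ≤⟨ <⇒≤ (≰⇒> not-crowded) ⟩
        # (V b)
          ≤⟨ V′-size b ⟩
        16 * K * # (V′ b) ∎)
        where
        open ≤-Reasoning
        lem : ∀ c d y → c * (d * y) ≡ d * c * y
        lem = solve-∀
        sub : V′ b ∩ R y ⊆ (V b ∩ R y) ∩ nb (w b) x
        sub z q with V b z | nb (w b) x z | R y z
        sub z q | true | true | true = refl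
        sub z q | true | true | false with not (R x z) | not (⋃ (λ b′ → crowded b b′ x) z)
        sub z () | true | true | false | true | true
        sub z () | true | true | false | true | false
        sub z () | true | true | false | false | _
        not-crowded : ¬ # (V b) ≤ D * (16 * K) * # ((V b ∩ R y) ∩ nb (w b) x)
        not-crowded le = ⋃-∉ (λ b → crowded a b x) y
          (∧-elimʳ {not (R x y)} (∧-elimʳ {nb (w a) x y} (∧-elimʳ {V a y} h))) b
          (∧-intro (true-does (a Fin.<? b) lt) (true-does
              (# (V b) ≤? D * (16 * K) * # ((V b ∩ R y) ∩ nb (w b) x)) le))

  -- A step divides sizes by up to `16 * K` but the sparseness only by 64; mere passage to subsets
  -- would lose `16 * K` in sparseness as well.
  complete : ∀ n u D₀ θ → 1 ≤ u → 16 * K ≤ 64 * D₀ → 28 * (K * N) ≤ θ →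
    16 * K * n * (192 * (64 ^ n * D₀ * (K * N))) ≤ θ → (n + n * n) * θ < u * u → ∀ m → m ≤ n →
    (w : Fin m → Fin m → L) (U : Fin m → Sub N) → (∀ b → u * (16 * K) ^ m ≤ # (U b)) →
    (∀ a b → a Fin.< b → ∀ x → U a x ≡ true → 64 ^ m * D₀ * # (U b ∩ R x) ≤ # (U b)) →
    Σ (Fin m → Fin N) λ f → (∀ b → U b (f b) ≡ true) ×
      (∀ a b → a Fin.< b → nb (w a b) (f a) (f b) ≡ true × not (R (f a) (f b)) ≡ true)
  complete n u D₀ θ u≥1 D₀-large θ₁ θ₂ big zero _ w U _ _ = (λ ()) , (λ ()) , λ ()
  complete n u D₀ θ u≥1 D₀-large θ₁ θ₂ big (suc m) m<n w U size sparse = result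
    where
    open ≤-Reasoning
    D : ℕ
    D = 64 ^ m * D₀
    u≤ : ∀ b → u ≤ # (U b)
    u≤ b = ≤-trans (m≤m*n u ((16 * K) ^ suc m) {{m^n≢0 (16 * K) (suc m) {{m*n≢0 16 K}}}}) (size b)
    mono : ∀ a b m n d d′ x → m ≤ n → d ≤ d′ → a * m * (b * (d * x)) ≤ a * n * (b * (d′ * x))
    mono a b m n d d′ x p q = *-mono-≤ (*-monoʳ-≤ a p) (*-monoʳ-≤ b (*-monoˡ-≤ x q))
    assoc : ∀ y → 64 * D * y ≡ 64 ^ suc m * D₀ * y
    assoc y = cong (_* y) (sym (*-assoc 64 (64 ^ m) D₀))
    h₁ : ∀ b x → U zero x ≡ true → 64 * D * # (U (suc b) ∩ R x) ≤ # (U (suc b))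
    h₁ b x p = ≤-trans (≤-reflexive (assoc (# (U (suc b) ∩ R x))))
        (sparse zero (suc b) (s≤s z≤n) x p)
    h₂ : ∀ a b → a Fin.< b → ∀ y → U (suc a) y ≡ true → 64 * D * # (U (suc b) ∩ R y) ≤ # (U (suc b))
    h₂ a b lt y p = ≤-trans (≤-reflexive (assoc (# (U (suc b) ∩ R y))))
        (sparse (suc a) (suc b) (s≤s lt) y p)
    h₃ : 16 * K ≤ 64 * D
    h₃ = ≤-trans D₀-large (*-monoʳ-≤ 64 (m≤n*m D₀ (64 ^ m) {{m^n≢0 64 m}}))
    h₄ : 16 * K * m * (192 * (D * (K * N))) ≤ θ
    h₄ = ≤-trans (mono (16 * K) 192 m n D (64 ^ n * D₀) (K * N) (<⇒≤ m<n)
        (*-monoˡ-≤ D₀ (^-monoʳ-≤ 64 (<⇒≤ m<n)))) θ₂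
    h₅ : (m + m * m) * θ < u * u
    h₅ = ≤-<-trans (*-monoˡ-≤ θ (+-mono-≤ (<⇒≤ m<n) (*-mono-≤ (<⇒≤ m<n) (<⇒≤ m<n)))) big
    module S = Step m D θ (λ b → w zero (suc b)) (U zero) (U ∘ suc) u u≥1 (u≤ zero) (u≤ ∘ suc)
    x : Fin N
    x = S.x h₁ h₂ h₃ θ₁ h₄ h₅
    V′ : Fin m → Sub N
    V′ = S.V′ h₁ h₂ h₃ θ₁ h₄ h₅
    size′ : ∀ b → u * (16 * K) ^ m ≤ # (V′ b)
    size′ b = *-cancelˡ-≤ (16 * K) {{m*n≢0 16 K}} (begin
      16 * K * (u * (16 * K) ^ m)    ≡⟨ lem (16 * K) u ((16 * K) ^ m) ⟩
      u * (16 * K) ^ suc m           ≤⟨ size (suc b) ⟩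
      # (U (suc b))                  ≤⟨ S.V′-size h₁ h₂ h₃ θ₁ h₄ h₅ b ⟩
      16 * K * # (V′ b)              ∎)
      where
      lem : ∀ c u p → c * (u * p) ≡ u * (c * p)
      lem = solve-∀
    rest : Σ (Fin m → Fin N) λ f → (∀ b → V′ b (f b) ≡ true) ×
      (∀ a b → a Fin.< b → nb (w (suc a) (suc b)) (f a) (f b) ≡ true × not (R (f a) (f b)) ≡ true)
    rest = complete n u D₀ θ u≥1 D₀-large θ₁ θ₂ big m (<⇒≤ m<n) (λ a b → w (suc a) (suc b)) V′ size′
      (S.V′-sparse h₁ h₂ h₃ θ₁ h₄ h₅)
    f : Fin m → Fin N
    f = proj₁ rest
    f∈ : ∀ b → V′ b (f b) ≡ true
    f∈ = proj₁ (proj₂ rest)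
    f∈U : ∀ b → U (suc b) (f b) ≡ true
    f∈U b = ∧-elimˡ {U (suc b) (f b)} (f∈ b)
    f∈nb : ∀ b → nb (w zero (suc b)) x (f b) ≡ true
    f∈nb b = ∧-elimˡ {nb (w zero (suc b)) x (f b)} (∧-elimʳ {U (suc b) (f b)} (f∈ b))
    f∉R : ∀ b → not (R x (f b)) ≡ true
    f∉R b = ∧-elimˡ {not (R x (f b))} (∧-elimʳ {nb (w zero (suc b)) x (f b)}
        (∧-elimʳ {U (suc b) (f b)} (f∈ b)))
    result : Σ (Fin (suc m) → Fin N) λ f → (∀ b → U b (f b) ≡ true) ×
      (∀ a b → a Fin.< b → nb (w a b) (f a) (f b) ≡ true × not (R (f a) (f b)) ≡ true)
    result = (λ { zero → x ; (suc b) → f b }) ,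
      (λ { zero → S.x∈A h₁ h₂ h₃ θ₁ h₄ h₅ ; (suc b) → f∈U b }) ,
      λ { zero (suc b) _ → f∈nb b , f∉R b ; (suc a) (suc b) (s≤s lt) → proj₂ (proj₂ rest) a b lt }

-- Bounds on the exponents

n<2^n : ∀ n → n < 2 ^ n
n<2^n zero = s≤s z≤n
n<2^n (suc n) = ≤-trans (+-mono-≤ (m^n>0 2 n) (n<2^n n))
    (≤-reflexive (cong (2 ^ n +_) (sym (+-identityʳ (2 ^ n)))))

ceiling-log : ∀ n → ∃ λ c → suc n ≤ 2 ^ c × 2 ^ c < 2 * suc n
ceiling-log zero = 0 , s≤s z≤n , s≤s (s≤s z≤n)
ceiling-log (suc n) with ceiling-log n
... | c , le , lt with suc (suc n) ≤? 2 ^ c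
...   | yes p = c , p , <-trans lt (*-monoʳ-< 2 (n<1+n (suc n)))
...   | no ¬p = suc c , ≤-trans (s≤s le) (≤-trans (+-monoˡ-≤ (2 ^ c) (m^n>0 2 c))
    (≤-reflexive (cong (2 ^ c +_) (sym (+-identityʳ (2 ^ c)))))) ,
                *-monoʳ-< 2 (≰⇒> ¬p)

-- The recursion of `pairs-suc`: `m` searches for the previous colours and one new digit. The value
-- is the geometric sum of `m ^ i` over `i < k`.
digits : ℕ → ℕ → ℕ
digits m zero = 0
digits m (suc k) = m * digits m k + 1

digits-bound : ∀ m k → digits m (suc k) ≤ suc m ^ k
digits-bound m zero = ≤-reflexive (cong (_+ 1) (*-zeroʳ m))
digits-bound m (suc k) = begin
  m * digits m (suc k) + 1      ≤⟨ +-mono-≤ (*-monoʳ-≤ m (digits-bound m k)) (m^n>0 (suc m) k) ⟩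
  m * suc m ^ k + suc m ^ k     ≡⟨ +-comm (m * suc m ^ k) (suc m ^ k) ⟩
  suc m * suc m ^ k             ∎
  where open ≤-Reasoning

module Bounds (m c : ℕ) (m≥1 : 1 ≤ m) (c≥1 : 1 ≤ c) (c≤m : c ≤ m) (κ : ℕ) where

  n : ℕ
  n = suc m

  -- For i + j = P, pairs sparse in the first i colours are needed with density at
  -- most 2^(- e j), and cost a factor 2^(σ i j) in size.
  e : ℕ → ℕ
  e zero = c + 1 + (6 * n + (3 + κ))
  e (suc j) = c + 1 + n * (1 + e j)

  σ : ℕ → ℕ → ℕ
  σ zero j = 0
  σ (suc k) j = c * (1 + σ k (suc j)) + (c + m * (1 + e j))

  X : ℕ
  X = e 0 + 4

  -- The summand 4 turns the affine recursion into a geometric one; the step reduces to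
  -- `m + 5 ≤ 3 * n`, which holds from `m = 1` on.
  e-bound : ∀ j → e j + 4 ≤ n ^ j * X
  e-bound zero = ≤-reflexive (sym (*-identityˡ X))
  e-bound (suc j) = begin
    c + 1 + n * (1 + e j) + 4       ≤⟨ +-monoˡ-≤ 4 (+-monoˡ-≤ (n * (1 + e j)) (+-monoˡ-≤ 1 c≤m)) ⟩
    m + 1 + n * (1 + e j) + 4       ≡⟨ lem₁ m (e j) ⟩
    2 * 1 + (2 * m + 4 + n * e j)   ≤⟨ +-monoˡ-≤ (2 * m + 4 + n * e j) (*-monoʳ-≤ 2 m≥1) ⟩
    2 * m + (2 * m + 4 + n * e j)   ≡⟨ lem₂ m (e j) ⟩
    n * (e j + 4)                   ≤⟨ *-monoʳ-≤ n (e-bound j) ⟩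
    n * (n ^ j * X)                 ≡⟨ sym (*-assoc n (n ^ j) X) ⟩
    n ^ suc j * X                   ∎
    where
    open ≤-Reasoning
    lem₁ : ∀ m e → m + 1 + (1 + m) * (1 + e) + 4 ≡ 2 * 1 + (2 * m + 4 + (1 + m) * e)
    lem₁ = solve-∀
    lem₂ : ∀ m e → 2 * m + (2 * m + 4 + (1 + m) * e) ≡ (1 + m) * (e + 4)
    lem₂ = solve-∀

  increment : ∀ j → c + (c + m * (1 + e j)) ≤ m * (n ^ j * X)
  increment j = begin
    c + (c + m * (1 + e j))   ≤⟨ +-mono-≤ c≤m (+-monoˡ-≤ _ c≤m) ⟩
    m + (m + m * (1 + e j))   ≤⟨ m≤n+m _ m ⟩
    m + (m + (m + m * (1 + e j))) ≡⟨ lem m (e j) ⟩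
    m * (e j + 4)             ≤⟨ *-monoʳ-≤ m (e-bound j) ⟩
    m * (n ^ j * X)           ∎
    where
    open ≤-Reasoning
    lem : ∀ m e → m + (m + (m + m * (1 + e))) ≡ m * (e + 4)
    lem = solve-∀

  -- Since `m = n - 1`, `increment` is at most `(n ^ suc j - n ^ j) * X`. The extra term on the left
  -- makes these differences telescope.
  σ-bound : ∀ k j → σ (suc k) j + c ^ k * X * n ^ j ≤ c ^ k * X * n ^ (suc k + j)
  σ-bound zero j = begin
    c * 1 + (c + m * (1 + e j)) + 1 * X * n ^ j
      ≡⟨ cong (λ z → z + (c + m * (1 + e j)) + 1 * X * n ^ j) (*-identityʳ c) ⟩
    c + (c + m * (1 + e j)) + 1 * X * n ^ j
      ≤⟨ +-monoˡ-≤ (1 * X * n ^ j) (increment j) ⟩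
    m * (n ^ j * X) + 1 * X * n ^ j
      ≡⟨ lem m (n ^ j) X ⟩
    1 * X * (n * n ^ j) ∎
    where
    open ≤-Reasoning
    lem : ∀ m p X → m * (p * X) + 1 * X * p ≡ 1 * X * ((1 + m) * p)
    lem = solve-∀
  σ-bound (suc k) j = begin
    c * (1 + σ (suc k) (suc j)) + (c + m * (1 + e j)) + c * c ^ k * X * n ^ j
      ≡⟨ lem₁ c (σ (suc k) (suc j)) (m * (1 + e j)) (c * c ^ k * X * n ^ j) ⟩
    c * σ (suc k) (suc j) + (c + (c + m * (1 + e j)) + c * c ^ k * X * n ^ j)
      ≤⟨ +-monoʳ-≤ (c * σ (suc k) (suc j)) (+-monoˡ-≤ (c * c ^ k * X * n ^ j)
           (≤-trans (increment j) (m≤n*m (m * (n ^ j * X)) (c * c ^ k)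
               {{m^n≢0 c (suc k) {{>-nonZero c≥1}}}}))) ⟩
    c * σ (suc k) (suc j) + (c * c ^ k * (m * (n ^ j * X)) + c * c ^ k * X * n ^ j)
      ≡⟨ lem₂ c (σ (suc k) (suc j)) (c ^ k) m (n ^ j) X ⟩
    c * (σ (suc k) (suc j) + c ^ k * X * (n * n ^ j))
      ≤⟨ *-monoʳ-≤ c (σ-bound k (suc j)) ⟩
    c * (c ^ k * X * n ^ (suc k + suc j))
      ≡⟨ cong (λ z → c * (c ^ k * X * n ^ z)) (+-suc (suc k) j) ⟩
    c * (c ^ k * X * n ^ (suc (suc k) + j))
      ≡⟨ lem₃ c (c ^ k) X (n ^ (suc (suc k) + j)) ⟩
    c * c ^ k * X * n ^ (suc (suc k) + j) ∎
    where
    open ≤-Reasoning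
    lem₁ : ∀ c s y w → c * (1 + s) + (c + y) + w ≡ c * s + (c + (c + y) + w)
    lem₁ = solve-∀
    lem₂ : ∀ c s k m p X → c * s + (c * k * (m * (p * X)) + c * k * X * p) ≡ c *
        (s + k * X * ((1 + m) * p))
    lem₂ = solve-∀
    lem₃ : ∀ c k X y → c * (k * X * y) ≡ c * k * X * y
    lem₃ = solve-∀

  s* : ℕ → ℕ
  s* P = c * (1 + σ P 0)

  -- Everything is measured in `Y = n^(2P) c^(P+1)`, where `P = suc p`. The leading term is `s*`:
  -- there `X`, at most `13 c n^P` because it contains `κ`, meets the factor `c^P n^P` from
  -- `σ-bound`.
  budget : ∀ p L → κ ≤ 2 * c * n ^ suc p →
    128 * (n ^ suc p * n ^ suc p * (c * c ^ suc p)) ≤ L →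
    2 * s* (suc p) + 2 * (n * (4 + κ)) + 3 * κ + 3 * c + 6 * n + 17 ≤ L
  budget p L κ≤ L≥ = ≤-trans total L≥
    where
    open ≤-Reasoning
    a C y Y : ℕ
    a = n ^ suc p
    C = c ^ suc p
    y = c * a
    Y = a * a * (c * C)
    instance
      c≢0 : NonZero c
      c≢0 = >-nonZero c≥1
      a≢0 : NonZero a
      a≢0 = m^n≢0 n (suc p)
      C≢0 : NonZero C
      C≢0 = m^n≢0 c (suc p)
      aC≢0 : NonZero (a * C)
      aC≢0 = m*n≢0 a C
    n≤a : n ≤ a
    n≤a = m≤m*n n (n ^ p) {{m^n≢0 n p}}
    n≤y : n ≤ y
    n≤y = ≤-trans n≤a (m≤n*m a c)
    c≤y : c ≤ y
    c≤y = m≤m*n c a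
    2≤y : 2 ≤ y
    2≤y = ≤-trans (s≤s m≥1) n≤y
    y≤Y : y ≤ Y
    y≤Y = ≤-trans (m≤m*n y (a * C)) (≤-reflexive (lem c a C))
      where
      lem : ∀ c a C → c * a * (a * C) ≡ a * a * (c * C)
      lem = solve-∀
    ny≤Y : n * y ≤ Y
    ny≤Y = ≤-trans (*-monoˡ-≤ y n≤a) (≤-trans (m≤m*n (a * y) C) (≤-reflexive (lem c a C)))
      where
      lem : ∀ c a C → a * (c * a) * C ≡ a * a * (c * C)
      lem = solve-∀
    4≤Y : 4 ≤ Y
    4≤Y = ≤-trans (*-mono-≤ (s≤s m≥1) 2≤y) ny≤Y
    κ≤y : κ ≤ 2 * y
    κ≤y = ≤-trans κ≤ (≤-reflexive (*-assoc 2 c a))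
    X≤ : X ≤ 13 * y
    X≤ = begin
      c + 1 + (6 * n + (3 + κ)) + 4    ≡⟨ lem c n κ ⟩
      c + 4 * 2 + 6 * n + κ            ≤⟨ +-mono-≤ (+-mono-≤ (+-mono-≤ c≤y (*-monoʳ-≤ 4 2≤y))
          (*-monoʳ-≤ 6 n≤y)) κ≤y ⟩
      y + 4 * y + 6 * y + 2 * y        ≡⟨ lem₂ y ⟩
      13 * y                           ∎
      where
      lem : ∀ c n κ → c + 1 + (6 * n + (3 + κ)) + 4 ≡ c + 4 * 2 + 6 * n + κ
      lem = solve-∀
      lem₂ : ∀ y → y + 4 * y + 6 * y + 2 * y ≡ 13 * y
      lem₂ = solve-∀
    s*≤ : s* (suc p) ≤ 14 * Y
    s*≤ = begin
      c * (1 + σ (suc p) 0)            ≡⟨ *-distribˡ-+ c 1 (σ (suc p) 0) ⟩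
      c * 1 + c * σ (suc p) 0          ≤⟨ +-mono-≤ (≤-trans (≤-reflexive (*-identityʳ c))
          (≤-trans c≤y y≤Y))
                                            (*-monoʳ-≤ c (≤-trans (m≤m+n _ _) (σ-bound p 0))) ⟩
      Y + c * (c ^ p * X * n ^ (suc p + 0)) ≡⟨ cong (λ z → Y + c * (c ^ p * X * n ^ z))
          (+-identityʳ (suc p)) ⟩
      Y + c * (c ^ p * X * a)          ≤⟨ +-monoʳ-≤ Y (*-monoʳ-≤ c
          (*-monoˡ-≤ a (*-monoʳ-≤ (c ^ p) X≤))) ⟩
      Y + c * (c ^ p * (13 * y) * a)   ≡⟨ lem c (c ^ p) a ⟩
      14 * Y                           ∎
      where
      lem : ∀ c C a → a * a * (c * (c * C)) + c * (C * (13 * (c * a)) * a) ≡ 14 *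
          (a * a * (c * (c * C)))
      lem = solve-∀
    nκ≤ : n * (4 + κ) ≤ 6 * Y
    nκ≤ = begin
      n * (4 + κ)               ≤⟨ *-monoʳ-≤ n (+-monoʳ-≤ 4 κ≤y) ⟩
      n * (4 + 2 * y)           ≡⟨ lem n y ⟩
      4 * n + 2 * (n * y)       ≤⟨ +-mono-≤ (*-monoʳ-≤ 4 (≤-trans n≤y y≤Y)) (*-monoʳ-≤ 2 ny≤Y) ⟩
      4 * Y + 2 * Y             ≡⟨ lem₂ Y ⟩
      6 * Y                     ∎
      where
      lem : ∀ n y → n * (4 + 2 * y) ≡ 4 * n + 2 * (n * y)
      lem = solve-∀
      lem₂ : ∀ y → 4 * y + 2 * y ≡ 6 * y
      lem₂ = solve-∀
    total : 2 * s* (suc p) + 2 * (n * (4 + κ)) + 3 * κ + 3 * c + 6 * n + 17 ≤ 128 * Y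
    total = begin
      2 * s* (suc p) + 2 * (n * (4 + κ)) + 3 * κ + 3 * c + 6 * n + 17
        ≤⟨ +-mono-≤ (+-mono-≤ (+-mono-≤ (+-mono-≤ (+-mono-≤ (*-monoʳ-≤ 2 s*≤) (*-monoʳ-≤ 2 nκ≤))
             (*-monoʳ-≤ 3 (≤-trans κ≤y (*-monoʳ-≤ 2 y≤Y)))) (*-monoʳ-≤ 3 (≤-trans c≤y y≤Y)))
             (*-monoʳ-≤ 6 (≤-trans n≤y y≤Y))) (≤-trans (m≤m+n 17 3) (*-monoʳ-≤ 5 4≤Y)) ⟩
      2 * (14 * Y) + 2 * (6 * Y) + 3 * (2 * Y) + 3 * Y + 6 * Y + 5 * Y
        ≡⟨ lem Y ⟩
      60 * Y
        ≤⟨ *-monoˡ-≤ Y (m≤m+n 60 68) ⟩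
      128 * Y ∎
      where
      lem : ∀ Y → 2 * (14 * Y) + 2 * (6 * Y) + 3 * (2 * Y) + 3 * Y + 6 * Y + 5 * Y ≡ 60 * Y
      lem = solve-∀

-- The recursion over the colours

pow-pow : ∀ a b → (2 * 2 ^ a) ^ b ≡ 2 ^ (b * (1 + a))
pow-pow a b = trans (^-*-assoc 2 (suc a) b) (cong (2 ^_) (*-comm (suc a) b))

*-≤-2^ : ∀ {x y} a b → x ≤ 2 ^ a → y ≤ 2 ^ b → x * y ≤ 2 ^ (a + b)
*-≤-2^ a b p q = ≤-trans (*-mono-≤ p q) (≤-reflexive (sym (^-distribˡ-+-* 2 a b)))

-- `2 ^ u` is what remains of `2 ^ L` vertices after the families (`a`) and the last embedding
-- (`b`). The number of vertices enters `θ` linearly while `Step` compares `θ` with the square of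
-- `2 ^ u`; this is why `a` and `b` appear doubled in the assumption.
spare-exponent : ∀ a b κ c d L → 2 * a + 2 * b + 3 * κ + 3 * c + d + 17 ≤ L →
  ∃ λ u → a + b + u ≡ L × 2 + (c + c) + (4 + κ + c + (8 + (d + (3 + κ) + (κ + L)))) ≤ u + u
spare-exponent a b κ c d L enough = proj₁ split , proj₂ split , +-cancelˡ-≤ (2 * a + 2 * b) _ _
    (begin
    2 * a + 2 * b + (2 + (c + c) + (4 + κ + c + (8 + (d + (3 + κ) + (κ + L)))))
      ≡⟨ lem₁ a b κ c d L ⟩
    2 * a + 2 * b + 3 * κ + 3 * c + d + 17 + L
      ≤⟨ +-monoˡ-≤ L enough ⟩
    L + L
      ≡⟨ cong₂ _+_ (sym (proj₂ split)) (sym (proj₂ split)) ⟩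
    a + b + u + (a + b + u)
      ≡⟨ lem₂ a b u ⟩
    2 * a + 2 * b + (u + u) ∎)
  where
  open ≤-Reasoning
  lem : ∀ a b c d e → a + b + (a + b + c + d + e + 17) ≡ 2 * a + 2 * b + c + d + e + 17
  lem = solve-∀
  lem₁ : ∀ a b κ c d L → 2 * a + 2 * b + (2 + (c + c) +
      (4 + κ + c + (8 + (d + (3 + κ) + (κ + L))))) ≡ 2 * a + 2 * b + 3 * κ + 3 * c + d + 17 + L
  lem₁ = solve-∀
  lem₂ : ∀ a b u → a + b + u + (a + b + u) ≡ 2 * a + 2 * b + (u + u)
  lem₂ = solve-∀
  split : ∃ λ u → a + b + u ≡ L
  split = m≤n⇒∃[o]m+o≡n (≤-trans (m≤m+n (a + b) (a + b + 3 * κ + 3 * c + d + 17))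
    (≤-trans (≤-reflexive (lem a b (3 * κ) (3 * c) d)) enough))
  u : ℕ
  u = proj₁ split

16x≤64[8x] : ∀ x → 16 * x ≤ 64 * (8 * x)
16x≤64[8x] x = ≤-trans (*-monoʳ-≤ 16 (m≤n*m x 8)) (*-monoˡ-≤ (8 * x) (m≤m+n 16 48))

module Host (m c p L : ℕ) (m≥1 : 1 ≤ m) (c≥1 : 1 ≤ c) (c≤m : c ≤ m) (n≤2^c : suc m ≤ 2 ^ c) where

  -- `β` is at least `n * n`, so one digit can hold the rank of an edge. `Δ` counts `m` searches for
  -- the first `P` colours and one digit for the last colour, and `β ^ Δ = 2 ^ κ`.
  P Δ κ N β k : ℕ
  P = suc p
  Δ = digits m (suc P)
  κ = 2 * c * Δ
  N = 2 ^ L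
  β = 2 ^ (2 * c)
  k = pred (2 ^ κ)

  open Bounds m c m≥1 c≥1 c≤m κ

  instance
    β≢0 : NonZero β
    β≢0 = m^n≢0 2 (2 * c)

  K≡ : suc k ≡ 2 ^ κ
  K≡ = suc-pred (2 ^ κ) {{m^n≢0 2 κ}}

  Δ≥1 : 1 ≤ Δ
  Δ≥1 = m≤n+m 1 (m * digits m P)

  κ≥1 : 1 ≤ κ
  κ≥1 = ≤-trans c≥1 (≤-trans (m≤n*m c 2) (m≤m*n (2 * c) Δ {{>-nonZero Δ≥1}}))

  module _ (enough : 2 * s* P + 2 * (n * (4 + κ)) + 3 * κ + 3 * c + 6 * n + 17 ≤ L) where

    κ+3≤N : κ + 3 ≤ N
    κ+3≤N = ≤-trans (≤-trans (≤-trans (+-monoʳ-≤ κ (m≤m+n 3 14))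
        (≤-trans (m≤m+n _ (2 * s* P + 2 * (n * (4 + κ)) + 2 * κ + 3 * c + 6 * n))
        (≤-reflexive (lem κ (2 * s* P) (2 * (n * (4 + κ))) (3 * c) (6 * n))))) enough)
      (<⇒≤ (n<2^n L))
      where
      lem : ∀ κ a b c d → κ + 17 + (a + b + 2 * κ + c + d) ≡ a + b + 3 * κ + c + d + 17
      lem = solve-∀

    lab : Fin N → Fin N → Fin (suc k)
    lab = randomLabel N k κ K≡ κ≥1 κ+3≤N

    lab-sym : ∀ x y → lab x y ≡ lab y x
    lab-sym = randomLabel-sym N k κ K≡ κ≥1 κ+3≤N

    module _ (col : Fin N → Fin N → ℕ) (col-sym : ∀ x y → x ≢ y → col x y ≡ col y x)
             (col≤P : ∀ x y → col x y ≤ P) where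

      open Regions {N} β (λ x y → toℕ (lab x y)) (λ x y → cong toℕ (lab-sym x y)) col col-sym public

      weaken : ∀ k D D′ S S′ z → D′ ≤ D → S ≤ S′ → HasPairs k D S z → HasPairs k D′ S′ z
      weaken k D D′ S S′ z D≤ S≤ pairs r V A pos =
        let v , ref , B , C , B⊆ , C⊆ , sB , sC , sp = pairs r V A pos
        in v , ref , B , C , B⊆ , C⊆ , ≤-trans sB (*-monoˡ-≤ (# B) S≤) , ≤-trans sC
                (*-monoˡ-≤ (# C) S≤) ,
           λ x h → ≤-trans (*-monoˡ-≤ (# (C ∩ low r v k x)) D≤) (sp x h)

      module _ (g : ℕ → Fin n → Fin n → Fin β) (none : ∀ i → i ≤ P → ¬ Monochromatic i (g i)) where

        open ≤-Reasoning

        pairsAt : ∀ i j → i + j ≡ P → HasPairs i (2 ^ e j) (2 ^ σ i j) (digits m i)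
        pairsAt zero j eq = pairs-0 (2 ^ e j)
        pairsAt (suc i) j eq = weaken (suc i) (2 ^ e j) (2 ^ e j)
            ((2 * 2 ^ σ i (suc j)) ^ c * (n * (2 * 2 ^ e j) ^ m)) (2 ^ σ (suc i) j)
            (digits m (suc i)) ≤-refl S≤
          (pairs-suc i m (2 ^ e j) ((2 * 2 ^ σ i (suc j)) ^ c) (digits m i) (g i) {{m^n≢0 2 (e j)}}
            (none i (≤-trans (≤-trans (n≤1+n i) (m≤m+n (suc i) j)) (≤-reflexive eq)))
            (families i n ((2 * 2 ^ e j) ^ n) (2 ^ σ i (suc j)) (digits m i) {{_}}
                {{m^n≢0 2 (σ i (suc j))}}
              (weaken i (2 ^ e (suc j)) (2 * (n * (2 * 2 ^ e j) ^ n)) (2 ^ σ i (suc j))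
                  (2 ^ σ i (suc j)) (digits m i) D≤ ≤-refl
                  (pairsAt i (suc j) (trans (+-suc i j) eq))) c m n≤2^c ≤-refl))
          where
          -- `2 * n` is the loss in `families`; the `n`-th power is the density that `pairs-suc`
          -- asks of the earlier colours. This power is what multiplies the exponent by `n`.
          D≤ : 2 * (n * (2 * 2 ^ e j) ^ n) ≤ 2 ^ e (suc j)
          D≤ = begin
            2 * (n * (2 * 2 ^ e j) ^ n)      ≡⟨ cong (λ z → 2 * (n * z)) (pow-pow (e j) n) ⟩
            2 * (n * 2 ^ (n * (1 + e j)))    ≤⟨ *-monoʳ-≤ 2
                (*-monoˡ-≤ (2 ^ (n * (1 + e j))) n≤2^c) ⟩
            2 * (2 ^ c * 2 ^ (n * (1 + e j))) ≡⟨ cong (2 *_)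
                (sym (^-distribˡ-+-* 2 c (n * (1 + e j)))) ⟩
            2 ^ suc (c + n * (1 + e j))      ≡⟨ cong (2 ^_) (lem c (n * (1 + e j))) ⟩
            2 ^ (c + 1 + n * (1 + e j))      ∎
            where
            lem : ∀ c y → suc (c + y) ≡ c + 1 + y
            lem = solve-∀
          S≤ : (2 * 2 ^ σ i (suc j)) ^ c * (n * (2 * 2 ^ e j) ^ m) ≤ 2 ^ σ (suc i) j
          S≤ = begin
            (2 * 2 ^ σ i (suc j)) ^ c * (n * (2 * 2 ^ e j) ^ m)
              ≡⟨ cong₂ (λ y z → y * (n * z)) (pow-pow (σ i (suc j)) c) (pow-pow (e j) m) ⟩
            2 ^ (c * (1 + σ i (suc j))) * (n * 2 ^ (m * (1 + e j)))
              ≤⟨ *-monoʳ-≤ (2 ^ (c * (1 + σ i (suc j)))) (*-monoˡ-≤ (2 ^ (m * (1 + e j))) n≤2^c) ⟩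
            2 ^ (c * (1 + σ i (suc j))) * (2 ^ c * 2 ^ (m * (1 + e j)))
              ≡⟨ cong (2 ^ (c * (1 + σ i (suc j))) *_) (sym (^-distribˡ-+-* 2 c (m * (1 + e j)))) ⟩
            2 ^ (c * (1 + σ i (suc j))) * 2 ^ (c + m * (1 + e j))
              ≡⟨ sym (^-distribˡ-+-* 2 (c * (1 + σ i (suc j))) (c + m * (1 + e j))) ⟩
            2 ^ σ (suc i) j ∎

        K : ℕ
        K = suc k

        lastFamilies : HasFamilies P (64 ^ n * (8 * K)) ((2 * 2 ^ σ P 0) ^ c) (digits m P) m
        lastFamilies = families P n (64 ^ n * (8 * K)) (2 ^ σ P 0) (digits m P) {{_}}
            {{m^n≢0 2 (σ P 0)}}
          (weaken P (2 ^ e 0) (2 * (n * (64 ^ n * (8 * K)))) (2 ^ σ P 0) (2 ^ σ P 0) (digits m P)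
              D≤ ≤-refl (pairsAt P 0 (+-identityʳ P))) c m n≤2^c ≤-refl
          where
          -- `64 ^ n` feeds the `n` steps of `complete`, and `8 * K` keeps the exceptional degree of
          -- a chosen vertex below its label degree.
          D≤ : 2 * (n * (64 ^ n * (8 * K))) ≤ 2 ^ e 0
          D≤ = begin
            2 * (n * (64 ^ n * (8 * K)))
              ≤⟨ *-monoʳ-≤ 2 (*-monoˡ-≤ (64 ^ n * (8 * K)) n≤2^c) ⟩
            2 * (2 ^ c * (64 ^ n * (8 * K)))
              ≡⟨ cong₂ (λ y z → 2 * (2 ^ c * (y * (8 * z)))) (^-*-assoc 2 6 n) K≡ ⟩
            2 * (2 ^ c * (2 ^ (6 * n) * (8 * 2 ^ κ)))
              ≡⟨ cong (λ z → 2 * (2 ^ c * (2 ^ (6 * n) * z))) (sym (^-distribˡ-+-* 2 3 κ)) ⟩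
            2 * (2 ^ c * (2 ^ (6 * n) * 2 ^ (3 + κ)))
              ≡⟨ cong (λ z → 2 * (2 ^ c * z)) (sym (^-distribˡ-+-* 2 (6 * n) (3 + κ))) ⟩
            2 * (2 ^ c * 2 ^ (6 * n + (3 + κ)))
              ≡⟨ cong (2 *_) (sym (^-distribˡ-+-* 2 c (6 * n + (3 + κ)))) ⟩
            2 ^ suc (c + (6 * n + (3 + κ)))
              ≡⟨ cong (2 ^_) (lem c (6 * n + (3 + κ))) ⟩
            2 ^ (c + 1 + (6 * n + (3 + κ))) ∎
            where
            lem : ∀ c y → suc (c + y) ≡ c + 1 + y
            lem = solve-∀

        τ : ℕ
        -- The summands are the logarithms of the factors in `θ₂`: `16 * K * n`, then `192` rounded
        -- up to `2 ^ 8`, then `64 ^ n * (8 * K)` and `K * N`.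
        τ = 4 + κ + c + (8 + (6 * n + (3 + κ) + (κ + L)))

        spare : ∃ λ ũ → s* P + n * (4 + κ) + ũ ≡ L × 2 + (c + c) + τ ≤ ũ + ũ
        spare = spare-exponent (s* P) (n * (4 + κ)) κ c (6 * n) L enough

        K≤ : K ≤ 2 ^ κ
        K≤ = ≤-reflexive K≡

        θ₁ : 28 * (K * N) ≤ 2 ^ τ
        θ₁ = ≤-trans (*-≤-2^ 5 (κ + L) (m≤m+n 28 4) (*-≤-2^ κ L K≤ ≤-refl))
          (^-monoʳ-≤ 2 (≤-trans (m≤m+n (5 + (κ + L)) (κ + c + (6 * n + κ) + 10))
              (≤-reflexive (lem κ L c (6 * n)))))
          where
          lem : ∀ κ L c d → 5 + (κ + L) + (κ + c + (d + κ) + 10) ≡ 4 + κ + c +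
              (8 + (d + (3 + κ) + (κ + L)))
          lem = solve-∀

        θ₂ : 16 * K * n * (192 * (64 ^ n * (8 * K) * (K * N))) ≤ 2 ^ τ
        θ₂ = *-≤-2^ (4 + κ + c) (8 + (6 * n + (3 + κ) + (κ + L)))
            (*-≤-2^ (4 + κ) c (*-≤-2^ 4 κ ≤-refl K≤) n≤2^c)
          (*-≤-2^ 8 (6 * n + (3 + κ) + (κ + L)) (m≤m+n 192 64)
            (*-≤-2^ (6 * n + (3 + κ)) (κ + L)
              (*-≤-2^ (6 * n) (3 + κ) (≤-reflexive (^-*-assoc 2 6 n)) (*-≤-2^ 3 κ ≤-refl K≤))
              (*-≤-2^ κ L K≤ ≤-refl)))

        big : ∀ ũ → 2 + (c + c) + τ ≤ ũ + ũ → (n + n * n) * 2 ^ τ < 2 ^ ũ * 2 ^ ũ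
        big ũ le = begin-strict
          (n + n * n) * 2 ^ τ               ≤⟨ *-monoˡ-≤ (2 ^ τ) (begin
              n + n * n                     ≤⟨ +-monoˡ-≤ (n * n) (m≤m*n n n) ⟩
              n * n + n * n                 ≡⟨ cong (n * n +_) (sym (+-identityʳ (n * n))) ⟩
              2 * (n * n)                   ≤⟨ *-monoʳ-≤ 2 (*-mono-≤ n≤2^c n≤2^c) ⟩
              2 * (2 ^ c * 2 ^ c)           ≡⟨ cong (2 *_) (sym (^-distribˡ-+-* 2 c c)) ⟩
              2 ^ (1 + (c + c))             ∎) ⟩
          2 ^ (1 + (c + c)) * 2 ^ τ         ≡⟨ sym (^-distribˡ-+-* 2 (1 + (c + c)) τ) ⟩
          2 ^ (1 + (c + c) + τ)             <⟨ ^-monoʳ-< 2 (s≤s (s≤s z≤n))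
              (n<1+n (1 + (c + c) + τ)) ⟩
          2 ^ (2 + (c + c) + τ)             ≤⟨ ^-monoʳ-≤ 2 le ⟩
          2 ^ (ũ + ũ)                       ≡⟨ ^-distribˡ-+-* 2 ũ ũ ⟩
          2 ^ ũ * 2 ^ ũ                     ∎

        size : ∀ ũ y → s* P + n * (4 + κ) + ũ ≡ L → N ≤ (2 * 2 ^ σ P 0) ^ c * y →
            2 ^ ũ * (16 * K) ^ n ≤ y
        size ũ y eq le = *-cancelˡ-≤ (2 ^ s* P) {{m^n≢0 2 (s* P)}} (begin
          2 ^ s* P * (2 ^ ũ * (16 * K) ^ n)
            ≤⟨ *-monoʳ-≤ (2 ^ s* P) (*-monoʳ-≤ (2 ^ ũ) (^-monoˡ-≤ n (*-≤-2^ 4 κ ≤-refl K≤))) ⟩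
          2 ^ s* P * (2 ^ ũ * (2 ^ (4 + κ)) ^ n)
            ≡⟨ cong (λ z → 2 ^ s* P * (2 ^ ũ * z)) (trans (^-*-assoc 2 (4 + κ) n)
                (cong (2 ^_) (*-comm (4 + κ) n))) ⟩
          2 ^ s* P * (2 ^ ũ * 2 ^ (n * (4 + κ)))
            ≡⟨ lem (2 ^ s* P) (2 ^ ũ) (2 ^ (n * (4 + κ))) ⟩
          2 ^ s* P * 2 ^ (n * (4 + κ)) * 2 ^ ũ
            ≡⟨ trans (cong (_* 2 ^ ũ) (sym (^-distribˡ-+-* 2 (s* P) (n * (4 + κ)))))
                (sym (^-distribˡ-+-* 2 (s* P + n * (4 + κ)) ũ)) ⟩
          2 ^ (s* P + n * (4 + κ) + ũ)
            ≡⟨ cong (2 ^_) eq ⟩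
          2 ^ L
            ≤⟨ le ⟩
          (2 * 2 ^ σ P 0) ^ c * y
            ≡⟨ cong (_* y) (pow-pow (σ P 0) c) ⟩
          2 ^ s* P * y ∎)
          where
          lem : ∀ x y z → x * (y * z) ≡ x * z * y
          lem = solve-∀

        -- A label `v * β + toℕ (g P a b)` lies in the region `(1 , v)`. An edge with this label
        -- that avoids `low 1 v P` has no colour below `P`, hence has colour `P`.
        last-colour : ∀ v → suc v * β ^ 1 ≤ 1 * β ^ Δ → (U : Fin n → Sub N) →
          (∀ b → N ≤ (2 * 2 ^ σ P 0) ^ c * # (U b)) →
          (∀ a b → a Fin.< b → SparseTo (64 ^ n * (8 * K)) 1 v P (U a) (U b)) →
              Monochromatic P (g P)
        last-colour v bounded U sizes sparse = 0 , v , f , exactly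
          where
          label< : ∀ a b → v * β + toℕ (g P a b) < K
          label< a b = begin-strict
            v * β + toℕ (g P a b)     <⟨ +-monoʳ-< (v * β) (Fin.toℕ<n (g P a b)) ⟩
            v * β + β                 ≡⟨ +-comm (v * β) β ⟩
            suc v * β                 ≡⟨ cong (suc v *_) (sym (*-identityʳ β)) ⟩
            suc v * β ^ 1             ≤⟨ bounded ⟩
            1 * β ^ Δ                 ≡⟨ *-identityˡ (β ^ Δ) ⟩
            β ^ Δ                     ≡⟨ ^-*-assoc 2 (2 * c) Δ ⟩
            2 ^ κ                     ≡⟨ sym K≡ ⟩
            K                         ∎
          w : Fin n → Fin n → Fin K
          w a b = fromℕ< (label< a b)
          embedded : Σ (Fin n → Fin N) λ f → (∀ b → U b (f b) ≡ true) ×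
            (∀ a b → a Fin.< b → nbhd lab (w a b) (f a) (f b) ≡ true × not (low 1 v P (f a) (f b))
                ≡ true)
          embedded = complete (nbhd lab) (edges-upper N k κ K≡ κ≥1 κ+3≤N)
              (edges-lower N k κ K≡ κ≥1 κ+3≤N) (low 1 v P)
            n (2 ^ proj₁ spare) (8 * K) (2 ^ τ) (m^n>0 2 (proj₁ spare))
            (16x≤64[8x] K)
            θ₁ θ₂ (big (proj₁ spare) (proj₂ (proj₂ spare))) n ≤-refl w U
            (λ b → size (proj₁ spare) (# (U b)) (proj₁ (proj₂ spare)) (sizes b)) sparse
          f : Fin n → Fin N
          f = proj₁ embedded
          exactly : ∀ a b → a Fin.< b → exact 0 (v * β + toℕ (g P a b)) P (f a) (f b) ≡ true
          exactly a b lt = ∧-intro distinct (∧-intro (true-does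
              (toℕ (lab (f a) (f b)) ≟ v * β + toℕ (g P a b)) lab≡)
                (true-does (col (f a) (f b) ≟ P) (≤-antisym (col≤P (f a) (f b)) (≮⇒≥ notless))))
            where
            near : nbhd lab (w a b) (f a) (f b) ≡ true
            near = proj₁ (proj₂ (proj₂ embedded) a b lt)
            notlow : not (low 1 v P (f a) (f b)) ≡ true
            notlow = proj₂ (proj₂ (proj₂ embedded) a b lt)
            distinct : not (does (f a Fin.≟ f b)) ≡ true
            distinct = ∧-elimˡ near
            lab≡ : toℕ (lab (f a) (f b)) ≡ v * β + toℕ (g P a b)
            lab≡ = trans (cong toℕ (does-true (lab (f a) (f b) Fin.≟ w a b)
                (∧-elimʳ {not (does (f a Fin.≟ f b))} near)))
              (Fin.toℕ-fromℕ< (label< a b))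
            region : Q 1 (toℕ (lab (f a) (f b))) ≡ v
            region = Refines.extends (refines-digit 0 v (toℕ (g P a b)) (Fin.toℕ<n (g P a b))) _
                lab≡
            notless : ¬ col (f a) (f b) < P
            notless lt = contra (low 1 v P (f a) (f b)) (∧-intro distinct
              (∧-intro (true-does (Q 1 (toℕ (lab (f a) (f b))) ≟ v) region)
                  (true-does (col (f a) (f b) <? P) lt))) notlow
              where
              contra : ∀ b → b ≡ true → not b ≡ true → ⊥
              contra true _ ()

        impossible : ⊥
        -- The search starts with all `Δ` digits free; the argument 1 reserves the least significant
        -- one for the last colour.
        impossible = contradict (lastFamilies 1 0 (λ _ → true)
            (≤-trans (m^n>0 2 L) (≤-reflexive (sym (#-full {N})))))
          where
          contradict : (∃ λ v → Refines 1 v Δ 0 × Σ (List (Sub N)) λ Us → length Us ≡ n ×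
              All (λ U → U ⊆ (λ _ → true) × # {N} (λ _ → true) ≤ (2 * 2 ^ σ P 0) ^ c * # U) Us ×
              AllPairs (SparseTo (64 ^ n * (8 * K)) 1 v P) Us) → ⊥
          contradict (v , ref , Us , len , allU , apU) =
            let U , inU , sparseU = family len allU apU
            in none P ≤-refl (last-colour v (Refines.bounded ref) U
                 (λ b → ≤-trans (≤-reflexive (sym (#-full {N}))) (proj₂ (inU b))) sparseU)

-- The edge-ordered host graph

-- Labels of `H` are arbitrary numbers; ranks keep their order on edges and are small enough to
-- serve as digits.
rank : ∀ {n} → EOGraph n → Fin n → Fin n → ℕ
rank H x y = sum λ a → sum λ b → ⟦ adj H a b ∧ does (label H a b <? label H x y) ⟧

rank<n² : ∀ {m} (H : EOGraph (suc m)) x y → rank H x y < suc m * suc m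
rank<n² {m} H x y = ≤-trans
  (sum-mono-< {f = λ a → sum (λ b → ⟦ B a b ⟧)} {g = λ a → sum {suc m} (λ b → 1)}
      (λ a → sum-mono (λ b → ⟦⟧≤1 (B a b))) zero
    (sum-mono-< {f = λ b → ⟦ B zero b ⟧} {g = λ b → 1} (λ b → ⟦⟧≤1 (B zero b)) zero diag))
  (≤-reflexive (trans (sum-const (suc m) (sum {suc m} (λ _ → 1)))
      (cong (suc m *_) (trans (sum-const (suc m) 1) (*-identityʳ (suc m))))))
  where
  B : Fin (suc m) → Fin (suc m) → Bool
  B a b = adj H a b ∧ does (label H a b <? label H x y)
  diag : ⟦ B zero zero ⟧ < 1
  diag rewrite adj-irr H zero = s≤s z≤n

rank-mono : ∀ {n} (H : EOGraph n) x y z w → Edge H x y → label H x y < label H z w →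
    rank H x y < rank H z w
rank-mono H x y z w edge lt =
  sum-mono-< (λ a → sum-mono (λ b → ⟦⟧-mono (weaker a b))) x
      (sum-mono-< (λ b → ⟦⟧-mono (weaker x b)) y strict)
  where
  weaker : ∀ a b → adj H a b ∧ does (label H a b <? label H x y) ≡ true →
    adj H a b ∧ does (label H a b <? label H z w) ≡ true
  weaker a b h = ∧-intro (∧-elimˡ h) (true-does (label H a b <? label H z w)
    (<-trans (does-true (label H a b <? label H x y) (∧-elimʳ {adj H a b} h)) lt))
  strict : ⟦ adj H x y ∧ does (label H x y <? label H x y) ⟧ < ⟦ adj H x y ∧ does
      (label H x y <? label H z w) ⟧
  strict rewrite edge | dec-false (label H x y <? label H x y) (n≮n (label H x y)) | dec-true
      (label H x y <? label H z w) lt = s≤s z≤n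

rank-sym : ∀ {n} (H : EOGraph n) x y → rank H x y ≡ rank H y x
rank-sym H x y rewrite label-sym H x y = refl

module _ {N K : ℕ} (lab : Fin N → Fin N → Fin K) (lab-sym : ∀ x y → lab x y ≡ lab y x) where

  ends : Fin N → Fin N → Fin (N * N)
  ends x y = if does (x Fin.≤? y) then combine x y else combine y x

  ends-sym : ∀ x y → ends x y ≡ ends y x
  ends-sym x y with Fin.<-cmp x y
  ... | tri< lt _ gt rewrite dec-true (x Fin.≤? y) (<⇒≤ lt) | dec-false (y Fin.≤? x) (<⇒≱ lt) = refl
  ... | tri≈ _ refl _ = refl
  ... | tri> lt _ gt rewrite dec-true (y Fin.≤? x) (<⇒≤ gt) | dec-false (x Fin.≤? y) (<⇒≱ gt) = refl

  ends-cases : ∀ x y → ends x y ≡ combine x y ⊎ ends x y ≡ combine y x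
  ends-cases x y with does (x Fin.≤? y)
  ... | true = inj₁ refl
  ... | false = inj₂ refl

  ends-inj : ∀ a b c d → ends a b ≡ ends c d → (a ≡ c × b ≡ d) ⊎ (a ≡ d × b ≡ c)
  ends-inj a b c d eq with ends-cases a b | ends-cases c d
  ... | inj₁ p | inj₁ q = inj₁ (Fin.combine-injective a b c d (trans (sym p) (trans eq q)))
  ... | inj₁ p | inj₂ q = inj₂ (Fin.combine-injective a b d c (trans (sym p) (trans eq q)))
  ... | inj₂ p | inj₁ q = let r , s = Fin.combine-injective b a c d (trans (sym p) (trans eq q))
      in inj₂ (s , r)
  ... | inj₂ p | inj₂ q = let r , s = Fin.combine-injective b a d c (trans (sym p) (trans eq q))
      in inj₁ (s , r)

  -- The complete graph ordered by lab; ties are broken by the pair of endpoints.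
  completeGraph : EOGraph N
  completeGraph = record
    { adj = λ x y → not (does (x Fin.≟ y))
    ; label = λ x y → toℕ (combine (lab x y) (ends x y))
    ; adj-sym = adj-symmetric
    ; adj-irr = λ x → cong not (dec-true (x Fin.≟ x) refl)
    ; label-sym = λ x y → cong₂ (λ i j → toℕ (combine i j)) (lab-sym x y) (ends-sym x y)
    ; label-inj = λ a b c d _ _ eq → ends-inj a b c d
        (Fin.combine-injectiveʳ (lab a b) (ends a b) (lab c d) (ends c d) (Fin.toℕ-injective eq))
    }
    where
    adj-symmetric : ∀ x y → not (does (x Fin.≟ y)) ≡ not (does (y Fin.≟ x))
    adj-symmetric x y with x Fin.≟ y | y Fin.≟ x
    ... | yes _ | yes _ = refl
    ... | yes refl | no ne = ⊥-elim (ne refl)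
    ... | no ne | yes refl = ⊥-elim (ne refl)
    ... | no _ | no _ = refl

  -- Copies of patterns and the search for a universal colour

  module _ {n q β : ℕ} (c : Colouring completeGraph q) where

    -- `order` is about `lab` and strict, so it decides the order in the host before any tie is
    -- broken.
    record Copy (i : Fin q) (g : Fin n → Fin n → Fin β) (f : Fin n → Fin N) : Set where
      constructor copy
      field
        edge : ∀ a b → a Fin.< b → f a ≢ f b × proj₁ c (f a) (f b) ≡ i
        order : ∀ a b a′ b′ → a Fin.< b → a′ Fin.< b′ → g a b Fin.< g a′ b′ →
            lab (f a) (f b) Fin.< lab (f a′) (f b′)

    copy? : ∀ i g f → Dec (Copy i g f)
    copy? i g f with Fin.all? (λ a → Fin.all? (λ b → (a Fin.<? b) →-dec
        (¬? (f a Fin.≟ f b) ×-dec (proj₁ c (f a) (f b) Fin.≟ i))))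
      | Fin.all? (λ a → Fin.all? (λ b → Fin.all? (λ a′ → Fin.all? (λ b′ →
          (a Fin.<? b) →-dec ((a′ Fin.<? b′) →-dec ((g a b Fin.<? g a′ b′) →-dec
              (lab (f a) (f b) Fin.<? lab (f a′) (f b′))))))))
    ... | yes p | yes r = yes (copy p r)
    ... | no ¬p | _ = no λ k → ¬p (Copy.edge k)
    ... | _ | no ¬r = no λ k → ¬r (Copy.order k)

    decodeF : Fin (N ^ n) → Fin n → Fin N
    decodeF = finToFun

    decodeG : Fin ((β ^ n) ^ n) → Fin n → Fin n → Fin β
    decodeG j a b = finToFun (finToFun {m = β ^ n} j a) b

    encodeG : (Fin n → Fin n → Fin β) → Fin ((β ^ n) ^ n)
    encodeG g = funToFin (λ a → funToFin (g a))

    decode-encodeG : ∀ g a b → decodeG (encodeG g) a b ≡ g a b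
    decode-encodeG g a b = trans (cong (λ j → finToFun j b)
        (Fin.finToFun-funToFin (λ a → funToFin (g a)) a))
      (Fin.finToFun-funToFin (g a) b)

    Copy-f : ∀ {i g f f′} → (∀ a → f a ≡ f′ a) → Copy i g f → Copy i g f′
    Copy-f {i} {g} {f} {f′} eq (copy e o) = copy
      (λ a b lt → subst₂ (λ x y → x ≢ y × proj₁ c x y ≡ i) (eq a) (eq b) (e a b lt))
      (λ a b a′ b′ l₁ l₂ l₃ → subst₂ Fin._<_ (cong₂ lab (eq a) (eq b)) (cong₂ lab (eq a′) (eq b′))
          (o a b a′ b′ l₁ l₂ l₃))

    Copy-g : ∀ {i g g′ f} → (∀ a b → g a b ≡ g′ a b) → Copy i g f → Copy i g′ f
    Copy-g eq (copy e o) = copy e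
      (λ a b a′ b′ l₁ l₂ l₃ → o a b a′ b′ l₁ l₂ (subst₂ Fin._<_ (sym (eq a b)) (sym (eq a′ b′)) l₃))

    copies? : ∀ i j → Dec (∃ λ h → Copy i (decodeG j) (decodeF h))
    copies? i j = Fin.any? (λ h → copy? i (decodeG j) (decodeF h))

    -- Patterns and placements are finite in number, so a search through their codes decides the
    -- alternative constructively.
    universal-or-bad : (∃ λ i → ∀ g → ∃ (Copy i g)) ⊎ (∀ i → ∃ λ g → ∀ f → ¬ Copy i g f)
    universal-or-bad with Fin.any? (λ i → Fin.all? (copies? i))
    ... | yes (i , all) = inj₁ (i , λ g → let h , k = all (encodeG g) in decodeF h , Copy-g
        (decode-encodeG g) k)
    ... | no none = inj₂ λ i →
      let j , ¬k = Fin.¬∀⟶∃¬ _ _ (copies? i) (λ all → none (i , all))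
      in decodeG j , λ f k → ¬k (funToFin f , Copy-f (λ a → sym (Fin.finToFun-funToFin f a)) k)

    contains : ∀ {i} (H : EOGraph n) (g : Fin n → Fin n → Fin β) → (∀ x y → g x y ≡ g y x) →
      (∀ x y z w → Edge H x y → label H x y < label H z w → g x y Fin.< g z w) →
      ∀ f → Copy i g f → Contains (colourClass completeGraph c i) H
    contains {i} H g g-sym g-mono f (copy e o) = f , injective , kept , ordered
      where
      injective : Injective _≡_ _≡_ f
      injective {x} {y} eq with Fin.<-cmp x y
      ... | tri< lt _ _ = ⊥-elim (proj₁ (e x y lt) eq)
      ... | tri≈ _ x≡y _ = x≡y
      ... | tri> _ _ gt = ⊥-elim (proj₁ (e y x gt) (sym eq))
      distinct : ∀ x y → Edge H x y → x ≢ y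
      distinct x .x h refl with trans (sym h) (adj-irr H x)
      ... | ()
      colour : ∀ x y → x ≢ y → proj₁ c (f x) (f y) ≡ i
      colour x y ne with Fin.<-cmp x y
      ... | tri< lt _ _ = proj₂ (e x y lt)
      ... | tri≈ _ x≡y _ = ⊥-elim (ne x≡y)
      ... | tri> _ _ gt = trans (proj₂ c (f x) (f y) (does-not (f x Fin.≟ f y)
          (λ eq → ne (injective eq)))) (proj₂ (e y x gt))
      kept : ∀ x y → Edge H x y → Edge (colourClass completeGraph c i) (f x) (f y)
      kept x y h = ∧-intro (does-not (f x Fin.≟ f y) (λ eq → distinct x y h (injective eq)))
        (true-does (proj₁ c (f x) (f y) Fin.≟ i) (colour x y (distinct x y h)))
      oriented : ∀ x y z w → x ≢ y → z ≢ w → g x y Fin.< g z w →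
          lab (f x) (f y) Fin.< lab (f z) (f w)
      oriented x y z w ne ne′ lt with Fin.<-cmp x y | Fin.<-cmp z w
      ... | tri≈ _ x≡y _ | _ = ⊥-elim (ne x≡y)
      ... | _ | tri≈ _ z≡w _ = ⊥-elim (ne′ z≡w)
      ... | tri< l _ _ | tri< l′ _ _ = o x y z w l l′ lt
      ... | tri< l _ _ | tri> _ _ l′ rewrite lab-sym (f z) (f w) | g-sym z w = o x y w z l l′ lt
      ... | tri> _ _ l | tri< l′ _ _ rewrite lab-sym (f x) (f y) | g-sym x y = o y x z w l l′ lt
      ... | tri> _ _ l | tri> _ _ l′ rewrite lab-sym (f x) (f y) | g-sym x y | lab-sym (f z) (f w)
          | g-sym z w = o y x w z l l′ lt
      ordered : ∀ x y z w → Edge H x y → Edge H z w → label H x y < label H z w →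
        label (colourClass completeGraph c i) (f x) (f y) < label (colourClass completeGraph c i)
            (f z) (f w)
      ordered x y z w h h′ lt = Fin.combine-monoˡ-< (ends (f x) (f y)) (ends (f z) (f w))
        (oriented x y z w (distinct x y h) (distinct z w h′) (g-mono x y z w h lt))

module _ (m c p L : ℕ) (m≥1 : 1 ≤ m) (c≥1 : 1 ≤ c) (c≤m : c ≤ m) (n≤2^c : suc m ≤ 2 ^ c) where

  open Host m c p L m≥1 c≥1 c≤m n≤2^c using (P; κ; β; N; k; lab; lab-sym; β≢0; impossible)
  open Bounds m c m≥1 c≥1 c≤m κ using (n; s*)

  n²≤β : n * n ≤ β
  n²≤β = ≤-trans (*-mono-≤ n≤2^c n≤2^c) (≤-reflexive (trans (sym (^-distribˡ-+-* 2 c c))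
      (cong (λ z → 2 ^ (c + z)) (sym (+-identityʳ c)))))

  edgePattern : EOGraph n → Fin n → Fin n → Fin β
  edgePattern H x y = fromℕ< (<-≤-trans (rank<n² H x y) n²≤β)

  edgePattern-sym : ∀ H x y → edgePattern H x y ≡ edgePattern H y x
  edgePattern-sym H x y = Fin.toℕ-injective (trans (Fin.toℕ-fromℕ< _)
      (trans (rank-sym H x y) (sym (Fin.toℕ-fromℕ< _))))

  edgePattern-mono : ∀ H x y z w → Edge H x y → label H x y < label H z w →
      edgePattern H x y Fin.< edgePattern H z w
  edgePattern-mono H x y z w h lt = subst₂ _<_ (sym (Fin.toℕ-fromℕ< _)) (sym (Fin.toℕ-fromℕ< _))
      (rank-mono H x y z w h lt)

  module _ (enough : 2 * s* P + 2 * (n * (4 + κ)) + 3 * κ + 3 * c + 6 * n + 17 ≤ L) where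

    host : EOGraph N
    host = completeGraph (lab enough) (lab-sym enough)

    module _ (colouring : Colouring host (suc P)) where

      col : Fin N → Fin N → ℕ
      col x y = toℕ (proj₁ colouring x y)

      col-sym : ∀ x y → x ≢ y → col x y ≡ col y x
      col-sym x y ne = cong toℕ (proj₂ colouring x y (does-not (x Fin.≟ y) ne))

      col≤P : ∀ x y → col x y ≤ P
      col≤P x y = ≤-pred (Fin.toℕ<n (proj₁ colouring x y))

      module R = Regions {N} β (λ x y → toℕ (lab enough x y))
          (λ x y → cong toℕ (lab-sym enough x y)) col col-sym

      IsCopy : Fin (suc P) → (Fin n → Fin n → Fin β) → (Fin n → Fin N) → Set
      IsCopy = Copy (lab enough) (lab-sym enough) colouring

      monochromatic-copy : ∀ i g → R.Monochromatic (toℕ i) g → ∃ (IsCopy i g)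
      monochromatic-copy i g (r , v , f , exact) = f , copy
        (λ a b lt → not-does (f a Fin.≟ f b) (∧-elimˡ (exact a b lt)) ,
          Fin.toℕ-injective (does-true (col (f a) (f b) ≟ toℕ i)
            (∧-elimʳ {does (R.Q r (toℕ (lab enough (f a) (f b))) ≟ v * β + toℕ (g a b))}
              (∧-elimʳ {not (does (f a Fin.≟ f b))} (exact a b lt)))))
        (λ a b a′ b′ l₁ l₂ lt → R.Q-<-cancel r (subst₂ _<_ (sym (leading a b l₁))
            (sym (leading a′ b′ l₂)) (+-monoʳ-< (v * β) lt)))
        where
        leading : ∀ a b → a Fin.< b → R.Q r (toℕ (lab enough (f a) (f b))) ≡ v * β + toℕ (g a b)
        leading a b lt = does-true (R.Q r (toℕ (lab enough (f a) (f b))) ≟ v * β + toℕ (g a b))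
          (∧-elimˡ (∧-elimʳ {not (does (f a Fin.≟ f b))} (exact a b lt)))

      -- The recursion counts colours by natural numbers; those above `P` get the default `P`.
      clamp : ℕ → Fin (suc P)
      clamp i = fromℕ< (s≤s (m⊓n≤n i P))

      toℕ-clamp : ∀ i → i ≤ P → toℕ (clamp i) ≡ i
      toℕ-clamp i le = trans (Fin.toℕ-fromℕ< _) (m≤n⇒m⊓n≡m le)

      some-colour-universal : ∃ λ i → ∀ g → ∃ (IsCopy i g)
      some-colour-universal = resolve (universal-or-bad (lab enough) (lab-sym enough) {n} {suc P}
          {β} colouring)
        where
        resolve : (∃ λ i → ∀ g → ∃ (IsCopy i g)) ⊎ (∀ i → ∃ λ g → ∀ f → ¬ IsCopy i g f) → ∃ λ i →
            ∀ g → ∃ (IsCopy i g)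
        resolve (inj₁ found) = found
        resolve (inj₂ bad) = ⊥-elim (impossible enough col col-sym col≤P g none)
          where
          g : ℕ → Fin n → Fin n → Fin β
          g i = proj₁ (bad (clamp i))
          none : ∀ i → i ≤ P → ¬ R.Monochromatic i (g i)
          none i le mono =
            let f , k = monochromatic-copy (clamp i) (g i)
                    (subst (λ j → R.Monochromatic j (g i)) (sym (toℕ-clamp i le)) mono)
            in proj₂ (bad (clamp i)) f k

      host-universal : Σ (Fin (suc P)) λ i → (H : EOGraph n) →
          Contains (colourClass host colouring i) H
      host-universal = proj₁ some-colour-universal , λ H →
        let f , k = proj₂ some-colour-universal (edgePattern H)
        in contains (lab enough) (lab-sym enough) colouring H (edgePattern H) (edgePattern-sym H)
                (edgePattern-mono H) f k

-- The number of vertices and the assembly of the theorem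

atMostTwoPow : ∀ n q c M → 2 ≤ n → 2 ^ c < 2 * n → AtMostTwoPow (8 ^ (q + 1) * M) n q
    (2 ^ (8 * 4 ^ q * M * c ^ q))
atMostTwoPow n q c M n≥2 c-log s t _ lt = begin
  (2 ^ (8 * 4 ^ q * M * c ^ q)) ^ (t ^ q)   ≡⟨ ^-*-assoc 2 (8 * 4 ^ q * M * c ^ q) (t ^ q) ⟩
  2 ^ (8 * 4 ^ q * M * c ^ q * t ^ q)       ≤⟨ ^-monoʳ-≤ 2 exponent ⟩
  2 ^ (8 ^ (q + 1) * M * s ^ q)             ∎
  where
  open ≤-Reasoning
  cancel-< : ∀ {a b} → 2 ^ a < 2 ^ b → a < b
  cancel-< {a} {b} p = ≰⇒> λ le → <⇒≱ p (^-monoʳ-≤ 2 le)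
  t≤s : t ≤ s
  t≤s = <⇒≤ (cancel-< (≤-<-trans (^-monoˡ-≤ t n≥2) lt))
  -- With `s / t` above `log₂ n`, this expresses `c < 1 + log₂ n ≤ 2 log₂ n`, where the second
  -- inequality uses `2 ≤ n`.
  ct≤2s : c * t ≤ 2 * s
  ct≤2s = begin
    c * t          ≤⟨ 2^-cancel-≤ (begin
      2 ^ (c * t)        ≡⟨ sym (^-*-assoc 2 c t) ⟩
      (2 ^ c) ^ t        ≤⟨ ^-monoˡ-≤ t (<⇒≤ c-log) ⟩
      (2 * n) ^ t        ≡⟨ ^-distribʳ-* 2 n t ⟩
      2 ^ t * n ^ t      ≤⟨ *-monoʳ-≤ (2 ^ t) (<⇒≤ lt) ⟩
      2 ^ t * 2 ^ s      ≡⟨ sym (^-distribˡ-+-* 2 t s) ⟩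
      2 ^ (t + s)        ∎) ⟩
    t + s          ≤⟨ +-monoˡ-≤ s t≤s ⟩
    s + s          ≡⟨ cong (s +_) (sym (+-identityʳ s)) ⟩
    2 * s          ∎
  exponent : 8 * 4 ^ q * M * c ^ q * t ^ q ≤ 8 ^ (q + 1) * M * s ^ q
  exponent = begin
    8 * 4 ^ q * M * c ^ q * t ^ q        ≡⟨ *-assoc (8 * 4 ^ q * M) (c ^ q) (t ^ q) ⟩
    8 * 4 ^ q * M * (c ^ q * t ^ q)      ≡⟨ cong (8 * 4 ^ q * M *_) (sym (^-distribʳ-* c t q)) ⟩
    8 * 4 ^ q * M * (c * t) ^ q          ≤⟨ *-monoʳ-≤ (8 * 4 ^ q * M) (^-monoˡ-≤ q ct≤2s) ⟩
    8 * 4 ^ q * M * (2 * s) ^ q          ≡⟨ cong (8 * 4 ^ q * M *_) (^-distribʳ-* 2 s q) ⟩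
    8 * 4 ^ q * M * (2 ^ q * s ^ q)      ≡⟨ regroup 8 (4 ^ q) M (2 ^ q) (s ^ q) ⟩
    8 * (4 ^ q * 2 ^ q) * M * s ^ q      ≡⟨ cong (λ z → 8 * z * M * s ^ q)
        (sym (^-distribʳ-* 4 2 q)) ⟩
    8 ^ suc q * M * s ^ q                ≡⟨ cong (λ z → 8 ^ z * M * s ^ q) (sym (+-comm q 1)) ⟩
    8 ^ (q + 1) * M * s ^ q              ∎
    where
    regroup : ∀ a b m c s → a * b * m * (c * s) ≡ a * (b * c) * m * s
    regroup = solve-∀

-- For `n = 1` the logarithm vanishes and the bound allows a single vertex. It suffices, as a graph
-- on one vertex has no edges.
one-vertex : (q : ℕ) → 2 ≤ q → (M : ℕ) → Σ ℕ λ v → AtMostTwoPow M 1 q v × Σ (EOGraph v) λ G →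
  (c : Colouring G q) → Σ (Fin q) λ i → (H : EOGraph 1) → Contains (colourClass G c i) H
one-vertex (suc q) _ M = 1 , (λ s t _ _ → ≤-trans (≤-reflexive (^-zeroˡ (t ^ suc q)))
    (m^n>0 2 (M * s ^ suc q))) , point ,
  λ c → zero , λ H → (λ x → x) , (λ eq → eq) ,
    (λ { zero zero h → loop (trans (sym h) (adj-irr H zero)) }) ,
    (λ { zero zero _ _ h → loop (trans (sym h) (adj-irr H zero)) })
  where
  loop : ∀ {A : Set} → true ≡ false → A
  loop ()
  point : EOGraph 1
  point = record
    { adj = λ _ _ → false ; label = λ _ _ → 0 ; adj-sym = λ _ _ → refl ; adj-irr = λ _ → refl
    ; label-sym = λ _ _ → refl ; label-inj = λ _ _ _ _ () }

theorem3 : (n q : ℕ) → 1 ≤ n → 2 ≤ q →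
    Σ ℕ λ v →
    AtMostTwoPow (8 ^ (q + 1) * n ^ (2 * q ∸ 2)) n q v ×
    Σ (EOGraph v) λ G →
    (c : Colouring G q) →
    Σ (Fin q) λ i → (H : EOGraph n) → Contains (colourClass G c i) H
theorem3 (suc zero) q _ q≥2 = one-vertex q q≥2 (8 ^ (q + 1) * 1 ^ (2 * q ∸ 2))
theorem3 (suc (suc m)) (suc zero) _ (s≤s ())
theorem3 (suc (suc m)) (suc (suc p)) _ _ =
  2 ^ L , atMostTwoPow n q c (n ^ (2 * q ∸ 2)) (s≤s (s≤s z≤n)) c-log ,
  host (suc m) c p L (s≤s z≤n) c≥1 c≤m n≤2^c enough ,
  host-universal (suc m) c p L (s≤s z≤n) c≥1 c≤m n≤2^c enough
  where
  n q c L κ : ℕ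
  n = suc (suc m)
  q = suc (suc p)
  c = proj₁ (ceiling-log (suc m))
  -- Since `q ≥ 2`, `8 * 4 ^ q` covers the constant 128 of `Bounds.budget`. The rounding of `log₂ n`
  -- up to `c` contributes a further `2 ^ q`, and `8 * 4 ^ q * 2 ^ q = 8 ^ (q + 1)`.
  L = 8 * 4 ^ q * n ^ (2 * q ∸ 2) * c ^ q
  κ = 2 * c * digits (suc m) q
  n≤2^c : n ≤ 2 ^ c
  n≤2^c = proj₁ (proj₂ (ceiling-log (suc m)))
  c-log : 2 ^ c < 2 * n
  c-log = proj₂ (proj₂ (ceiling-log (suc m)))
  positive-log : ∀ c → suc (suc m) ≤ 2 ^ c → 1 ≤ c
  positive-log zero (s≤s ())
  positive-log (suc c) _ = s≤s z≤n
  c≥1 : 1 ≤ c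
  c≥1 = positive-log c n≤2^c
  small-log : ∀ c → 2 ^ c < 2 * suc (suc m) → c ≤ suc m
  small-log zero _ = z≤n
  small-log (suc c) lt = ≤-trans (n<2^n c) (≤-pred (*-cancelˡ-< 2 (2 ^ c) (suc (suc m)) lt))
  c≤m : c ≤ suc m
  c≤m = small-log c c-log
  enough : 2 * Bounds.s* (suc m) c (s≤s z≤n) c≥1 c≤m κ (suc p) + 2 * (n * (4 + κ)) + 3 * κ + 3 * c
      + 6 * n + 17 ≤ L
  enough = Bounds.budget (suc m) c (s≤s z≤n) c≥1 c≤m κ p L
      (*-monoʳ-≤ (2 * c) (digits-bound (suc m) (suc p))) (begin
    128 * (n ^ suc p * n ^ suc p * c ^ q)     ≡⟨ cong (λ z → 128 * (z * c ^ q))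
        (sym (^-distribˡ-+-* n (suc p) (suc p))) ⟩
    128 * (n ^ (suc p + suc p) * c ^ q)       ≡⟨ cong (λ z → 128 * (n ^ z * c ^ q)) (exponent p) ⟩
    128 * (n ^ (2 * q ∸ 2) * c ^ q)           ≡⟨ sym (*-assoc 128 (n ^ (2 * q ∸ 2)) (c ^ q)) ⟩
    128 * n ^ (2 * q ∸ 2) * c ^ q             ≤⟨ *-monoˡ-≤ (c ^ q)
        (*-monoˡ-≤ (n ^ (2 * q ∸ 2)) (*-monoʳ-≤ 8 16≤)) ⟩
    L                                         ∎)
    where
    open ≤-Reasoning
    exponent : ∀ p → suc p + suc p ≡ 2 * suc (suc p) ∸ 2
    exponent p = trans (+-suc (suc p) p) (trans (cong suc (sym (+-suc p p))) (lem p))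
      where
      lem : ∀ p → suc (p + suc p) ≡ p + suc (suc (p + 0))
      lem = solve-∀
    16≤ : 4 ^ 2 ≤ 4 ^ q
    16≤ = ^-monoʳ-≤ 4 {2} {q} (s≤s (s≤s z≤n))
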